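{- Let $p$ be an odd prime and $m\ge1$. For a positive divisor $d$ of $\frac{\phi(p^m)}{2}$ put $g_k(d)=\gcd\!\left(d,\frac{\phi(p^{m-k})}{2}\right)$ for $1\le k\le m-1$, $$Q_d(x)=\left(1+x^{\frac{\phi(p^m)}{d}}\right)^{d},\qquad P_d(x)=\prod_{k=1}^{m-1}\left(1+x^{\frac{\phi(p^{m-k})}{g_k(d)}}\right)^{g_k(d)}.$$ Then $$\Psi^w_{\mathbb{Z}_{2p^m}}(x)=\frac{2}{p^{m-1}(p-1)}\sum_{d\mid\frac{\phi(p^m)}{2}}\phi\!\left(\frac{\phi(p^m)}{2d}\right)\Big[(Q_d(x)-1)\,Q_d(x)\,P_d(x)^2(1+x)+(Q_d(x)-1)\big(P_d(x)(1+x)-1\big)P_d(x)\Big],$$ and hence $$\mathcal{E}^w(\mathbb{Z}_{2p^m})=\Psi^w_{\mathbb{Z}_{2p^m}}(1)=\frac{2}{p^{m-1}(p-1)}\sum_{d\mid\frac{\phi(p^m)}{2}}\phi\!\left(\frac{\phi(p^m)}{2d}\right)\Big[2^{d+1}(2^d-1)\prod_{k=1}^{m-1}2^{2g_k(d)}+(2^d-1)\Big(2\prod_{k=1}^{m-1}2^{g_k(d)}-1\Big)\prod_{k=1}^{m-1}2^{g_k(d)}\Big].$$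
   Context: $\phi$ is Euler's totient function; empty products equal $1$. For the cyclic group $\mathbb{Z}_n$ and a generating set $\Omega$ with $\Omega=-\Omega$, $0\notin\Omega$, the Cayley graph $C(\mathbb{Z}_n,\Omega)$ has vertex set $\mathbb{Z}_n$ and edges $\{g,h\}$ with $h-g\in\Omega$, with $\mathbb{Z}_n$ acting by translation. A graph isomorphism $f$ between two such Cayley graphs is a weak equivalence if there is a group automorphism $\alpha$ of $\mathbb{Z}_n$ with $f(g+u)=\alpha(g)+f(u)$ for all $g,u$. $a^w_k(\mathbb{Z}_n)$ is the number of weak equivalence classes of Cayley graphs $C(\mathbb{Z}_n,\Omega)$ with $|\Omega|=k$, $\Psi^w_{\mathbb{Z}_n}(x)=\sum_{k=1}^{n-1}a^w_k(\mathbb{Z}_n)x^k$, and $\mathcal{E}^w(\mathbb{Z}_n)$ is the number of weak equivalence classes. -}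

module Defs where

open import Data.Nat using (ℕ; zero; suc; _+_; _*_; _∸_; _^_; _≤_; _<_)
open import Data.Nat.DivMod using (_/_; _mod_)
open import Data.Nat.GCD using (gcd)
open import Data.Nat.Divisibility using (_∣?_)
open import Data.Fin using (Fin; toℕ)
open import Data.Fin.Subset using (Subset; _∈_; _∉_; ∣_∣)
open import Data.List using (List; []; _∷_; map; upTo; filter; length)
open import Data.Nat.ListAction using (sum; product)
open import Data.Product using (Σ; ∃; _×_; _,_)
open import Data.Empty using (⊥)
open import Relation.Nullary using (¬_)
open import Relation.Binary.PropositionalEquality using (_≡_)
open import Function.Bundles using (_⇔_)
import Data.Nat as ℕ

φ : ℕ → ℕ
φ n = length (filter (λ j → gcd (suc j) n ℕ.≟ 1) (upTo n))

-- division, with the (never used) convention a div 0 = 0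
_div_ : ℕ → ℕ → ℕ
a div zero = 0
a div suc b = a / suc b

sumDiv : ℕ → (ℕ → ℕ) → ℕ
sumDiv N f = sum (map (λ i → f (suc i)) (filter (λ i → suc i ∣? N) (upTo N)))

prodK : ℕ → (ℕ → ℕ) → ℕ
prodK m f = product (map (λ j → f (suc j)) (upTo (m ∸ 1)))

-- Polynomials with natural-number coefficients, as coefficient sequences

Poly : Set
Poly = ℕ → ℕ

pconst : ℕ → Poly
pconst c zero = c
pconst c (suc k) = 0

xpow : ℕ → Poly
xpow e k with e ℕ.≟ k
... | Relation.Nullary.yes _ = 1
... | Relation.Nullary.no _ = 0

infixl 6 _⊕_
infixl 7 _⊛_
_⊕_ : Poly → Poly → Poly
(f ⊕ g) k = f k + g k

_⊛_ : Poly → Poly → Poly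
(f ⊛ g) k = sum (map (λ i → f i * g (k ∸ i)) (upTo (suc k)))

-- f - 1 (only applied to polynomials with constant term ≥ 1, so exact)
minus1 : Poly → Poly
minus1 f zero = f zero ∸ 1
minus1 f (suc k) = f (suc k)

ppow : Poly → ℕ → Poly
ppow f zero = pconst 1
ppow f (suc e) = f ⊛ ppow f e

pscale : ℕ → Poly → Poly
pscale c f k = c * f k

psum : List Poly → Poly
psum [] = pconst 0
psum (f ∷ fs) = f ⊕ psum fs

pprod : List Poly → Poly
pprod [] = pconst 1
pprod (f ∷ fs) = f ⊛ pprod fs

gk : ℕ → ℕ → ℕ → ℕ → ℕ
gk p m d k = gcd d (φ (p ^ (m ∸ k)) / 2)

Qd : ℕ → ℕ → ℕ → Poly
Qd p m d = ppow (pconst 1 ⊕ xpow (φ (p ^ m) div d)) d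

Pd : ℕ → ℕ → ℕ → Poly
Pd p m d = pprod (map (λ j → let k = suc j in
             ppow (pconst 1 ⊕ xpow (φ (p ^ (m ∸ k)) div gk p m d k)) (gk p m d k))
           (upTo (m ∸ 1)))

onePlusX : Poly
onePlusX = pconst 1 ⊕ xpow 1

bracket : ℕ → ℕ → ℕ → Poly
bracket p m d =
  (minus1 Q ⊛ Q ⊛ P ⊛ P ⊛ onePlusX) ⊕ (minus1 Q ⊛ minus1 (P ⊛ onePlusX) ⊛ P)
  where
  Q = Qd p m d
  P = Pd p m d

RHSpoly : ℕ → ℕ → Poly
RHSpoly p m = psum (map (λ i → let d = suc i in
                  pscale (φ (φ (p ^ m) div (2 * d))) (bracket p m d))
                (filter (λ i → suc i ∣? (φ (p ^ m) / 2)) (upTo (φ (p ^ m) / 2))))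

RHSnum : ℕ → ℕ → ℕ
RHSnum p m = sumDiv (φ (p ^ m) / 2) (λ d →
  φ (φ (p ^ m) div (2 * d)) *
    ( 2 ^ (d + 1) * (2 ^ d ∸ 1) * prodK m (λ k → 2 ^ (2 * gk p m d k))
    + (2 ^ d ∸ 1) * (2 * prodK m (λ k → 2 ^ gk p m d k) ∸ 1) * prodK m (λ k → 2 ^ gk p m d k)))

module Cyclic (n' : ℕ) where
  n : ℕ
  n = suc n'

  Zn : Set
  Zn = Fin n

  _+ₙ_ : Zn → Zn → Zn
  a +ₙ b = (toℕ a + toℕ b) mod n

  -ₙ_ : Zn → Zn
  -ₙ a = (n ∸ toℕ a) mod n

  _-ₙ_ : Zn → Zn → Zn
  a -ₙ b = a +ₙ (-ₙ b)

  0ₙ : Zn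
  0ₙ = 0 mod n

  -- subgroup generated by Ω (closure of {0} under adding elements of Ω;
  -- in a finite group this is the generated subgroup)
  data Gen (Ω : Subset n) : Zn → Set where
    gen0 : Gen Ω 0ₙ
    genS : ∀ {g h} → g ∈ Ω → Gen Ω h → Gen Ω (g +ₙ h)

  Admissible : Subset n → Set
  Admissible Ω = (∀ g → g ∈ Ω → (-ₙ g) ∈ Ω) × (0ₙ ∉ Ω) × (∀ g → Gen Ω g)

  Bijective : (Zn → Zn) → Set
  Bijective f = Σ (Zn → Zn) λ f⁻¹ → (∀ x → f⁻¹ (f x) ≡ x) × (∀ y → f (f⁻¹ y) ≡ y)

  Automorphism : (Zn → Zn) → Set
  Automorphism α = Bijective α × (∀ a b → α (a +ₙ b) ≡ α a +ₙ α b)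

  Adj : Subset n → Zn → Zn → Set
  Adj Ω g h = (h -ₙ g) ∈ Ω

  GraphIso : Subset n → Subset n → (Zn → Zn) → Set
  GraphIso Ω Ω' f = Bijective f × (∀ g h → Adj Ω g h ⇔ Adj Ω' (f g) (f h))

  WeakEquiv : Subset n → Subset n → Set
  WeakEquiv Ω Ω' = Σ (Zn → Zn) λ f → Σ (Zn → Zn) λ α →
    GraphIso Ω Ω' f × Automorphism α × (∀ g u → f (g +ₙ u) ≡ α g +ₙ f u)

  -- "the admissible Ω satisfying S fall into exactly N weak equivalence classes":
  -- there are N pairwise weakly inequivalent representatives satisfying S such
  -- that every admissible Ω satisfying S is weakly equivalent to one of them
  NumClasses : (Subset n → Set) → ℕ → Set
  NumClasses S N = Σ (Fin N → Subset n) λ r →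
      (∀ i → Admissible (r i) × S (r i))
    × (∀ i j → WeakEquiv (r i) (r j) → i ≡ j)
    × (∀ Ω → Admissible Ω → S Ω → ∃ λ i → WeakEquiv Ω (r i))

  IsAwK : ℕ → ℕ → Set
  IsAwK k N = NumClasses (λ Ω → ∣ Ω ∣ ≡ k) N

  IsEw : ℕ → Set
  IsEw N = NumClasses (λ _ → Data.Unit.⊤) N
    where import Data.Unit

-- wrappers for arbitrary n (ℤ_0 is not considered: the predicates are empty)
IsAwK : ℕ → ℕ → ℕ → Set
IsAwK zero k N = ⊥
IsAwK (suc n') k N = Cyclic.IsAwK n' k N

IsEw : ℕ → ℕ → Set
IsEw zero N = ⊥
IsEw (suc n') N = Cyclic.IsEw n' N

sumRange : ℕ → ℕ → (ℕ → ℕ) → ℕ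
sumRange a b f = sum (map (λ i → f (a + i)) (upTo (suc b ∸ a)))

{-# OPTIONS --safe #-}

-- Let n = 2q with q = pᵐ, h = φ(q)/2, and let g be an odd primitive root modulo every power of p.
-- A weak equivalence f maps the connection set by the automorphism α, and every unit of ℤₙ is a power
-- of g; so the classes of connection sets are the orbits of Ω ↦ g⁻¹Ω. On symmetric sets the h-th power
-- of this map is the identity because g^h = -1. Burnside's lemma therefore gives h times the number of
-- classes as the sum over i = 1 , … , h of the number of admissible sets fixed by g^i; this number only
-- depends on d = gcd(i, h), and each divisor d of h arises from φ(h/d) exponents i.
-- A nonzero element other than q is, modulo q, of the form p^k g^t for a unique k < m and a unique t
-- modulo φ(p^(m-k)), and is odd or even. A set fixed by g^d is thus a choice, for each k and each
-- parity, of a subset of ℤ modulo gcd(d, φ(p^(m-k))) = g_k(d), together with the membership of q. It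
-- generates ℤₙ iff it contains an odd element and an element prime to p; the two summands of the bracket
-- count the sets that contain an odd unit and those that do not.

module Submission where

open import Defs
open import Data.Nat
  using (ℕ; zero; suc; pred; _+_; _*_; _∸_; _^_; _≤_; _<_; _%_; _/_; z≤n; s≤s; _≟_; _≤?_; NonZero
        ; ≢-nonZero; >-nonZero; nonTrivial⇒n>1; ≢-nonZero⁻¹)
open import Data.Nat.Properties
  using (+-comm; ^-zeroˡ; +-assoc; +-identityʳ; *-comm; *-assoc; *-identityˡ; *-identityʳ; *-zeroʳ
        ; *-distribˡ-+; *-distribʳ-+; +-mono-≤; +-monoʳ-≤; *-monoʳ-≤; *-mono-≤; +-cancelˡ-≡
        ; +-cancelʳ-≡; *-cancelˡ-≡; *-cancelʳ-≡; +-cancelˡ-≤; ≤-refl; ≤-reflexive; ≤-trans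
        ; ≤-antisym; <-trans; ≤-<-trans; <-irrefl; <⇒≤; <⇒≢; <⇒≱; m≤m+n; m≤n+m; n<1+n; ≤-pred
        ; suc-injective; suc-pred; m+n≡0⇒m≡0; m+n≡0⇒n≡0; m+n∸m≡n; m+[n∸m]≡n; m∸n+n≡m
        ; ^-distribˡ-+-*; ^-*-assoc; m^n>0; m*n≢0; m^n≢0; m<n⇒0<n∸m; n≢0⇒n>0; ≤-total; n≤0⇒n≡0
        ; +-suc; 1+n≢0; ≤∧≢⇒<; m≤m*n; n>0⇒n≢0; anyUpTo?; ^-identityʳ)
open import Data.Nat.Divisibility
  using (_∣_; _∤_; divides; _∣?_; ∣-refl; ∣-trans; ∣-antisym; ∣⇒≤; ∣1⇒≡1; 0∣⇒≡0; _∣0; 1∣_; m∣m*n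
        ; n∣m*n; ∣n⇒∣m*n; ∣m∣n⇒∣m+n; ∣m+n∣m⇒∣n; *-monoʳ-∣; *-monoˡ-∣; *-cancelˡ-∣; m%n≡0⇒n∣m
        ; n∣m⇒m%n≡0)
open import Data.Nat.DivMod
  using (_mod_; m≡m%n+[m/n]*n; m%n<n; m<n⇒m%n≡m; [m+kn]%n≡m%n; m*n/n≡m; m/n*n≡m)
open import Data.Nat.GCD
  using (gcd; gcd[m,n]∣m; gcd[m,n]∣n; gcd-greatest; c*gcd[m,n]≡gcd[cm,cn]; gcd-GCD; module Bézout)
open import Data.Nat.Coprimality using (Coprime; coprime-Bézout; coprime-divisor; coprime⇒gcd≡1)
open import Data.Nat.Primality
  using (Prime; euclidsLemma; prime⇒nonZero; prime⇒nonTrivial; prime⇒irreducible; prime[2])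
open import Data.Nat.ListAction using (sum; product)
open import Data.Nat.Tactic.RingSolver using (solve-∀)
open import Data.Bool using (Bool; true; false; if_then_else_)
import Data.Bool as Bool
open import Data.Fin using (Fin; toℕ)
import Data.Fin as Fin
open import Data.Fin.Properties using (toℕ<n; toℕ-injective; toℕ-fromℕ<; pigeonhole)
open import Data.Fin.Subset using (Subset; _∈_; _∉_; ∣_∣)
import Data.List as List
open import Data.List
  using (List; []; _∷_; _++_; map; upTo; filter; length; lookup; cartesianProductWith; allFin
        ; tabulate)
open import Data.List.Properties
  using (map-applyUpTo; map-upTo; length-upTo; length-map; length-replicate)
open import Data.List.Membership.Propositional using () renaming (_∈_ to _∈ᴸ_)
open import Data.List.Membership.Propositional.Properties using (∈-filter⁺; ∈-filter⁻; ∈-lookup)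
open import Data.List.Relation.Unary.Any using (here; there; index)
open import Data.List.Relation.Unary.Any.Properties using (lookup-index)
open import Data.List.Relation.Unary.All using (All; []; _∷_)
import Data.List.Relation.Unary.All as All
import Data.List.Relation.Unary.All.Properties as Allₚ
open import Data.List.Relation.Unary.AllPairs using (AllPairs; []; _∷_)
import Data.List.Relation.Unary.AllPairs.Properties as AllPairsₚ
open import Data.Vec using (Vec; []; _∷_; replicate)
import Data.Vec as Vec
import Data.Vec.Properties as Vecₚ
open import Data.Product using (∃; ∃-syntax; _×_; _,_; proj₁; proj₂)
import Data.Product.Properties as Prodₚ
open import Data.Sum using (_⊎_; inj₁; inj₂; [_,_]′)
open import Data.Unit using (⊤; tt)
open import Function using (_∘_; id; case_of_)
open import Function.Bundles using (mk⇔; Equivalence)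
open import Relation.Nullary using (¬_; Dec; yes; no; does; contradiction)
open import Relation.Nullary.Decidable using (map′; _×-dec_; _⊎-dec_; ¬?; decidable-stable)
open import Relation.Binary.Definitions using (DecidableEquality)
open import Relation.Binary.PropositionalEquality
  using (_≡_; _≢_; refl; sym; trans; cong; cong₂; subst; subst₂; module ≡-Reasoning)

-- One `g` serving every power of p is what makes the count possible: multiplication by g^d is then
-- translation by d of the exponents in all blocks at once, so the blocks may be chosen
-- independently. Oddness of `g` makes it a unit modulo 2q as well: odd numbers congruent modulo q
-- are congruent modulo 2q, so the discrete logarithm modulo q already settles the units of the
-- whole ring. Symmetry never enters the count as a separate condition. As d divides h and g^h = -1,
-- a set fixed by g^d is automatically symmetric; and the group acting on symmetric sets has
-- exponent h = p^(m-1)(p-1)/2, whose inverse is the constant in front of the sum. The existence of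
-- `g` and of discrete logarithms is obtained by counting: a termwise inequality whose two sides
-- have the same total must be an equality everywhere.

private
  variable
    𝔸 𝔹 ℂ : Set
    ℙ 𝕊 : Set

-- Indicators of decidable propositions

ind : Dec ℙ → ℕ
ind (yes _) = 1
ind (no _)  = 0

ind-yes : (d : Dec ℙ) → ℙ → ind d ≡ 1
ind-yes (yes _) _ = refl
ind-yes (no ¬p) p = contradiction p ¬p

ind-no : (d : Dec ℙ) → ¬ ℙ → ind d ≡ 0
ind-no (yes p) ¬p = contradiction p ¬p
ind-no (no _)  _  = refl

ind-cong : (d : Dec ℙ) (e : Dec 𝕊) → (ℙ → 𝕊) → (𝕊 → ℙ) → ind d ≡ ind e
ind-cong (yes p) e f g = sym (ind-yes e (f p))
ind-cong (no ¬p) e f g = sym (ind-no e (¬p ∘ g))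

ind>0⇒ : (d : Dec ℙ) → 0 < ind d → ℙ
ind>0⇒ (yes p) _ = p

ind-× : (d : Dec ℙ) (e : Dec 𝕊) → ind (d ×-dec e) ≡ ind d * ind e
ind-× (yes _) (yes _) = refl
ind-× (yes _) (no _)  = refl
ind-× (no _)  e       = refl

ind-*-cong : (d : Dec ℙ) {x y : ℕ} → (ℙ → x ≡ y) → ind d * x ≡ ind d * y
ind-*-cong (yes p) f = cong (1 *_) (f p)
ind-*-cong (no _)  f = refl

-- Finite sums over lists

∑ : List 𝔸 → (𝔸 → ℕ) → ℕ
∑ []       f = 0
∑ (x ∷ xs) f = f x + ∑ xs f

∑-sum : (xs : List 𝔸) (f : 𝔸 → ℕ) → sum (map f xs) ≡ ∑ xs f
∑-sum []       f = refl
∑-sum (x ∷ xs) f = cong (f x +_) (∑-sum xs f)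

∑< : ℕ → (ℕ → ℕ) → ℕ
∑< n = ∑ (upTo n)

∑-cong : (xs : List 𝔸) {f g : 𝔸 → ℕ} → (∀ x → f x ≡ g x) → ∑ xs f ≡ ∑ xs g
∑-cong []       eq = refl
∑-cong (x ∷ xs) eq = cong₂ _+_ (eq x) (∑-cong xs eq)

∑-zero : (xs : List 𝔸) {f : 𝔸 → ℕ} → (∀ x → f x ≡ 0) → ∑ xs f ≡ 0
∑-zero []       eq = refl
∑-zero (x ∷ xs) eq = cong₂ _+_ (eq x) (∑-zero xs eq)

∑-mono : (xs : List 𝔸) {f g : 𝔸 → ℕ} → (∀ x → f x ≤ g x) → ∑ xs f ≤ ∑ xs g
∑-mono []       le = z≤n
∑-mono (x ∷ xs) le = +-mono-≤ (le x) (∑-mono xs le)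

+-interchange : ∀ a b c d → (a + b) + (c + d) ≡ (a + c) + (b + d)
+-interchange = solve-∀

∑-+ : (xs : List 𝔸) (f g : 𝔸 → ℕ) → ∑ xs (λ x → f x + g x) ≡ ∑ xs f + ∑ xs g
∑-+ []       f g = refl
∑-+ (x ∷ xs) f g = trans (cong (f x + g x +_) (∑-+ xs f g)) (+-interchange (f x) (g x) _ _)

∑-*ˡ : (xs : List 𝔸) (c : ℕ) (f : 𝔸 → ℕ) → ∑ xs (λ x → c * f x) ≡ c * ∑ xs f
∑-*ˡ []       c f = sym (*-zeroʳ c)
∑-*ˡ (x ∷ xs) c f = trans (cong (c * f x +_) (∑-*ˡ xs c f)) (sym (*-distribˡ-+ c (f x) _))

∑-*ʳ : (xs : List 𝔸) (c : ℕ) (f : 𝔸 → ℕ) → ∑ xs (λ x → f x * c) ≡ ∑ xs f * c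
∑-*ʳ xs c f = trans (∑-cong xs λ x → *-comm (f x) c) (trans (∑-*ˡ xs c f) (*-comm c _))

∑-const : (xs : List 𝔸) (c : ℕ) → ∑ xs (λ _ → c) ≡ length xs * c
∑-const []       c = refl
∑-const (x ∷ xs) c = cong (c +_) (∑-const xs c)

∑-swap : (xs : List 𝔸) (ys : List 𝔹) (f : 𝔸 → 𝔹 → ℕ) →
         ∑ xs (λ x → ∑ ys (f x)) ≡ ∑ ys (λ y → ∑ xs (λ x → f x y))
∑-swap []       ys f = sym (∑-zero ys λ _ → refl)
∑-swap (x ∷ xs) ys f = trans (cong (∑ ys (f x) +_) (∑-swap xs ys f)) (sym (∑-+ ys (f x) _))

∑-++ : (xs ys : List 𝔸) (f : 𝔸 → ℕ) → ∑ (xs ++ ys) f ≡ ∑ xs f + ∑ ys f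
∑-++ []       ys f = refl
∑-++ (x ∷ xs) ys f = trans (cong (f x +_) (∑-++ xs ys f)) (sym (+-assoc (f x) _ _))

∑-map : (h : 𝔹 → 𝔸) (ys : List 𝔹) (f : 𝔸 → ℕ) → ∑ (map h ys) f ≡ ∑ ys (f ∘ h)
∑-map h []       f = refl
∑-map h (y ∷ ys) f = cong (f (h y) +_) (∑-map h ys f)

∑-prod : (c : 𝔸 → 𝔹 → ℂ) (xs : List 𝔸) (ys : List 𝔹) (f : ℂ → ℕ) →
         ∑ (cartesianProductWith c xs ys) f ≡ ∑ xs (λ x → ∑ ys (λ y → f (c x y)))
∑-prod c []       ys f = refl
∑-prod c (x ∷ xs) ys f =
  trans (∑-++ (map (c x) ys) _ f) (cong₂ _+_ (∑-map (c x) ys f) (∑-prod c xs ys f))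

∑-filter : {R : 𝔸 → Set} (R? : ∀ x → Dec (R x)) (xs : List 𝔸) (f : 𝔸 → ℕ) →
           ∑ (filter R? xs) f ≡ ∑ xs (λ x → ind (R? x) * f x)
∑-filter R? []       f = refl
∑-filter R? (x ∷ xs) f with R? x
... | yes _ = cong₂ _+_ (sym (+-identityʳ _)) (∑-filter R? xs f)
... | no _  = ∑-filter R? xs f

length-filter-∑ : {R : 𝔸 → Set} (R? : ∀ x → Dec (R x)) (xs : List 𝔸) →
                  length (filter R? xs) ≡ ∑ xs (λ x → ind (R? x))
length-filter-∑ R? []       = refl
length-filter-∑ R? (x ∷ xs) with R? x
... | yes _ = cong suc (length-filter-∑ R? xs)
... | no _  = length-filter-∑ R? xs

∑<-suc : ∀ n (f : ℕ → ℕ) → ∑< (suc n) f ≡ f 0 + ∑< n (f ∘ suc)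
∑<-suc n f = cong (f 0 +_) (trans (cong (λ l → ∑ l f) (sym (map-upTo suc n))) (∑-map suc (upTo n) f))

∑<-snoc : ∀ n (f : ℕ → ℕ) → ∑< (suc n) f ≡ ∑< n f + f n
∑<-snoc zero    f = +-comm (f 0) 0
∑<-snoc (suc n) f = begin
  ∑< (suc (suc n)) f                ≡⟨ ∑<-suc (suc n) f ⟩
  f 0 + ∑< (suc n) (f ∘ suc)        ≡⟨ cong (f 0 +_) (∑<-snoc n (f ∘ suc)) ⟩
  f 0 + (∑< n (f ∘ suc) + f (suc n)) ≡⟨ sym (+-assoc (f 0) _ _) ⟩
  f 0 + ∑< n (f ∘ suc) + f (suc n)  ≡⟨ cong (_+ f (suc n)) (sym (∑<-suc n f)) ⟩
  ∑< (suc n) f + f (suc n) ∎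
  where open ≡-Reasoning

∑<-+ : ∀ m n (f : ℕ → ℕ) → ∑< (m + n) f ≡ ∑< m f + ∑< n (λ i → f (m + i))
∑<-+ zero    n f = refl
∑<-+ (suc m) n f = trans (∑<-suc (m + n) f) (trans (cong (f 0 +_) (∑<-+ m n (f ∘ suc)))
  (trans (sym (+-assoc (f 0) _ _)) (cong (_+ ∑< n (λ i → f (suc m + i))) (sym (∑<-suc m f)))))

∑<-cong : ∀ n {f g : ℕ → ℕ} → (∀ i → i < n → f i ≡ g i) → ∑< n f ≡ ∑< n g
∑<-cong zero    eq = refl
∑<-cong (suc n) {f} {g} eq = trans (∑<-suc n f)
  (trans (cong₂ _+_ (eq 0 (s≤s z≤n)) (∑<-cong n (λ i i<n → eq (suc i) (s≤s i<n)))) (sym (∑<-suc n g)))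

∑<-const : ∀ n c → ∑< n (λ _ → c) ≡ n * c
∑<-const n c = trans (∑-const (upTo n) c) (cong (_* c) (length-upTo n))

∑<-blocks : ∀ N d (f : ℕ → ℕ) → ∑< (N * d) f ≡ ∑< N (λ i → ∑< d (λ j → f (i * d + j)))
∑<-blocks zero    d f = refl
∑<-blocks (suc N) d f = begin
  ∑< (d + N * d) f                                        ≡⟨ ∑<-+ d (N * d) f ⟩
  ∑< d f + ∑< (N * d) (λ i → f (d + i))                    ≡⟨ cong (∑< d f +_) (∑<-blocks N d _) ⟩
  ∑< d f + ∑< N (λ i → ∑< d (λ j → f (d + (i * d + j))))
    ≡⟨ cong (∑< d f +_) (∑-cong (upTo N) λ i → ∑-cong (upTo d) λ j → cong f (sym (+-assoc d (i * d) j))) ⟩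
  ∑< d f + ∑< N (λ i → ∑< d (λ j → f (suc i * d + j)))     ≡⟨ sym (∑<-suc N _) ⟩
  ∑< (suc N) (λ i → ∑< d (λ j → f (i * d + j))) ∎
  where open ≡-Reasoning

∑<-single : ∀ n {f : ℕ → ℕ} j → j < n → (∀ i → i < n → i ≢ j → f i ≡ 0) → ∑< n f ≡ f j
∑<-single (suc n) {f} zero    _         z = trans (∑<-suc n f)
  (trans (cong (f 0 +_) (trans (∑<-cong n (λ i i<n → z (suc i) (s≤s i<n) λ ())) (∑-zero (upTo n) λ _ → refl))) (+-identityʳ _))
∑<-single (suc n) {f} (suc j) (s≤s j<n) z = trans (∑<-suc n f)
  (cong₂ _+_ (z 0 (s≤s z≤n) λ ()) (∑<-single n j j<n λ i i<n i≢j → z (suc i) (s≤s i<n) (i≢j ∘ suc-injective)))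

∑<-≥ : ∀ n (f : ℕ → ℕ) j → j < n → f j ≤ ∑< n f
∑<-≥ (suc n) f zero    _         = ≤-trans (m≤m+n (f 0) _) (≤-reflexive (sym (∑<-suc n f)))
∑<-≥ (suc n) f (suc j) (s≤s j<n) =
  ≤-trans (∑<-≥ n (f ∘ suc) j j<n) (≤-trans (m≤n+m _ (f 0)) (≤-reflexive (sym (∑<-suc n f))))

∑<-mono : ∀ n {f g : ℕ → ℕ} → (∀ i → i < n → f i ≤ g i) → ∑< n f ≤ ∑< n g
∑<-mono zero    le = z≤n
∑<-mono (suc n) {f} {g} le = ≤-trans (≤-reflexive (∑<-suc n f)) (≤-trans
  (+-mono-≤ (le 0 (s≤s z≤n)) (∑<-mono n λ i i<n → le (suc i) (s≤s i<n))) (≤-reflexive (sym (∑<-suc n g))))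

+-squeeze : ∀ {a b c d} → a ≤ c → b ≤ d → a + b ≡ c + d → a ≡ c × b ≡ d
+-squeeze {a} {b} {c} {d} a≤c b≤d eq = a≡c , +-cancelˡ-≡ a b d (trans eq (cong (_+ d) (sym a≡c)))
  where
  c≤a : c ≤ a
  c≤a = +-cancelˡ-≤ d c a (≤-trans (≤-reflexive (trans (+-comm d c) (sym eq)))
          (≤-trans (+-monoʳ-≤ a b≤d) (≤-reflexive (+-comm a d))))
  a≡c = ≤-antisym a≤c c≤a

-- Turns counts into existence: a termwise bound whose totals agree is attained at every index. Both
-- the primitive root and the discrete logarithm come from it.
∑<-squeeze : ∀ n {f g : ℕ → ℕ} → (∀ i → i < n → f i ≤ g i) → ∑< n f ≡ ∑< n g → ∀ i → i < n → f i ≡ g i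
∑<-squeeze (suc n) {f} {g} le eq = go
  where
  both : f 0 ≡ g 0 × ∑< n (f ∘ suc) ≡ ∑< n (g ∘ suc)
  both = +-squeeze (le 0 (s≤s z≤n)) (∑<-mono n λ i i<n → le (suc i) (s≤s i<n))
                   (trans (sym (∑<-suc n f)) (trans eq (∑<-suc n g)))
  go : ∀ i → i < suc n → f i ≡ g i
  go zero    _         = proj₁ both
  go (suc i) (s≤s i<n) = ∑<-squeeze n (λ i i<n → le (suc i) (s≤s i<n)) (proj₂ both) i i<n

∑<>0⇒ : ∀ n (f : ℕ → ℕ) → 0 < ∑< n f → ∃[ i ] (i < n × 0 < f i)
∑<>0⇒ (suc n) f pos = go (f 0) refl
  where
  go : ∀ k → f 0 ≡ k → ∃[ i ] (i < suc n × 0 < f i)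
  go (suc k) eq = 0 , s≤s z≤n , subst (0 <_) (sym eq) (s≤s z≤n)
  go zero    eq with ∑<>0⇒ n (f ∘ suc) (subst (0 <_) (trans (∑<-suc n f) (cong (_+ ∑< n (f ∘ suc)) eq)) pos)
  ... | i , i<n , p = suc i , s≤s i<n , p

∑<-ind≤1 : ∀ n {R : ℕ → Set} (R? : ∀ i → Dec (R i)) →
           (∀ i j → i < n → j < n → R i → R j → i ≡ j) → ∑< n (λ i → ind (R? i)) ≤ 1
∑<-ind≤1 zero    R? uniq = z≤n
∑<-ind≤1 (suc n) R? uniq = ≤-trans (≤-reflexive (∑<-suc n _)) (go (R? 0))
  where
  go : (d : Dec _) → ind d + ∑< n (λ i → ind (R? (suc i))) ≤ 1
  go (yes r) = s≤s (≤-reflexive (trans (∑<-cong n λ i i<n → ind-no (R? (suc i)) λ r′ →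
                 1+n≢0 (uniq (suc i) 0 (s≤s i<n) (s≤s z≤n) r′ r)) (∑-zero (upTo n) λ _ → refl)))
  go (no _)  = ∑<-ind≤1 n (R? ∘ suc) λ i j i<n j<n ri rj → suc-injective (uniq _ _ (s≤s i<n) (s≤s j<n) ri rj)

-- Enumerations of finite types

-- Multiplicity is measured by a sum, so that `once` can be inserted directly when sums are
-- exchanged. Membership and distinctness are recovered by `Enum⇒∈` and `∑≤1⇒distinct`.
record Enum {A : Set} (_≟_ : DecidableEquality A) (xs : List A) : Set where
  constructor mk-enum
  field once : ∀ a → ∑ xs (λ x → ind (x ≟ a)) ≡ 1

open Enum using (once) public

∑-collapse : {_≟_ : DecidableEquality 𝔸} {xs : List 𝔸} → Enum _≟_ xs → ∀ a (f : 𝔸 → ℕ) →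
             ∑ xs (λ x → ind (x ≟ a) * f x) ≡ f a
∑-collapse {_≟_ = _≟_} {xs} en a f = begin
  ∑ xs (λ x → ind (x ≟ a) * f x) ≡⟨ ∑-cong xs (λ x → ind-*-cong (x ≟ a) (cong f)) ⟩
  ∑ xs (λ x → ind (x ≟ a) * f a) ≡⟨ ∑-*ʳ xs (f a) _ ⟩
  ∑ xs (λ x → ind (x ≟ a)) * f a ≡⟨ cong (_* f a) (once en a) ⟩
  1 * f a                        ≡⟨ *-identityˡ (f a) ⟩
  f a ∎
  where open ≡-Reasoning

-- Both sides are the sum over the pairs with `R a` and `b ≡ g a`; for these pairs the equation is
-- equivalent to `a ≡ f b`. That `g` maps `R` into `S` follows from `f (g a) ≡ a` and the last
-- implication.
∑-bijection : {_≟A_ : DecidableEquality 𝔸} {_≟B_ : DecidableEquality 𝔹} {xs : List 𝔸} {ys : List 𝔹} →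
  Enum _≟A_ xs → Enum _≟B_ ys → {R : 𝔸 → Set} {S : 𝔹 → Set} (R? : ∀ a → Dec (R a)) (S? : ∀ b → Dec (S b)) →
  (f : 𝔹 → 𝔸) (g : 𝔸 → 𝔹) → (∀ a → R a → f (g a) ≡ a) → (∀ b → S b → g (f b) ≡ b) →
  (∀ b → S b → R (f b)) → (∀ b → R (f b) → S b) → (h : 𝔸 → ℕ) →
  ∑ xs (λ a → ind (R? a) * h a) ≡ ∑ ys (λ b → ind (S? b) * h (f b))
∑-bijection {_≟A_ = _≟A_} {_≟B_} {xs} {ys} enA enB R? S? f g fg gf S⇒R R⇒S h = begin
  ∑ xs (λ a → ind (R? a) * h a)
    ≡⟨ ∑-cong xs (λ a → sym (∑-collapse enB (g a) _)) ⟩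
  ∑ xs (λ a → ∑ ys (λ b → ind (b ≟B g a) * (ind (R? a) * h a)))
    ≡⟨ ∑-swap xs ys _ ⟩
  ∑ ys (λ b → ∑ xs (λ a → ind (b ≟B g a) * (ind (R? a) * h a)))
    ≡⟨ ∑-cong ys (λ b → ∑-cong xs λ a → pointwise b a (R? a)) ⟩
  ∑ ys (λ b → ∑ xs (λ a → ind (a ≟A f b) * (ind (R? a) * h a)))
    ≡⟨ ∑-cong ys (λ b → ∑-collapse enA (f b) _) ⟩
  ∑ ys (λ b → ind (R? (f b)) * h (f b))
    ≡⟨ ∑-cong ys (λ b → cong (_* h (f b)) (ind-cong (R? (f b)) (S? b) (R⇒S b) (S⇒R b))) ⟩
  ∑ ys (λ b → ind (S? b) * h (f b)) ∎
  where
  open ≡-Reasoning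
  pointwise : ∀ b a (d : Dec _) → ind (b ≟B g a) * (ind d * h a) ≡ ind (a ≟A f b) * (ind d * h a)
  pointwise b a (no _)  = trans (*-zeroʳ (ind (b ≟B g a))) (sym (*-zeroʳ (ind (a ≟A f b))))
  pointwise b a (yes r) = cong (_* (1 * h a)) (ind-cong (b ≟B g a) (a ≟A f b)
    (λ b≡ga → trans (sym (fg a r)) (cong f (sym b≡ga)))
    (λ a≡fb → trans (sym (gf b (R⇒S b (subst _ a≡fb r)))) (cong g (sym a≡fb))))

∑-≡0⇒ : (xs : List 𝔸) {f : 𝔸 → ℕ} → ∑ xs f ≡ 0 → All (λ x → f x ≡ 0) xs
∑-≡0⇒ []           eq = []
∑-≡0⇒ (x ∷ xs) {f} eq = m+n≡0⇒m≡0 (f x) eq ∷ ∑-≡0⇒ xs (m+n≡0⇒n≡0 (f x) eq)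

-- The multiplicities are only bounded, not equal to 1, because the hypothesis has to pass to the
-- tail of the list.
∑≤1⇒distinct : (_≟_ : DecidableEquality 𝔸) (xs : List 𝔸) →
               (∀ a → ∑ xs (λ x → ind (x ≟ a)) ≤ 1) → AllPairs _≢_ xs
∑≤1⇒distinct _≟_ []       le = []
∑≤1⇒distinct _≟_ (x ∷ xs) le =
  All.map (λ {y} z x≡y → 1+n≢0 (trans (sym (ind-yes (y ≟ x) (sym x≡y))) z))
    (∑-≡0⇒ xs (n≤0⇒n≡0 (≤-pred (subst (λ i → i + ∑ xs (λ y → ind (y ≟ x)) ≤ 1) (ind-yes (x ≟ x) refl) (le x)))))
  ∷ ∑≤1⇒distinct _≟_ xs (λ a → ≤-trans (m≤n+m _ (ind (x ≟ a))) (le a))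

∑>0⇒∈ : (xs : List 𝔸) {f : 𝔸 → ℕ} → 0 < ∑ xs f → ∃[ x ] (x ∈ᴸ xs × 0 < f x)
∑>0⇒∈ (x ∷ xs) {f} pos with f x in eq
... | suc _ = x , here refl , subst (0 <_) (sym eq) (s≤s z≤n)
... | zero with ∑>0⇒∈ xs pos
...   | y , y∈ , p = y , there y∈ , p

Enum⇒∈ : {_≟_ : DecidableEquality 𝔸} {xs : List 𝔸} → Enum _≟_ xs → ∀ a → a ∈ᴸ xs
Enum⇒∈ {_≟_ = _≟_} {xs} en a with ∑>0⇒∈ xs (subst (0 <_) (sym (once en a)) (s≤s z≤n))
... | x , x∈ , p = subst (_∈ᴸ xs) (ind>0⇒ (x ≟ a) p) x∈

Enum-prod : {_≟A_ : DecidableEquality 𝔸} {_≟B_ : DecidableEquality 𝔹} {xs : List 𝔸} {ys : List 𝔹} →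
  Enum _≟A_ xs → Enum _≟B_ ys → (_≟_ : DecidableEquality ℂ) (c : 𝔸 → 𝔹 → ℂ) →
  (∀ {x x′ y y′} → c x y ≡ c x′ y′ → x ≡ x′ × y ≡ y′) →
  ∀ a b → ∑ (cartesianProductWith c xs ys) (λ z → ind (z ≟ c a b)) ≡ 1
Enum-prod {_≟A_ = _≟A_} {_≟B_} {xs} {ys} enA enB _≟_ c inj a b = begin
  ∑ (cartesianProductWith c xs ys) (λ z → ind (z ≟ c a b))
    ≡⟨ ∑-prod c xs ys _ ⟩
  ∑ xs (λ x → ∑ ys (λ y → ind (c x y ≟ c a b)))
    ≡⟨ ∑-cong xs (λ x → ∑-cong ys λ y → trans (ind-cong (c x y ≟ c a b) ((x ≟A a) ×-dec (y ≟B b)) inj (λ { (p , q) → cong₂ c p q }))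
                                          (ind-× (x ≟A a) (y ≟B b))) ⟩
  ∑ xs (λ x → ∑ ys (λ y → ind (x ≟A a) * ind (y ≟B b)))
    ≡⟨ ∑-cong xs (λ x → trans (∑-*ˡ ys (ind (x ≟A a)) λ y → ind (y ≟B b)) (trans (cong (ind (x ≟A a) *_) (once enB b)) (*-identityʳ _))) ⟩
  ∑ xs (λ x → ind (x ≟A a))
    ≡⟨ once enA a ⟩
  1 ∎
  where open ≡-Reasoning

-- Congruences. Both sides are moved up by multiples of q, so that no subtraction occurs.

infix 4 _≈_[_]

record _≈_[_] (a b q : ℕ) : Set where
  constructor cg
  field
    u v   : ℕ
    shift : a + u * q ≡ b + v * q

≈-reflexive : ∀ {q a b} → a ≡ b → a ≈ b [ q ]
≈-reflexive refl = cg 0 0 refl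

≈-refl : ∀ {q a} → a ≈ a [ q ]
≈-refl = ≈-reflexive refl

≈-sym : ∀ {q a b} → a ≈ b [ q ] → b ≈ a [ q ]
≈-sym (cg x y e) = cg y x (sym e)

≈-trans : ∀ {q a b c} → a ≈ b [ q ] → b ≈ c [ q ] → a ≈ c [ q ]
≈-trans {q} {a} {b} {c} (cg x y e) (cg z w f) = cg (x + z) (w + y) (begin
  a + (x + z) * q     ≡⟨ r₁ a x z q ⟩
  (a + x * q) + z * q ≡⟨ cong (_+ z * q) e ⟩
  (b + y * q) + z * q ≡⟨ r₂ b y z q ⟩
  (b + z * q) + y * q ≡⟨ cong (_+ y * q) f ⟩
  (c + w * q) + y * q ≡⟨ sym (r₁ c w y q) ⟩
  c + (w + y) * q ∎)
  where
  open ≡-Reasoning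
  r₁ : ∀ a x z q → a + (x + z) * q ≡ (a + x * q) + z * q
  r₁ = solve-∀
  r₂ : ∀ b y z q → (b + y * q) + z * q ≡ (b + z * q) + y * q
  r₂ = solve-∀

≈-+ : ∀ {q a b c d} → a ≈ b [ q ] → c ≈ d [ q ] → a + c ≈ b + d [ q ]
≈-+ {q} {a} {b} {c} {d} (cg x y e) (cg z w f) =
  cg (x + z) (y + w) (trans (r a c x z q) (trans (cong₂ _+_ e f) (sym (r b d y w q))))
  where
  r : ∀ a c x z q → (a + c) + (x + z) * q ≡ (a + x * q) + (c + z * q)
  r = solve-∀

≈-* : ∀ {q a b c d} → a ≈ b [ q ] → c ≈ d [ q ] → a * c ≈ b * d [ q ]
≈-* {q} {a} {b} {c} {d} (cg x y e) (cg z w f) =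
  cg (a * z + x * c + x * z * q) (b * w + y * d + y * w * q)
     (trans (r a c x z q) (trans (cong₂ _*_ e f) (sym (r b d y w q))))
  where
  r : ∀ a c x z q → a * c + (a * z + x * c + x * z * q) * q ≡ (a + x * q) * (c + z * q)
  r = solve-∀

≈-*ˡ : ∀ {q a b} c → a ≈ b [ q ] → c * a ≈ c * b [ q ]
≈-*ˡ c = ≈-* (≈-refl {a = c})

≈-*ʳ : ∀ {q a b} c → a ≈ b [ q ] → a * c ≈ b * c [ q ]
≈-*ʳ c e = ≈-* e (≈-refl {a = c})

≈-^ : ∀ {q a b} e → a ≈ b [ q ] → a ^ e ≈ b ^ e [ q ]
≈-^ zero    e = ≈-refl
≈-^ (suc n) e = ≈-* e (≈-^ n e)

^-* : ∀ x y e → (x * y) ^ e ≡ x ^ e * y ^ e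
^-* x y zero    = refl
^-* x y (suc e) = trans (cong (x * y *_) (^-* x y e)) (r x y (x ^ e) (y ^ e))
  where
  r : ∀ x y a b → x * y * (a * b) ≡ x * a * (y * b)
  r = solve-∀

≈1-^ : ∀ {q a} e → a ≈ 1 [ q ] → a ^ e ≈ 1 [ q ]
≈1-^ e h = ≈-trans (≈-^ e h) (≈-reflexive (^-zeroˡ e))

≈-% : ∀ a q .{{_ : NonZero q}} → a % q ≈ a [ q ]
≈-% a q = cg (a / q) 0 (trans (sym (m≡m%n+[m/n]*n a q)) (sym (+-identityʳ a)))

≈⇒% : ∀ {a b} q .{{_ : NonZero q}} → a ≈ b [ q ] → a % q ≡ b % q
≈⇒% {a} {b} q (cg x y e) = trans (sym ([m+kn]%n≡m%n a x q)) (trans (cong (_% q) e) ([m+kn]%n≡m%n b y q))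

%⇒≈ : ∀ {a b} q .{{_ : NonZero q}} → a % q ≡ b % q → a ≈ b [ q ]
%⇒≈ {a} {b} q e = ≈-trans (≈-sym (≈-% a q)) (≈-trans (≈-reflexive e) (≈-% b q))

≈⇒≡ : ∀ {a b} q .{{_ : NonZero q}} → a < q → b < q → a ≈ b [ q ] → a ≡ b
≈⇒≡ q a<q b<q e = trans (sym (m<n⇒m%n≡m a<q)) (trans (≈⇒% q e) (m<n⇒m%n≡m b<q))

≈-dec : ∀ q .{{_ : NonZero q}} a b → Dec (a ≈ b [ q ])
≈-dec q a b = map′ (%⇒≈ q) (≈⇒% q) (a % q ≟ b % q)

+-cancel-≈ : ∀ {q k} a → a + k ≈ a [ q ] → q ∣ k
+-cancel-≈ {q} {k} a (cg x y e) = ∣m+n∣m⇒∣n {m = x * q} (divides y (+-cancelˡ-≡ a _ _ (begin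
  a + (x * q + k) ≡⟨ r a x q k ⟩
  a + k + x * q   ≡⟨ e ⟩
  a + y * q ∎))) (n∣m*n x)
  where
  open ≡-Reasoning
  r : ∀ a x q k → a + (x * q + k) ≡ a + k + x * q
  r = solve-∀

∣⇒+-≈ : ∀ {q k} a → q ∣ k → a + k ≈ a [ q ]
∣⇒+-≈ {q} a (divides y refl) = cg 0 y (+-identityʳ _)

∣⇒≈0 : ∀ {q k} → q ∣ k → k ≈ 0 [ q ]
∣⇒≈0 = ∣⇒+-≈ 0

≈0⇒∣ : ∀ {q k} → k ≈ 0 [ q ] → q ∣ k
≈0⇒∣ = +-cancel-≈ 0

≈-∣ : ∀ {q d a b} → d ∣ q → a ≈ b [ q ] → a ≈ b [ d ]
≈-∣ {d = d} {a} {b} (divides z refl) (cg x y e) =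
  cg (x * z) (y * z) (trans (cong (a +_) (*-assoc x z d)) (trans e (cong (b +_) (sym (*-assoc y z d)))))

∣-resp-≈ : ∀ {q d a b} → d ∣ q → a ≈ b [ q ] → d ∣ a → d ∣ b
∣-resp-≈ d∣q e d∣a = ≈0⇒∣ (≈-trans (≈-sym (≈-∣ d∣q e)) (∣⇒≈0 d∣a))

≈-scale : ∀ {q a b} c → a ≈ b [ q ] → c * a ≈ c * b [ c * q ]
≈-scale {q} {a} {b} c (cg x y e) = cg x y (trans (r c a x q) (trans (cong (c *_) e) (sym (r c b y q))))
  where
  r : ∀ c a x q → c * a + x * (c * q) ≡ c * (a + x * q)
  r = solve-∀

≈-unscale : ∀ {q a b} c .{{_ : NonZero c}} → c * a ≈ c * b [ c * q ] → a ≈ b [ q ]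
≈-unscale {q} {a} {b} c (cg x y e) =
  cg x y (*-cancelˡ-≡ _ _ c (trans (sym (r c a x q)) (trans e (r c b y q))))
  where
  r : ∀ c a x q → c * a + x * (c * q) ≡ c * (a + x * q)
  r = solve-∀

-- Inverses modulo q, powers of a prime, the Chinese remainder theorem

Inv : ℕ → ℕ → Set
Inv q c = ∃[ c′ ] (c * c′ ≈ 1 [ q ])

Inv-cancel : ∀ {q a b} c → Inv q c → c * a ≈ c * b [ q ] → a ≈ b [ q ]
Inv-cancel {q} {a} {b} c (c′ , inv) e = ≈-trans (≈-sym (one a)) (≈-trans (≈-*ˡ c′ e) (one b))
  where
  one : ∀ a → c′ * (c * a) ≈ a [ q ]
  one a = ≈-trans (≈-reflexive (trans (sym (*-assoc c′ c a)) (cong (_* a) (*-comm c′ c))))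
                  (≈-trans (≈-*ʳ a inv) (≈-reflexive (*-identityˡ a)))

Inv-^ : ∀ {q c} e → Inv q c → Inv q (c ^ e)
Inv-^ {c = c} e (c′ , inv) = c′ ^ e , ≈-trans (≈-reflexive (sym (^-* c c′ e))) (≈1-^ e inv)

coprime⇒Inv : ∀ {q c} → Coprime c q → Inv q c
coprime⇒Inv {q} {c} cop with coprime-Bézout cop
... | Bézout.Identity.+- x y e = x , cg 0 y (trans (+-identityʳ (c * x)) (trans (*-comm c x) (sym e)))
-- Here `x * c` is -1 modulo `q`, so `x * (c * x)` represents the inverse -x without a subtraction.
... | Bézout.Identity.-+ x y e = x * (c * x) , cg (2 * y) (y * (y * q)) (begin
  c * (x * (c * x)) + 2 * y * q  ≡⟨ r₁ c x y q ⟩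
  (x * c) * (x * c) + 2 * (y * q) ≡⟨ cong (λ w → (x * c) * (x * c) + 2 * w) (sym e) ⟩
  (x * c) * (x * c) + 2 * (1 + x * c) ≡⟨ r₂ (x * c) ⟩
  1 + (1 + x * c) * (1 + x * c) ≡⟨ cong (λ w → 1 + w * w) e ⟩
  1 + (y * q) * (y * q) ≡⟨ r₃ y q ⟩
  1 + y * (y * q) * q ∎)
  where
  open ≡-Reasoning
  r₁ : ∀ c x y q → c * (x * (c * x)) + 2 * y * q ≡ (x * c) * (x * c) + 2 * (y * q)
  r₁ = solve-∀
  r₂ : ∀ s → s * s + 2 * (1 + s) ≡ 1 + (1 + s) * (1 + s)
  r₂ = solve-∀
  r₃ : ∀ y q → 1 + (y * q) * (y * q) ≡ 1 + y * (y * q) * q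
  r₃ = solve-∀

coprime-* : ∀ {c a b} → Coprime c a → Coprime c b → Coprime c (a * b)
coprime-* ca cb {d} (d∣c , d∣ab) =
  cb (d∣c , coprime-divisor (λ { (e∣d , e∣a) → ca (∣-trans e∣d d∣c , e∣a) }) d∣ab)

coprime-^ : ∀ {c a} j → Coprime c a → Coprime c (a ^ j)
coprime-^ zero    ca (_ , d∣1) = ∣1⇒≡1 d∣1
coprime-^ (suc j) ca = coprime-* ca (coprime-^ j ca)

∤⇒coprime : ∀ {p c} → Prime p → p ∤ c → Coprime c p
∤⇒coprime pr p∤c (d∣c , d∣p) with prime⇒irreducible pr d∣p
... | inj₁ d≡1  = d≡1
... | inj₂ refl = contradiction d∣c p∤c

∤⇒Inv : ∀ {p c} j → Prime p → p ∤ c → Inv (p ^ j) c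
∤⇒Inv j pr p∤c = coprime⇒Inv (coprime-^ j (∤⇒coprime pr p∤c))

chinese : ∀ {u v a b} → Coprime u v → a ≈ b [ u ] → a ≈ b [ v ] → a ≈ b [ u * v ]
chinese {u} {v} cop e f = [ (λ a≤b → ≈-sym (go a≤b (≈-sym e) (≈-sym f))) , (λ b≤a → go b≤a e f) ]′ (≤-total _ _)
  where
  go : ∀ {a b} → a ≤ b → b ≈ a [ u ] → b ≈ a [ v ] → b ≈ a [ u * v ]
  go {a} {b} a≤b e f = ≈-trans (≈-reflexive (sym b≡)) (∣⇒+-≈ a (uv∣k (+-cancel-≈ a (≈-trans (≈-reflexive b≡) e))))
    where
    b≡ : a + (b ∸ a) ≡ b
    b≡ = m+[n∸m]≡n a≤b
    v∣k = +-cancel-≈ a (≈-trans (≈-reflexive b≡) f)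
    uv∣k : u ∣ b ∸ a → u * v ∣ b ∸ a
    uv∣k (divides w k≡wu) = subst (u * v ∣_) (trans (*-comm u w) (sym k≡wu))
      (*-monoʳ-∣ u (coprime-divisor (λ { (d∣v , d∣u) → cop (d∣u , d∣v) }) (subst (v ∣_) (trans k≡wu (*-comm w u)) v∣k)))

-- Multiplicative orders

record Order (q x d : ℕ) : Set where
  field
    pow   : x ^ d ≈ 1 [ q ]
    least : ∀ e → x ^ e ≈ 1 [ q ] → d ∣ e

open Order public

least-witness : {P : ℕ → Set} → (∀ i → Dec (P i)) → ∀ N → P N →
                ∃[ d ] (d ≤ N × P d × (∀ e → e < d → ¬ P e))
least-witness P? zero    PN = 0 , z≤n , PN , λ _ ()
least-witness {P} P? (suc N) PN with P? 0
... | yes P0 = 0 , z≤n , P0 , λ _ ()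
... | no ¬P0 with least-witness (P? ∘ suc) N PN
...   | d , d≤N , Pd , min = suc d , s≤s d≤N , Pd , λ where
        zero    _         P0 → ¬P0 P0
        (suc e) (s≤s e<d) Pe → min e e<d Pe

-- The search runs over positive exponents, whence the shift by one. Divisibility comes from
-- minimality applied to the remainder `e % suc d`. Minimality is returned too, because the freeness
-- of the action in `Lagrange` rests on it.
order-exists : ∀ q .{{_ : NonZero q}} x N → x ^ suc N ≈ 1 [ q ] →
               ∃[ d ] (d ≤ N × Order q x (suc d) × (∀ e → e < d → ¬ x ^ suc e ≈ 1 [ q ]))
order-exists q x N h with least-witness (λ i → ≈-dec q (x ^ suc i) 1) N h
... | d , d≤N , hd , min = d , d≤N , record { pow = hd ; least = div } , min
  where
  div : ∀ e → x ^ e ≈ 1 [ q ] → suc d ∣ e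
  div e he = m%n≡0⇒n∣m e (suc d) (zero-rem (e % suc d) refl)
    where
    split : x ^ (e % suc d) ≈ 1 [ q ]
    split = ≈-trans (≈-reflexive (sym (*-identityʳ _)))
      (≈-trans (≈-*ˡ (x ^ (e % suc d)) (≈-sym (≈1-^ (e / suc d) hd)))
      (≈-trans (≈-reflexive (trans (cong (x ^ (e % suc d) *_) (trans (^-*-assoc x (suc d) (e / suc d)) (cong (x ^_) (*-comm (suc d) (e / suc d)))))
                 (trans (sym (^-distribˡ-+-* x (e % suc d) _)) (cong (x ^_) (sym (m≡m%n+[m/n]*n e (suc d))))))) he))
    zero-rem : ∀ r → e % suc d ≡ r → r ≡ 0
    zero-rem zero    _  = refl
    zero-rem (suc r) eq = contradiction (subst (λ i → x ^ i ≈ 1 [ q ]) eq split)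
                            (min r (≤-pred (subst (_< suc d) eq (m%n<n e (suc d)))))

^-cancel-≈ : ∀ {q x} i k → Inv q x → x ^ (i + k) ≈ x ^ i [ q ] → x ^ k ≈ 1 [ q ]
^-cancel-≈ {q} {x} i k inv e = Inv-cancel (x ^ i) (Inv-^ i inv)
  (≈-trans (≈-reflexive (sym (^-distribˡ-+-* x i k))) (≈-trans e (≈-reflexive (sym (*-identityʳ _)))))

Order-inj≤ : ∀ {q x d i j} → Order q x d → Inv q x → i ≤ j → x ^ i ≈ x ^ j [ q ] → j ≈ i [ d ]
Order-inj≤ {x = x} {i = i} {j} o inv i≤j e = ≈-trans (≈-reflexive (sym (m+[n∸m]≡n i≤j)))
  (∣⇒+-≈ i (least o (j ∸ i) (^-cancel-≈ i (j ∸ i) inv (≈-trans (≈-reflexive (cong (x ^_) (m+[n∸m]≡n i≤j))) (≈-sym e)))))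

Order-inj : ∀ {q x d i j} → Order q x d → Inv q x → x ^ i ≈ x ^ j [ q ] → i ≈ j [ d ]
Order-inj {i = i} {j} o inv e with ≤-total i j
... | inj₁ i≤j = ≈-sym (Order-inj≤ o inv i≤j e)
... | inj₂ j≤i = Order-inj≤ o inv j≤i (≈-sym e)

Order-≈ : ∀ {q x d i j} → Order q x d → i ≈ j [ d ] → x ^ i ≈ x ^ j [ q ]
Order-≈ {q} {x} {d} {i} {j} o (cg u v e) = ≈-trans (≈-sym (drop i u)) (≈-trans (≈-reflexive (cong (x ^_) e)) (drop j v))
  where
  drop : ∀ i u → x ^ (i + u * d) ≈ x ^ i [ q ]
  drop i u = ≈-trans (≈-reflexive (trans (^-distribˡ-+-* x i (u * d))
      (cong (x ^ i *_) (trans (cong (x ^_) (*-comm u d)) (sym (^-*-assoc x d u))))))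
    (≈-trans (≈-*ˡ (x ^ i) (≈1-^ u (pow o))) (≈-reflexive (*-identityʳ _)))

-- Roots of monic polynomials modulo a prime

-- The monic polynomial whose lower coefficients, from degree 0 up, are cs.
monic : List ℕ → ℕ → ℕ
monic []       x = 1
monic (c ∷ cs) x = c + x * monic cs x

-- Quotient of the monic polynomial with lower coefficients c ∷ cs by x - a.
quot : ℕ → List ℕ → List ℕ
quot a []       = []
quot a (c ∷ cs) = monic (c ∷ cs) a ∷ quot a cs

length-quot : ∀ a cs → length (quot a cs) ≡ length cs
length-quot a []       = refl
length-quot a (c ∷ cs) = cong suc (length-quot a cs)

-- This is f(x) - f(a) = (x - a) q(x) with the negative terms moved across; the coefficients of
-- `quot` are the intermediate values of Horner's scheme at a.
monic-quot : ∀ a x c cs → monic (c ∷ cs) x + a * monic (quot a cs) x ≡ x * monic (quot a cs) x + monic (c ∷ cs) a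
monic-quot a x c []        = r c x a
  where
  r : ∀ c x a → (c + x * 1) + a * 1 ≡ x * 1 + (c + a * 1)
  r = solve-∀
monic-quot a x c (c′ ∷ cs) = begin
  (c + x * C) + a * (D + x * Q) ≡⟨ r₁ c x C a D Q ⟩
  (c + a * D) + x * (C + a * Q) ≡⟨ cong (λ w → c + a * D + x * w) (monic-quot a x c′ cs) ⟩
  (c + a * D) + x * (x * Q + D) ≡⟨ r₂ c x a D Q ⟩
  x * (D + x * Q) + (c + a * D) ∎
  where
  open ≡-Reasoning
  C = monic (c′ ∷ cs) x
  D = monic (c′ ∷ cs) a
  Q = monic (quot a cs) x
  r₁ : ∀ c x C a D Q → (c + x * C) + a * (D + x * Q) ≡ (c + a * D) + x * (C + a * Q)
  r₁ = solve-∀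
  r₂ : ∀ c x a D Q → (c + a * D) + x * (x * Q + D) ≡ x * (D + x * Q) + (c + a * D)
  r₂ = solve-∀

≈-*-cancel : ∀ {p} → Prime p → ∀ a b y → a * y ≈ b * y [ p ] → a ≈ b [ p ] ⊎ y ≈ 0 [ p ]
≈-*-cancel {p} pr a b y e with p ∣? y
... | yes p∣y = inj₂ (∣⇒≈0 p∣y)
... | no p∤y  = inj₁ (Inv-cancel y (coprime⇒Inv (∤⇒coprime pr p∤y))
                  (≈-trans (≈-reflexive (*-comm y a)) (≈-trans e (≈-reflexive (*-comm b y)))))

-- Division by x - a for the first root a: another root b gives (a - b) q(b) = 0 modulo p, and as b
-- is incongruent to a and p is prime, b is a root of the quotient.
root-bound : ∀ {p} → Prime p → ∀ cs as → All (λ a → monic cs a ≈ 0 [ p ]) as →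
             AllPairs (λ a b → ¬ a ≈ b [ p ]) as → length as ≤ length cs
root-bound pr []       []       _        _ = z≤n
root-bound {p} pr [] (a ∷ as) (h ∷ _) _ =
  contradiction (∣1⇒≡1 (≈0⇒∣ h)) (λ { refl → ¬1 pr })
  where
  ¬1 : ¬ Prime 1
  ¬1 pr = contradiction (nonTrivial⇒n>1 _ {{prime⇒nonTrivial pr}}) (<-irrefl refl)
root-bound pr (c ∷ cs) []       _        _ = z≤n
root-bound {p} pr (c ∷ cs) (a ∷ as) (h ∷ hs) (d ∷ ds) = s≤s
  (subst (length as ≤_) (length-quot a cs)
    (root-bound pr (quot a cs) as (All.zipWith (λ { (¬e , hb) → root ¬e hb }) (d , hs)) ds))
  where
  root : ∀ {b} → ¬ a ≈ b [ p ] → monic (c ∷ cs) b ≈ 0 [ p ] → monic (quot a cs) b ≈ 0 [ p ]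
  root {b} ¬e hb with ≈-*-cancel pr a b (monic (quot a cs) b)
    (≈-trans (≈-sym (≈-+ hb (≈-refl {a = a * monic (quot a cs) b})))
    (≈-trans (≈-reflexive (monic-quot a b c cs))
    (≈-trans (≈-+ (≈-refl {a = b * monic (quot a cs) b}) h) (≈-reflexive (+-identityʳ _)))))
  ... | inj₁ e = contradiction e ¬e
  ... | inj₂ z = z

roots-of-unity-bound : ∀ {p} → Prime p → ∀ d .{{_ : NonZero d}} as → All (λ a → a ^ d ≈ 1 [ p ]) as →
                       AllPairs (λ a b → ¬ a ≈ b [ p ]) as → length as ≤ d
roots-of-unity-bound {p} pr (suc d) as hs ds =
  -- The coefficient `p ∸ 1` stands for the constant term -1 of the polynomial x^d - 1.
  ≤-trans (root-bound pr (p ∸ 1 ∷ zeros) as (All.map (λ {a} → root {a}) hs) ds) (≤-reflexive (cong suc (length-replicate d)))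
  where
  zeros = List.replicate d 0
  monic-zeros : ∀ d x → monic (List.replicate d 0) x ≡ x ^ d
  monic-zeros zero    x = refl
  monic-zeros (suc d) x = cong (x *_) (monic-zeros d x)
  root : ∀ {a} → a ^ suc d ≈ 1 [ p ] → monic (p ∸ 1 ∷ zeros) a ≈ 0 [ p ]
  root {a} h = ≈-trans (≈-reflexive {b = p ∸ 1 + a ^ suc d} (cong (λ w → p ∸ 1 + a * w) (monic-zeros d a)))
    (≈-trans (≈-+ (≈-refl {a = p ∸ 1}) h)
    (≈-trans (≈-reflexive (m∸n+n≡m (<⇒≤ (nonTrivial⇒n>1 _ {{prime⇒nonTrivial pr}})))) (∣⇒≈0 ∣-refl)))

-- Orbits of a single map

iter : {A : Set} → (A → A) → ℕ → A → A
iter T zero    x = x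
iter T (suc i) x = T (iter T i x)

iter-+ : {A : Set} (T : A → A) (i j : ℕ) (x : A) → iter T (i + j) x ≡ iter T i (iter T j x)
iter-+ T zero    j x = refl
iter-+ T (suc i) j x = cong T (iter-+ T i j x)

first : {A : Set} {P : A → Set} → (∀ x → Dec (P x)) → A → List A → A
first P? d []       = d
first P? d (x ∷ xs) = if does (P? x) then x else first P? d xs

first-satisfies : {A : Set} {P : A → Set} (P? : ∀ x → Dec (P x)) (d : A) {xs : List A} {y : A} →
                  y ∈ᴸ xs → P y → P (first P? d xs)
first-satisfies P? d {x ∷ xs} y∈ Py with P? x
... | yes Px = Px
first-satisfies P? d {x ∷ xs} (here refl) Py | no ¬Px = contradiction Py ¬Px
first-satisfies P? d {x ∷ xs} (there y∈)  Py | no ¬Px = first-satisfies P? d y∈ Py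

-- The search depends only on which elements satisfy the predicate, and a known witness keeps it
-- from reaching the default. Hence all elements of an orbit get the same representative.
first-cong : {A : Set} {P Q : A → Set} (P? : ∀ x → Dec (P x)) (Q? : ∀ x → Dec (Q x)) (d e : A) →
             (∀ x → P x → Q x) → (∀ x → Q x → P x) → {xs : List A} {y : A} → y ∈ᴸ xs → P y →
             first P? d xs ≡ first Q? e xs
first-cong P? Q? d e f g {x ∷ xs} y∈ Py with P? x | Q? x
... | yes Px | yes Qx = refl
... | yes Px | no ¬Qx = contradiction (f x Px) ¬Qx
... | no ¬Px | yes Qx = contradiction (g x Qx) ¬Px
first-cong P? Q? d e f g {x ∷ xs} (here refl) Py | no ¬Px | no _ = contradiction Py ¬Px
first-cong P? Q? d e f g {x ∷ xs} (there y∈)  Py | no ¬Px | no _ = first-cong P? Q? d e f g y∈ Py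

∑<-periodic : ∀ h (f : ℕ → ℕ) → (∀ i → f (i + h) ≡ f i) → ∀ j → ∑< h (λ i → f (i + j)) ≡ ∑< h f
∑<-periodic h f per zero    = ∑-cong (upTo h) λ i → cong f (+-identityʳ i)
∑<-periodic h f per (suc j) = trans (trans (∑-cong (upTo h) λ i → cong f (+-suc i j)) (∑<-periodic h (f ∘ suc) (per ∘ suc) j)) step
  where
  step : ∑< h (f ∘ suc) ≡ ∑< h f
  step = +-cancelˡ-≡ (f 0) _ _ (trans (sym (∑<-suc h f)) (trans (∑<-snoc h f) (trans (cong (∑< h f +_) (per 0)) (+-comm _ (f 0)))))

lookup-distinct : {A : Set} {xs : List A} → AllPairs _≢_ xs → ∀ i j → lookup xs i ≡ lookup xs j → i ≡ j
lookup-distinct (d ∷ ds) Fin.zero    Fin.zero    eq = refl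
lookup-distinct (d ∷ ds) Fin.zero    (Fin.suc j) eq = contradiction eq (All.lookup d (∈-lookup j))
lookup-distinct (d ∷ ds) (Fin.suc i) Fin.zero    eq = contradiction (sym eq) (All.lookup d (∈-lookup i))
lookup-distinct (d ∷ ds) (Fin.suc i) (Fin.suc j) eq = cong Fin.suc (lookup-distinct ds i j eq)

-- The acting group is cyclic, generated by `T` on the subset `R`, where `T^h` is the identity. No
-- inverse is given: T^(h - i) undoes T^i.
module Burnside {A : Set} (_≟A_ : DecidableEquality A) (xs : List A) (en : Enum _≟A_ xs)
                (T : A → A) (h : ℕ) (0<h : 0 < h) (R : A → Set) (R? : ∀ x → Dec (R x))
                (R-T : ∀ x → R x → R (T x)) (T^h : ∀ x → R x → iter T h x ≡ x) where

  private
    instance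
      h≢0 : NonZero h
      h≢0 = >-nonZero 0<h

  Orbit : A → A → Set
  Orbit x y = ∃[ i ] (i < h × iter T i x ≡ y)

  Orbit? : ∀ x y → Dec (Orbit x y)
  Orbit? x y = anyUpTo? (λ i → iter T i x ≟A y) h

  iter-R : ∀ i {x} → R x → R (iter T i x)
  iter-R zero    r = r
  iter-R (suc i) r = R-T _ (iter-R i r)

  iter-period : ∀ i {x} → R x → iter T (i + h) x ≡ iter T i x
  iter-period i r = trans (iter-+ T i h _) (cong (iter T i) (T^h _ r))

  iter-multiple : ∀ k i {x} → R x → iter T (i + k * h) x ≡ iter T i x
  iter-multiple zero    i {x} r = cong (λ j → iter T j x) (+-identityʳ i)
  iter-multiple (suc k) i {x} r = trans (cong (λ j → iter T j x) (reassoc i h (k * h)))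
    (trans (iter-period (i + k * h) r) (iter-multiple k i r))
    where
    reassoc : ∀ a b c → a + (b + c) ≡ a + c + b
    reassoc = solve-∀

  orbit-any : ∀ i {x y} → R x → iter T i x ≡ y → Orbit x y
  orbit-any i {x} r eq = i % h , m%n<n i h , trans (sym (iter-multiple (i / h) (i % h) r))
    (trans (cong (λ j → iter T j x) (sym (m≡m%n+[m/n]*n i h))) eq)

  orbit-sym : ∀ {x y} → R x → Orbit x y → Orbit y x
  orbit-sym {x} {y} r (i , i<h , refl) = orbit-any (h ∸ i) (iter-R i r)
    (trans (sym (iter-+ T (h ∸ i) i x)) (trans (cong (λ j → iter T j x) (m∸n+n≡m (<⇒≤ i<h))) (T^h x r)))

  orbit-trans : ∀ {x y z} → R x → Orbit x y → Orbit y z → Orbit x z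
  orbit-trans r (i , _ , refl) (j , _ , refl) = orbit-any (j + i) r (iter-+ T j i _)

  rep : A → A
  rep x = first (Orbit? x) x xs

  rep-orbit : ∀ x → Orbit x (rep x)
  rep-orbit x = first-satisfies (Orbit? x) x (Enum⇒∈ en x) (0 , 0<h , refl)

  rep-cong : ∀ {x y} → R x → Orbit x y → rep x ≡ rep y
  rep-cong {x} {y} r o = first-cong (Orbit? x) (Orbit? y) x y
    (λ z → orbit-trans Ry (orbit-sym r o)) (λ z → orbit-trans r o) (Enum⇒∈ en x) (0 , 0<h , refl)
    where
    Ry : R y
    Ry = subst R (proj₂ (proj₂ o)) (iter-R (proj₁ o) r)

  rep-R : ∀ {x} → R x → R (rep x)
  rep-R {x} r with rep-orbit x
  ... | i , _ , eq = subst R eq (iter-R i r)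

  Rep? : ∀ x → Dec (R x × rep x ≡ x)
  Rep? x = R? x ×-dec (rep x ≟A x)

  reps : List A
  reps = filter Rep? xs

  reps-distinct : AllPairs _≢_ reps
  reps-distinct = AllPairsₚ.filter⁺ Rep? (∑≤1⇒distinct _≟A_ xs (λ a → ≤-reflexive (once en a)))

  reps-Rep : ∀ i → R (lookup reps i) × rep (lookup reps i) ≡ lookup reps i
  reps-Rep i = proj₂ (∈-filter⁻ Rep? {xs = xs} (∈-lookup i))

  reps-separate : ∀ i j → Orbit (lookup reps i) (lookup reps j) → i ≡ j
  reps-separate i j o = lookup-distinct reps-distinct i j
    (trans (sym (proj₂ (reps-Rep i))) (trans (rep-cong (proj₁ (reps-Rep i)) o) (proj₂ (reps-Rep j))))

  reps-cover : ∀ x → R x → ∃[ i ] Orbit x (lookup reps i)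
  reps-cover x r = index m , subst (Orbit x) (lookup-index m) (rep-orbit x)
    where
    m : rep x ∈ᴸ reps
    m = ∈-filter⁺ Rep? (Enum⇒∈ en (rep x)) (rep-R r , sym (rep-cong r (rep-orbit x)))

  hits : A → A → ℕ
  hits r x = ∑< h (λ i → ind (x ≟A iter T i r))

  fixed : ℕ → ℕ
  fixed i = ∑ xs (λ x → ind (R? x ×-dec (iter T i x ≟A x)))

  hits-total : ∀ r → ∑ xs (hits r) ≡ h
  hits-total r = trans (∑-swap xs (upTo h) _)
    (trans (∑-cong (upTo h) λ i → once en (iter T i r)) (trans (∑<-const h 1) (*-identityʳ h)))

  -- Only the representative of the orbit of x contributes. If it is T^j x, the exponents i that
  -- lead from it back to x are those with T^(i + j) x = x, and by periodicity there are as many of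
  -- them as exponents that fix x.
  hits-reps : ∀ x → ∑ xs (λ r → ind (Rep? r) * hits r x) ≡ ∑< h (λ i → ind (R? x ×-dec (iter T (suc i) x ≟A x)))
  hits-reps x = go (R? x)
    where
    go : (d : Dec (R x)) → ∑ xs (λ r → ind (Rep? r) * hits r x) ≡ ∑< h (λ i → ind (d ×-dec (iter T (suc i) x ≟A x)))
    go (no ¬R) = trans (∑-zero xs λ r → trans (ind-*-cong (Rep? r) (λ { (Rr , _) →
                   ∑-zero (upTo h) λ i → ind-no (x ≟A iter T i r) λ eq → ¬R (subst R (sym eq) (iter-R i Rr)) }))
                   (*-zeroʳ (ind (Rep? r))))
                 (sym (∑-zero (upTo h) λ i → ind-no (no ¬R ×-dec (iter T (suc i) x ≟A x)) (¬R ∘ proj₁)))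
    go (yes Rx) = begin
      ∑ xs (λ r → ind (Rep? r) * hits r x)
        ≡⟨ ∑-cong xs (λ r → pick r (Rep? r)) ⟩
      ∑ xs (λ r → ind (r ≟A rep x) * hits r x)
        ≡⟨ ∑-collapse en (rep x) (λ r → hits r x) ⟩
      hits (rep x) x
        ≡⟨ ∑-cong (upTo h) (λ i → cong (λ y → ind (x ≟A y)) (trans (cong (iter T i) (sym (proj₂ (proj₂ (rep-orbit x)))))
             (sym (iter-+ T i (proj₁ (rep-orbit x)) x)))) ⟩
      ∑< h (λ i → f (i + proj₁ (rep-orbit x)))
        ≡⟨ ∑<-periodic h f (λ i → cong (λ y → ind (x ≟A y)) (iter-period i Rx)) (proj₁ (rep-orbit x)) ⟩
      ∑< h f
        -- The shift by one makes the exponents run through 1 , ... , h, as the totient sum `∑<-gcd`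
        -- expects.
        ≡⟨ ∑<-periodic h f (λ i → cong (λ y → ind (x ≟A y)) (iter-period i Rx)) 1 ⟨
      ∑< h (λ i → f (i + 1))
        ≡⟨ ∑-cong (upTo h) (λ i → trans (cong f (+-comm i 1)) (ind-cong (x ≟A iter T (suc i) x) (yes Rx ×-dec (iter T (suc i) x ≟A x))
             (λ e → Rx , sym e) (sym ∘ proj₂))) ⟩
      ∑< h (λ i → ind (yes Rx ×-dec (iter T (suc i) x ≟A x))) ∎
      where
      open ≡-Reasoning
      f : ℕ → ℕ
      f i = ind (x ≟A iter T i x)
      pick : ∀ r (d : Dec (R r × rep r ≡ r)) → ind d * hits r x ≡ ind (r ≟A rep x) * hits r x
      pick r (no ¬ρ) = sym (cong (_* hits r x) (ind-no (r ≟A rep x) λ { refl → ¬ρ (rep-R Rx , sym (rep-cong Rx (rep-orbit x))) }))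
      pick r (yes (Rr , ρ)) with r ≟A rep x
      ... | yes _ = refl
      ... | no r≢ = trans (+-identityʳ _) (∑-zero (upTo h) λ i → ind-no (x ≟A iter T i r) λ eq →
                      r≢ (trans (sym ρ) (rep-cong Rr (orbit-any i Rr (sym eq)))))

  -- Double counting of `hits r x`: every representative r contributes h in total, and every x in
  -- `R` contributes the number of exponents in 1 , ... , h that fix it.
  burnside : h * length reps ≡ ∑< h (fixed ∘ suc)
  burnside = begin
    h * length reps                                    ≡⟨ *-comm h _ ⟩
    length reps * h                                    ≡⟨ cong (_* h) (length-filter-∑ Rep? xs) ⟩
    ∑ xs (λ r → ind (Rep? r)) * h                      ≡⟨ ∑-*ʳ xs h _ ⟨
    ∑ xs (λ r → ind (Rep? r) * h)                      ≡⟨ ∑-cong xs (λ r → trans (cong (ind (Rep? r) *_) (sym (hits-total r))) (sym (∑-*ˡ xs (ind (Rep? r)) (hits r)))) ⟩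
    ∑ xs (λ r → ∑ xs (λ x → ind (Rep? r) * hits r x))  ≡⟨ ∑-swap xs xs _ ⟩
    ∑ xs (λ x → ∑ xs (λ r → ind (Rep? r) * hits r x))  ≡⟨ ∑-cong xs hits-reps ⟩
    ∑ xs (λ x → ∑< h (λ i → ind (R? x ×-dec (iter T (suc i) x ≟A x)))) ≡⟨ ∑-swap xs (upTo h) _ ⟩
    ∑< h (fixed ∘ suc) ∎
    where open ≡-Reasoning

-- Totients

φ-∑ : ∀ n → φ n ≡ ∑< n (λ j → ind (gcd (suc j) n ≟ 1))
φ-∑ n = length-filter-∑ (λ j → gcd (suc j) n ≟ 1) (upTo n)

∣block⇒≡ : ∀ d a b → b < suc d → suc d ∣ suc (a * suc d + b) → b ≡ d
∣block⇒≡ d a b b<d d∣ = ≤-antisym (≤-pred b<d) (≤-pred (∣⇒≤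
  (∣m+n∣m⇒∣n (subst (suc d ∣_) (sym (+-suc (a * suc d) b)) d∣) (n∣m*n a))))

block-last : ∀ a d → suc (a * suc d + d) ≡ suc a * suc d
block-last a d = cong suc (+-comm (a * suc d) d)

-- With D = `suc d`, cut 1 , ... , eD into e blocks of length D. Only the last entry (a + 1)D of a
-- block is a multiple of D, and its gcd with eD is D gcd(a + 1, e).
∑<-gcd≡ : ∀ e d → ∑< (e * suc d) (λ i → ind (suc d ≟ gcd (suc i) (e * suc d))) ≡ φ e
∑<-gcd≡ e d = begin
  ∑< (e * suc d) F                                  ≡⟨ ∑<-blocks e (suc d) F ⟩
  ∑< e (λ a → ∑< (suc d) (λ b → F (a * suc d + b))) ≡⟨ ∑-cong (upTo e) (λ a → ∑<-single (suc d) d ≤-refl (λ b b<d b≢d →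
      ind-no (suc d ≟ gcd (suc (a * suc d + b)) (e * suc d)) λ eq → b≢d (∣block⇒≡ d a b b<d
        (subst (_∣ suc (a * suc d + b)) (sym eq) (gcd[m,n]∣m (suc (a * suc d + b)) (e * suc d)))))) ⟩
  ∑< e (λ a → F (a * suc d + d))                    ≡⟨ ∑-cong (upTo e) (λ a → ind-cong (suc d ≟ gcd (suc (a * suc d + d)) (e * suc d)) (gcd (suc a) e ≟ 1) (to a) (from a)) ⟩
  ∑< e (λ a → ind (gcd (suc a) e ≟ 1))              ≡⟨ φ-∑ e ⟨
  φ e ∎
  where
  open ≡-Reasoning
  F : ℕ → ℕ
  F i = ind (suc d ≟ gcd (suc i) (e * suc d))
  factor : ∀ a → gcd (suc (a * suc d + d)) (e * suc d) ≡ suc d * gcd (suc a) e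
  factor a = trans (cong₂ gcd (trans (block-last a d) (*-comm (suc a) (suc d))) (*-comm e (suc d))) (sym (c*gcd[m,n]≡gcd[cm,cn] (suc d) (suc a) e))
  to : ∀ a → suc d ≡ gcd (suc (a * suc d + d)) (e * suc d) → gcd (suc a) e ≡ 1
  to a eq = *-cancelˡ-≡ _ 1 (suc d) (trans (sym (factor a)) (trans (sym eq) (sym (*-identityʳ (suc d)))))
  from : ∀ a → gcd (suc a) e ≡ 1 → suc d ≡ gcd (suc (a * suc d + d)) (e * suc d)
  from a eq = sym (trans (factor a) (trans (cong (suc d *_) eq) (*-identityʳ (suc d))))

div-∣ : ∀ e d → (e * suc d) div suc d ≡ e
div-∣ e d = m*n/n≡m e (suc d)

-- For constant `G` this is Gauss's identity for the sum of φ(h/d), used in that form for the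
-- primitive root; with `G = fixed` it regroups the Burnside sum.
∑<-gcd : ∀ h (G : ℕ → ℕ) → ∑< h (λ i → G (gcd (suc i) h)) ≡
         ∑< h (λ j → ind (suc j ∣? h) * (φ (h div suc j) * G (suc j)))
∑<-gcd zero        G = refl
∑<-gcd h@(suc h′) G = begin
  ∑< h (λ i → G (gcd (suc i) h))                                          ≡⟨ ∑-cong (upTo h) expand ⟩
  ∑< h (λ i → ∑< h (λ j → ind (suc j ≟ gcd (suc i) h) * G (suc j)))        ≡⟨ ∑-swap (upTo h) (upTo h) _ ⟩
  ∑< h (λ j → ∑< h (λ i → ind (suc j ≟ gcd (suc i) h) * G (suc j)))        ≡⟨ ∑-cong (upTo h) (λ j → ∑-*ʳ (upTo h) (G (suc j)) (λ i → ind (suc j ≟ gcd (suc i) h))) ⟩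
  ∑< h (λ j → ∑< h (λ i → ind (suc j ≟ gcd (suc i) h)) * G (suc j))        ≡⟨ ∑-cong (upTo h) (λ j → trans (cong (_* G (suc j)) (count j (suc j ∣? h))) (*-assoc (ind (suc j ∣? h)) _ _)) ⟩
  ∑< h (λ j → ind (suc j ∣? h) * (φ (h div suc j) * G (suc j))) ∎
  where
  open ≡-Reasoning
  expand : ∀ i → G (gcd (suc i) h) ≡ ∑< h (λ j → ind (suc j ≟ gcd (suc i) h) * G (suc j))
  expand i = go (gcd (suc i) h) refl
    where
    go : ∀ c → gcd (suc i) h ≡ c → G (gcd (suc i) h) ≡ ∑< h (λ j → ind (suc j ≟ gcd (suc i) h) * G (suc j))
    go zero    eq = contradiction (0∣⇒≡0 (subst (_∣ h) eq (gcd[m,n]∣n (suc i) h))) λ ()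
    go (suc c) eq = trans (trans (cong G eq) (sym (+-identityʳ _))) (trans (cong (_* G (suc c)) (sym (ind-yes (suc c ≟ gcd (suc i) h) (sym eq)))) (sym
      (∑<-single h c (∣⇒≤ (subst (_∣ h) eq (gcd[m,n]∣n (suc i) h))) λ j _ j≢c →
        cong (_* G (suc j)) (ind-no (suc j ≟ gcd (suc i) h) λ e → j≢c (suc-injective (trans e eq))))))
  count : ∀ j (d : Dec (suc j ∣ h)) → ∑< h (λ i → ind (suc j ≟ gcd (suc i) h)) ≡ ind d * φ (h div suc j)
  count j (no ¬d) = ∑-zero (upTo h) λ i → ind-no (suc j ≟ gcd (suc i) h) λ eq → ¬d (subst (_∣ h) (sym eq) (gcd[m,n]∣n (suc i) h))
  count j (yes (divides e eq)) = subst (λ h → ∑< h (λ i → ind (suc j ≟ gcd (suc i) h)) ≡ 1 * φ (h div suc j)) (sym eq)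
    (trans (∑<-gcd≡ e j) (sym (trans (+-identityʳ _) (cong φ (div-∣ e j)))))

iter-fixed : {A : Set} (T : A → A) {x : A} → ∀ i k → iter T i x ≡ x → iter T (k * i) x ≡ x
iter-fixed T i zero    eq = refl
iter-fixed T i (suc k) eq = trans (iter-+ T i (k * i) _) (trans (cong (iter T i) (iter-fixed T i k eq)) eq)

-- Iterates have no negative exponents, so Bézout is used as gcd + l h = k i: replace x by T^(l h)
-- x, which is x, and recognise T^(k i) x. The other case exchanges i and h.
iter-gcd : {A : Set} (T : A → A) {x : A} → ∀ i h → iter T i x ≡ x → iter T h x ≡ x → iter T (gcd i h) x ≡ x
iter-gcd T {x} i h Ti Th = go (Bézout.identity (gcd-GCD i h))
  where
  go : Bézout.Identity (gcd i h) i h → iter T (gcd i h) x ≡ x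
  go (Bézout.+- k l eq) = trans (cong (iter T (gcd i h)) (sym (iter-fixed T h l Th)))
    (trans (sym (iter-+ T (gcd i h) (l * h) x)) (trans (cong (λ j → iter T j x) eq) (iter-fixed T i k Ti)))
  go (Bézout.-+ k l eq) = trans (cong (iter T (gcd i h)) (sym (iter-fixed T i k Ti)))
    (trans (sym (iter-+ T (gcd i h) (k * i) x)) (trans (cong (λ j → iter T j x) eq) (iter-fixed T h l Th)))

-- The multiplicative group modulo a prime

toℕ-mod : ∀ a n .{{_ : NonZero n}} → toℕ (a mod n) ≡ a % n
toℕ-mod a n = toℕ-fromℕ< (m%n<n a n)

∑-allFin : ∀ n (f : ℕ → ℕ) → ∑ (allFin n) (f ∘ toℕ) ≡ ∑< n f
∑-allFin n f = go n id {f} λ _ → refl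
  where
  go : ∀ m (k : Fin m → Fin n) {h : ℕ → ℕ} → (∀ i → f (toℕ (k i)) ≡ h (toℕ i)) → ∑ (tabulate k) (f ∘ toℕ) ≡ ∑< m h
  go zero    k eq = refl
  go (suc m) k {h} eq = trans (cong₂ _+_ (eq Fin.zero) (go m (k ∘ Fin.suc) (eq ∘ Fin.suc))) (sym (∑<-suc m h))

Enum-allFin : ∀ n → Enum Fin._≟_ (allFin n)
Enum-allFin n = mk-enum λ a → trans
  (∑-cong (allFin n) λ x → ind-cong (x Fin.≟ a) (toℕ x ≟ toℕ a) (cong toℕ) toℕ-injective)
  (trans (∑-allFin n (λ i → ind (i ≟ toℕ a)))
  (trans (∑<-single n (toℕ a) (toℕ<n a) (λ i _ i≢ → ind-no (i ≟ toℕ a) i≢)) (ind-yes (toℕ a ≟ toℕ a) refl)))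

∤-* : ∀ {p a b} → Prime p → p ∤ a → p ∤ b → p ∤ a * b
∤-* pr p∤a p∤b p∣ab = [ p∤a , p∤b ]′ (euclidsLemma _ _ pr p∣ab)

∤-^ : ∀ {p a} → Prime p → p ∤ a → ∀ e → p ∤ a ^ e
∤-^ pr p∤a zero    p∣1 = contradiction (subst Prime (∣1⇒≡1 p∣1) pr) (λ pr → <-irrefl refl (nonTrivial⇒n>1 1 {{prime⇒nonTrivial pr}}))
∤-^ pr p∤a (suc e) = ∤-* pr p∤a (∤-^ pr p∤a e)

module ModPrime (p : ℕ) (pr : Prime p) where

  instance
    p≢0 : NonZero p
    p≢0 = prime⇒nonZero pr

  P : ℕ
  P = p ∸ 1

  1<p : 1 < p
  1<p = nonTrivial⇒n>1 p {{prime⇒nonTrivial pr}}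

  1+P≡p : suc P ≡ p
  1+P≡p = m+[n∸m]≡n (<⇒≤ 1<p)

  0<P : 0 < P
  0<P = m<n⇒0<n∸m 1<p

  P<p : P < p
  P<p = ≤-reflexive 1+P≡p

  suc<p : ∀ {i} → i < P → suc i < p
  suc<p i<P = ≤-trans (s≤s i<P) P<p

  small∤ : ∀ {i} → 0 < i → i < p → p ∤ i
  small∤ 0<i i<p p∣i = <⇒≱ i<p (∣⇒≤ {{>-nonZero 0<i}} p∣i)

  ∤⇒Inv-p : ∀ {c} → p ∤ c → Inv p c
  ∤⇒Inv-p p∤c = coprime⇒Inv (∤⇒coprime pr p∤c)

  module _ {x : ℕ} (p∤x : p ∤ x) where

    power-returns : ∃[ k ] (x ^ suc k ≈ 1 [ p ])
    power-returns with pigeonhole (n<1+n p) (λ i → (x ^ toℕ i) mod p)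
    ... | i , j , i<j , eq = toℕ j ∸ suc (toℕ i) ,
      ^-cancel-≈ (toℕ i) _ (∤⇒Inv-p p∤x) (≈-trans (≈-reflexive (cong (x ^_) (trans (+-suc (toℕ i) _) (m+[n∸m]≡n i<j))))
        (≈-sym (%⇒≈ p (trans (sym (toℕ-mod (x ^ toℕ i) p)) (trans (cong toℕ eq) (toℕ-mod (x ^ toℕ j) p))))))

    -- Lagrange: the powers of x act freely by multiplication on the nonzero residues, so Burnside's
    -- lemma reads (order of x) * (number of orbits) = p - 1.
    module Lagrange (d : ℕ) (0<d : 0 < d) (x^d : x ^ d ≈ 1 [ p ]) (min : ∀ e → suc e < d → ¬ x ^ suc e ≈ 1 [ p ]) where

      T : Fin p → Fin p
      T u = (x * toℕ u) mod p

      iterT : ∀ i (u : Fin p) → toℕ (iter T i u) ≈ x ^ i * toℕ u [ p ]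
      iterT zero    u = ≈-reflexive (sym (+-identityʳ _))
      iterT (suc i) u = ≈-trans (≈-reflexive (toℕ-mod _ p)) (≈-trans (≈-% _ p)
        (≈-trans (≈-*ˡ x (iterT i u)) (≈-reflexive (sym (*-assoc x (x ^ i) (toℕ u))))))

      unit : ∀ (u : Fin p) → toℕ u ≢ 0 → p ∤ toℕ u
      unit u u≢0 = small∤ (n≢0⇒n>0 u≢0) (toℕ<n u)

      stable : ∀ (u : Fin p) → toℕ u ≢ 0 → toℕ (T u) ≢ 0
      stable u u≢0 eq = ∤-* pr p∤x (unit u u≢0) (≈0⇒∣ (≈-trans (≈-sym (≈-% _ p)) (≈-reflexive (trans (sym (toℕ-mod _ p)) eq))))

      return : ∀ (u : Fin p) → iter T d u ≡ u
      return u = toℕ-injective (≈⇒≡ p (toℕ<n _) (toℕ<n u) (≈-trans (iterT d u)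
        (≈-trans (≈-*ʳ (toℕ u) x^d) (≈-reflexive (+-identityʳ _)))))

      nonzero? : ∀ (u : Fin p) → Dec (toℕ u ≢ 0)
      nonzero? u = ¬? (toℕ u ≟ 0)

      open Burnside Fin._≟_ (allFin p) (Enum-allFin p) T d 0<d (λ u → toℕ u ≢ 0) nonzero? stable (λ u _ → return u)

      -- A fixed nonzero residue cancels in x^(i + 1) u = u, against the minimality of d. The
      -- excluded index `pred d` is the exponent d itself, which fixes everything.
      free : ∀ i → i < d → i ≢ pred d → fixed (suc i) ≡ 0
      free i i<d i≢ = ∑-zero (allFin p) λ u → ind-no (nonzero? u ×-dec (iter T (suc i) u Fin.≟ u)) λ { (u≢0 , eq) →
        min i (≤∧≢⇒< i<d (i≢ ∘ cong pred)) (Inv-cancel (toℕ u) (∤⇒Inv-p (unit u u≢0))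
          (≈-trans (≈-reflexive (*-comm (toℕ u) _)) (≈-trans (≈-sym (iterT (suc i) u))
            (≈-reflexive (trans (cong toℕ eq) (sym (*-identityʳ _))))))) }

      nonzero-count : ∀ P → ∑< (suc P) (λ i → ind (¬? (i ≟ 0))) ≡ P
      nonzero-count P = trans (∑<-suc P (λ i → ind (¬? (i ≟ 0)))) (trans (∑-cong (upTo P) λ _ → refl) (trans (∑<-const P 1) (*-identityʳ P)))

      suc-pred-d : suc (pred d) ≡ d
      suc-pred-d = suc-pred d {{>-nonZero 0<d}}

      total : ∑< d (fixed ∘ suc) ≡ P
      total = begin
        ∑< d (fixed ∘ suc)                ≡⟨ ∑<-single d (pred d) (≤-reflexive suc-pred-d) free ⟩
        fixed (suc (pred d))              ≡⟨ cong fixed suc-pred-d ⟩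
        fixed d                           ≡⟨ ∑-cong (allFin p) (λ u → ind-cong (nonzero? u ×-dec (iter T d u Fin.≟ u)) (nonzero? u) proj₁ (_, return u)) ⟩
        ∑ (allFin p) (λ u → ind (¬? (toℕ u ≟ 0))) ≡⟨ ∑-allFin p (λ i → ind (¬? (i ≟ 0))) ⟩
        ∑< p (λ i → ind (¬? (i ≟ 0)))     ≡⟨ cong (λ n → ∑< n (λ i → ind (¬? (i ≟ 0)))) 1+P≡p ⟨
        ∑< (suc P) (λ i → ind (¬? (i ≟ 0))) ≡⟨ nonzero-count P ⟩
        P ∎
        where open ≡-Reasoning

      divisor : d ∣ P
      divisor = divides (length reps) (trans (sym (trans burnside total)) (*-comm d (length reps)))

    abstract
      order∣P : ∃[ d ] (Order p x (suc d) × suc d ∣ P)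
      order∣P = let d , _ , o , min = order-exists p x (proj₁ power-returns) (proj₂ power-returns)
                in d , o , Lagrange.divisor (suc d) (s≤s z≤n) (pow o) (λ e → min e ∘ ≤-pred)

  -- The value 0 at multiples of p is a dummy. Totality allows residues to be sorted by a decidable
  -- equation on `ord`.
  ord : ℕ → ℕ
  ord x with p ∣? x
  ... | yes _  = 0
  ... | no p∤x = suc (proj₁ (order∣P p∤x))

  ord-Order : ∀ {x} → p ∤ x → Order p x (ord x) × ord x ∣ P
  ord-Order {x} p∤x with p ∣? x
  ... | yes p∣x = contradiction p∣x p∤x
  ... | no p∤x  = proj₂ (order∣P p∤x)

  fermat : ∀ {x} → p ∤ x → x ^ P ≈ 1 [ p ]
  fermat {x} p∤x with ord-Order p∤x
  ... | o , divides k P≡ = ≈-trans (≈-reflexive (trans (cong (x ^_) (trans P≡ (*-comm k (ord x)))) (sym (^-*-assoc x (ord x) k)))) (≈1-^ k (pow o))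

  module _ {a e : ℕ} .{{_ : NonZero e}} (p∤a : p ∤ a) (o : Order p a e) where

    -- If x were missed, then x and the e distinct powers of a would be e + 1 roots of X^e - 1
    -- modulo a prime.
    powers-exhaust : ∀ {x} → x ^ e ≈ 1 [ p ] → ∃[ k ] (k < e × x ≈ a ^ suc k [ p ])
    powers-exhaust {x} hx = go (anyUpTo? (λ k → ≈-dec p x (a ^ suc k)) e)
      where
      powers : List ℕ
      powers = map (λ k → a ^ suc k) (upTo e)
      power-root : ∀ k → (a ^ suc k) ^ e ≈ 1 [ p ]
      power-root k = ≈-trans (≈-reflexive (trans (^-*-assoc a (suc k) e) (trans (cong (a ^_) (*-comm (suc k) e)) (sym (^-*-assoc a e (suc k)))))) (≈1-^ (suc k) (pow o))
      ≈-shift : ∀ {i j} → suc i ≈ suc j [ e ] → i ≈ j [ e ]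
      ≈-shift (cg u v eq) = cg u v (suc-injective eq)
      separate : ∀ {i j} → i < j → j < e → ¬ a ^ suc i ≈ a ^ suc j [ p ]
      separate i<j j<e eq = <⇒≢ i<j (≈⇒≡ e (<-trans i<j j<e) j<e (≈-shift (Order-inj o (∤⇒Inv-p p∤a) eq)))
      go : Dec (∃[ k ] (k < e × x ≈ a ^ suc k [ p ])) → ∃[ k ] (k < e × x ≈ a ^ suc k [ p ])
      go (yes found) = found
      go (no ¬found) = contradiction
        (roots-of-unity-bound pr e (x ∷ powers)
          (hx ∷ Allₚ.map⁺ (All.universal power-root (upTo e)))
          (Allₚ.map⁺ (Allₚ.applyUpTo⁺₁ id e (λ {k} k<e eq → ¬found (k , k<e , eq)))
           ∷ AllPairsₚ.map⁺ (AllPairsₚ.applyUpTo⁺₁ id e separate)))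
        (<⇒≱ (s≤s (≤-reflexive (sym (trans (length-map (λ k → a ^ suc k) (upTo e)) (length-upTo e))))))

    -- Write k + 1 = s c and e = f c with c the gcd. Then x^f = a^(e s) = 1, so e divides f, which
    -- forces e = f and c = 1.
    primitive-exponent : ∀ {x k} → Order p x e → x ≈ a ^ suc k [ p ] → gcd (suc k) e ≡ 1
    primitive-exponent {x} {k} ox eq with gcd[m,n]∣m (suc k) e | gcd[m,n]∣n (suc k) e
    ... | divides s k≡ | divides f e≡ = *-cancelˡ-≡ c 1 f {{f≢0}} (trans (sym e≡) (trans (∣-antisym (least ox f xf) (divides c (trans e≡ (*-comm f c)))) (sym (*-identityʳ f))))
      where
      c = gcd (suc k) e
      f≢0 : NonZero f
      f≢0 = ≢-nonZero λ { refl → ≢-nonZero⁻¹ e e≡ }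
      r : ∀ s c f → (s * c) * f ≡ (f * c) * s
      r = solve-∀
      xf : x ^ f ≈ 1 [ p ]
      xf = ≈-trans (≈-^ f eq) (≈-trans (≈-reflexive (trans (^-*-assoc a (suc k) f)
             (trans (cong (a ^_) (trans (cong (_* f) k≡) (trans (r s c f) (cong (_* s) (sym e≡))))) (sym (^-*-assoc a e s))))) (≈1-^ s (pow o)))

    -- Each residue of order e is charged to the exponent given by `powers-exhaust`; an exponent is
    -- charged at most once because it determines the residue.
    order-count-by : {C : ℕ → Set} (C? : ∀ k → Dec (C k)) → (∀ {x k} → Order p x e → x ≈ a ^ suc k [ p ] → C k) →
                     ∑< P (λ i → ind (ord (suc i) ≟ e)) ≤ ∑< e (λ k → ind (C? k))
    order-count-by C? exponent = ≤-trans (∑<-mono P (λ i i<P → le i i<P (ord (suc i) ≟ e))) (≤-trans (≤-reflexive (trans (∑-swap (upTo P) (upTo e) _)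
        (∑-cong (upTo e) λ k → ∑-*ˡ (upTo P) (ind (C? k)) (λ i → ind (≈-dec p (suc i) (a ^ suc k))))))
      (∑-mono (upTo e) λ k → ≤-trans (*-monoʳ-≤ (ind (C? k)) (unique k)) (≤-reflexive (*-identityʳ _))))
      where
      unique : ∀ k → ∑< P (λ i → ind (≈-dec p (suc i) (a ^ suc k))) ≤ 1
      unique k = ∑<-ind≤1 P (λ i → ≈-dec p (suc i) (a ^ suc k)) λ i j i<P j<P ei ej →
        suc-injective (≈⇒≡ p (suc<p i<P) (suc<p j<P) (≈-trans ei (≈-sym ej)))
      le : ∀ i → i < P → (dec : Dec (ord (suc i) ≡ e)) → ind dec ≤ ∑< e (λ k → ind (C? k) * ind (≈-dec p (suc i) (a ^ suc k)))
      le i i<P (no _)   = z≤n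
      le i i<P (yes eq) =
        let ox = subst (Order p (suc i)) eq (proj₁ (ord-Order (small∤ (s≤s z≤n) (suc<p i<P))))
            k , k<e , xk = powers-exhaust (pow ox)
        in ≤-trans (≤-reflexive (sym (cong₂ _*_ (ind-yes (C? k) (exponent ox xk)) (ind-yes (≈-dec p (suc i) (a ^ suc k)) xk))))
             (∑<-≥ e (λ k → ind (C? k) * ind (≈-dec p (suc i) (a ^ suc k))) k k<e)

    order-count : ∑< P (λ i → ind (ord (suc i) ≟ e)) ≤ φ e
    order-count = ≤-trans (order-count-by (λ k → gcd (suc k) e ≟ 1) primitive-exponent) (≤-reflexive (sym (φ-∑ e)))

  -- The number of residues of order (p-1)/d is at most φ((p-1)/d), and both sum to p - 1 over d.
  abstract
    primitive-root : ∃[ g ] (p ∤ g × Order p g P)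
    primitive-root = finish (∑<>0⇒ P (λ i → N 0 i) (subst (0 <_) (sym (∑<-squeeze P bound sums 0 0<P)) positive))
      where
      N : ℕ → ℕ → ℕ
      N j i = ind (ord (suc i) * suc j ≟ P)
      bound : ∀ j → j < P → ∑< P (N j) ≤ ind (suc j ∣? P) * (φ (P div suc j) * 1)
      bound j j<P with suc j ∣? P
      ... | no ¬d = ≤-reflexive (∑-zero (upTo P) λ i → ind-no (ord (suc i) * suc j ≟ P) λ eq → ¬d (divides (ord (suc i)) (sym eq)))
      ... | yes (divides e P≡) = ≤-trans (≤-reflexive (∑-cong (upTo P) λ i →
              ind-cong (ord (suc i) * suc j ≟ P) (ord (suc i) ≟ e) (λ eq → *-cancelʳ-≡ _ e (suc j) (trans eq P≡)) (λ eq → trans (cong (_* suc j) eq) (sym P≡))))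
            (≤-trans (go e (∑< P (λ i → ind (ord (suc i) ≟ e))) refl) (≤-reflexive
              (trans (cong φ (sym (trans (cong (_div suc j) P≡) (div-∣ e j)))) (sym (trans (+-identityʳ _) (*-identityʳ _))))))
        where
        -- If no residue has order e the bound is trivial; otherwise such a residue is the generator
        -- that `order-count` asks for.
        go : ∀ e s → ∑< P (λ i → ind (ord (suc i) ≟ e)) ≡ s → ∑< P (λ i → ind (ord (suc i) ≟ e)) ≤ φ e
        go e       zero    eq = subst (_≤ φ e) (sym eq) z≤n
        go e       (suc s) eq with ∑<>0⇒ P (λ i → ind (ord (suc i) ≟ e)) (subst (0 <_) (sym eq) (s≤s z≤n))
        ... | i , i<P , pos with ind>0⇒ (ord (suc i) ≟ e) pos | small∤ (s≤s z≤n) (suc<p i<P)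
        go zero    (suc s) eq | i , i<P , pos | oe | p∤ = contradiction (proj₂ (ord-Order p∤)) λ d →
          <-irrefl (sym (0∣⇒≡0 (subst (_∣ P) oe d))) 0<P
        go (suc e) (suc s) eq | i , i<P , pos | oe | p∤ = order-count p∤ (subst (Order p (suc i)) oe (proj₁ (ord-Order p∤)))
      sums : ∑< P (λ j → ∑< P (N j)) ≡ ∑< P (λ j → ind (suc j ∣? P) * (φ (P div suc j) * 1))
      sums = trans (∑-swap (upTo P) (upTo P) N) (trans (∑<-cong P one) (∑<-gcd P (λ _ → 1)))
        where
        one : ∀ i → i < P → ∑< P (λ j → N j i) ≡ 1
        one i i<P with proj₂ (ord-Order (small∤ (s≤s z≤n) (suc<p i<P)))
        ... | divides zero    P≡ = contradiction (subst (0 <_) P≡ 0<P) (<-irrefl refl)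
        ... | divides (suc k) P≡ = trans (∑<-single P k k<P λ j _ j≢k → ind-no (ord (suc i) * suc j ≟ P) λ eq →
                j≢k (suc-injective (*-cancelˡ-≡ (suc j) (suc k) (ord (suc i)) {{ord≢0}} (trans eq (trans P≡ (*-comm (suc k) _))))))
              (ind-yes (ord (suc i) * suc k ≟ P) (trans (*-comm _ (suc k)) (sym P≡)))
          where
          ord≢0 : NonZero (ord (suc i))
          ord≢0 = ≢-nonZero λ z → <-irrefl (sym (trans P≡ (trans (cong (suc k *_) z) (*-zeroʳ (suc k))))) 0<P
          k<P : k < P
          k<P = ≤-trans (m≤m*n (suc k) (ord (suc i)) {{ord≢0}}) (≤-reflexive (sym P≡))
      -- At j = 0 the bound is φ(p - 1), which is positive; since the squeeze makes it an equality,
      -- some residue has order p - 1.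
      positive : 0 < ind (1 ∣? P) * (φ (P div 1) * 1)
      positive = subst (0 <_) (sym (trans (cong (_* (φ (P div 1) * 1)) (ind-yes (1 ∣? P) (1∣ P)))
        (trans (+-identityʳ _) (trans (*-identityʳ _) (cong φ (trans (cong (_div 1) (sym (*-identityʳ P))) (div-∣ P 0))))))) φP>0
        where
        φP>0 : 0 < φ P
        φP>0 = subst (0 <_) (sym (φ-∑ P)) (≤-trans (≤-reflexive (sym (ind-yes (gcd 1 P ≟ 1) (∣1⇒≡1 (gcd[m,n]∣m 1 P))))) (∑<-≥ P (λ j → ind (gcd (suc j) P ≟ 1)) 0 0<P))
      finish : ∃[ i ] (i < P × 0 < N 0 i) → ∃[ g ] (p ∤ g × Order p g P)
      finish (i , i<P , pos) = suc i , p∤ , subst (Order p (suc i)) (trans (sym (*-identityʳ _)) (ind>0⇒ (ord (suc i) * 1 ≟ P) pos)) (proj₁ (ord-Order p∤))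
        where
        p∤ : p ∤ suc i
        p∤ = small∤ (s≤s z≤n) (suc<p i<P)

-- Lifting a primitive root from p to all powers of p

-- The binomial coefficient n over 2, by recursion so that no division occurs.
triangular : ℕ → ℕ
triangular zero    = 0
triangular (suc n) = triangular n + n

triangular-2 : ∀ n → 2 * triangular (suc n) ≡ suc n * n
triangular-2 zero    = refl
triangular-2 (suc n) = trans (*-distribˡ-+ 2 (triangular (suc n)) (suc n)) (trans (cong (_+ 2 * suc n) (triangular-2 n)) (r n))
  where
  r : ∀ n → suc n * n + 2 * suc n ≡ suc (suc n) * suc n
  r = solve-∀

-- The quadratic term is kept explicit since y² alone is not divisible by a high enough power when y
-- = p u; there the factor p of the binomial coefficient is indispensable. The cubic remainder
-- always suffices.
binomial₃ : ∀ y e → ∃[ W ] ((1 + y) ^ e ≡ 1 + e * y + triangular e * (y * y) + y * y * y * W)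
binomial₃ y zero    = 0 , r y
  where
  r : ∀ y → 1 ≡ 1 + 0 * y + 0 * (y * y) + y * y * y * 0
  r = solve-∀
binomial₃ y (suc e) with binomial₃ y e
... | W , eq = W + triangular e + y * W , trans (cong ((1 + y) *_) eq) (r y e (triangular e) W)
  where
  r : ∀ y e T W → (1 + y) * (1 + e * y + T * (y * y) + y * y * y * W)
      ≡ 1 + suc e * y + (T + e) * (y * y) + y * y * y * (W + T + y * W)
  r = solve-∀

module OddPrime (p : ℕ) (pr : Prime p) (p-odd : p % 2 ≡ 1) where

  open ModPrime p pr public

  2∤p : 2 ∤ p
  2∤p 2∣p = 1+n≢0 (trans (sym p-odd) (n∣m⇒m%n≡0 p 2 2∣p))

  p≢2 : p ≢ 2
  p≢2 refl = 2∤p ∣-refl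

  2<p : 2 < p
  2<p = ≤∧≢⇒< 1<p (p≢2 ∘ sym)

  p∤2 : p ∤ 2
  p∤2 = small∤ (s≤s z≤n) 2<p

  p∤P : p ∤ P
  p∤P = small∤ 0<P P<p

  p∤1 : p ∤ 1
  p∤1 = small∤ (s≤s z≤n) 1<p

  abstract
    -- Twice the binomial coefficient is p(p - 1), and the odd prime p does not divide 2.
    p∣triangular : ∃[ t ] (triangular p ≡ t * p)
    p∣triangular with euclidsLemma 2 (triangular p) pr (divides P (trans (cong (λ n → 2 * triangular n) (sym 1+P≡p)) (trans (triangular-2 P)
                        (trans (*-comm (suc P) P) (cong (P *_) 1+P≡p)))))
    ... | inj₁ p∣2 = contradiction p∣2 p∤2
    ... | inj₂ (divides t eq) = t , eq

  p^≢0 : ∀ k → NonZero (p ^ k)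
  p^≢0 k = m^n≢0 p k

  abstract
    -- With y = p^(k+1) u the linear term p y is p^(k+2) u, while the quadratic term, through
    -- `p∣triangular`, and the cubic one are divisible by p^(k+3). Hence `u′` is u modulo p.
    raise : ∀ k u → p ∤ u → ∃[ u′ ] (p ∤ u′ × (1 + p ^ suc k * u) ^ p ≡ 1 + p ^ suc (suc k) * u′)
    raise k u p∤u with p∣triangular | binomial₃ (p ^ suc k * u) p
    ... | t , T≡ | W , eq = u + p * V , (λ p∣u′ → p∤u (∣m+n∣m⇒∣n (subst (p ∣_) (+-comm u (p * V)) p∣u′) (m∣m*n V))) ,
      trans eq (trans (cong (λ T → 1 + p * y + T * (y * y) + y * y * y * W) T≡) (r p (p ^ k) u t W))
      where
      y V : ℕ
      y = p ^ suc k * u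
      V = p ^ k * t * (u * u) + p ^ k * p ^ k * (u * u * u) * W
      r : ∀ p K u t W → 1 + p * (p * K * u) + t * p * (p * K * u * (p * K * u)) + p * K * u * (p * K * u) * (p * K * u) * W
          ≡ 1 + p * (p * K) * (u + p * (K * t * (u * u) + K * K * (u * u * u) * W))
      r = solve-∀

  raise-power : ∀ r k u → p ∤ u → (1 + p ^ suc k * u) ^ (p ^ r) ≈ 1 [ p ^ (suc k + r) ]
  raise-power zero    k u p∤u = ≈-trans (≈-reflexive (^-identityʳ _)) (∣⇒+-≈ 1 (subst (λ j → p ^ j ∣ p ^ suc k * u) (sym (+-identityʳ (suc k))) (m∣m*n u)))
  raise-power (suc r) k u p∤u with raise k u p∤u
  ... | u′ , p∤u′ , eq = subst (λ j → (1 + p ^ suc k * u) ^ (p ^ suc r) ≈ 1 [ p ^ j ]) (sym (+-suc (suc k) r))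
    (≈-trans (≈-reflexive (trans (sym (^-*-assoc _ p (p ^ r))) (cong (_^ (p ^ r)) eq))) (raise-power r (suc k) u′ p∤u′))

  -- Modulo p^(k+2) the power is 1 + e p^(k+1) u, so p divides e. Writing e = f p, the p-th power
  -- supplied by `raise` has one more factor p, and the induction continues with f and r - 1.
  raise-order : ∀ r k u e → p ∤ u → (1 + p ^ suc k * u) ^ e ≈ 1 [ p ^ (suc k + r) ] → p ^ r ∣ e
  raise-order zero    k u e p∤u h = 1∣ e
  raise-order (suc r) k u e p∤u h = multiple p∣e
    where
    y = p ^ suc k * u
    h′ : (1 + y) ^ e ≈ 1 [ p ^ suc (suc k) ]
    h′ = ≈-∣ (subst (p ^ suc (suc k) ∣_) (trans (sym (^-distribˡ-+-* p (suc (suc k)) r)) (cong (p ^_) (sym (+-suc (suc k) r)))) (m∣m*n (p ^ r))) h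
    p∣e : p ∣ e
    p∣e with binomial₃ y e
    ... | W , eq = [ id , (λ p∣u → contradiction p∣u p∤u) ]′ (euclidsLemma e u pr
      (*-cancelˡ-∣ (p ^ suc k) {{p^≢0 (suc k)}} (subst₂ _∣_ (*-comm p (p ^ suc k)) (r₂ e (p ^ suc k) u)
        (+-cancel-≈ 1 (≈-trans (≈-sym (∣⇒+-≈ (1 + e * y) (divides V (r₁ p (p ^ k) u (triangular e) W)))) (≈-trans (≈-reflexive (trans (sym (+-assoc (1 + e * y) _ _)) (sym eq))) h′))))))
      where
      V = p ^ k * (u * u) * (triangular e + p ^ suc k * u * W)
      r₁ : ∀ p K u T W → T * (p * K * u * (p * K * u)) + p * K * u * (p * K * u) * (p * K * u) * W
           ≡ K * (u * u) * (T + p * K * u * W) * (p * (p * K))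
      r₁ = solve-∀
      r₂ : ∀ e K u → e * (K * u) ≡ K * (e * u)
      r₂ = solve-∀
    multiple : p ∣ e → p ^ suc r ∣ e
    multiple (divides f e≡) = subst (p ^ suc r ∣_) (trans (*-comm p f) (sym e≡)) (*-monoʳ-∣ p (raise-order r (suc k) u′ f p∤u′ h″))
      where
      u′ : ℕ
      u′ = proj₁ (raise k u p∤u)
      p∤u′ : p ∤ u′
      p∤u′ = proj₁ (proj₂ (raise k u p∤u))
      power : (1 + p ^ suc (suc k) * u′) ^ f ≡ (1 + y) ^ e
      power = trans (cong (_^ f) (sym (proj₂ (proj₂ (raise k u p∤u))))) (trans (^-*-assoc (1 + y) p f) (cong ((1 + y) ^_) (trans (*-comm p f) (sym e≡))))
      h″ : (1 + p ^ suc (suc k) * u′) ^ f ≈ 1 [ p ^ (suc (suc k) + r) ]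
      h″ = subst₂ (λ x j → x ≈ 1 [ p ^ j ]) (sym power) (+-suc (suc k) r) h

  ≈1⇒1+ : ∀ {x q} → 0 < x → x ≈ 1 [ q ] → ∃[ z ] (x ≡ 1 + q * z)
  ≈1⇒1+ {suc x} {q} _ e with +-cancel-≈ 1 e
  ... | divides z eq = z , cong suc (trans eq (*-comm z q))

  odd-lift : ∀ x → ∃[ y ] (2 ∤ y × y ≈ x [ p ])
  odd-lift x with 2 ∣? x
  ... | no 2∤x  = x , 2∤x , ≈-refl
  ... | yes 2∣x = x + p , (λ 2∣x+p → 2∤p (∣m+n∣m⇒∣n 2∣x+p 2∣x)) , ∣⇒+-≈ x ∣-refl

  Order-resp : ∀ {q x y d} → x ≈ y [ q ] → Order q x d → Order q y d
  Order-resp {d = d} e o = record { pow = ≈-trans (≈-^ d (≈-sym e)) (pow o) ; least = λ f h → least o f (≈-trans (≈-^ f e) h) }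

  ^p-≈1 : ∀ z → (1 + p * z) ^ p ≈ 1 [ p * p ]
  ^p-≈1 z = let W , eq = binomial₃ (p * z) p in
    ≈-trans (≈-reflexive (trans eq (r p z (triangular p) W))) (∣⇒+-≈ 1 (m∣m*n (z + triangular p * (z * z) + z * z * p * z * W)))
    where
    r : ∀ p z T W → 1 + p * (p * z) + T * (p * z * (p * z)) + p * z * (p * z) * (p * z) * W ≡ 1 + p * p * (z + T * (z * z) + z * z * p * z * W)
    r = solve-∀

  [1+2p]^P : (1 + p * 2) ^ P ≈ 1 + p * (2 * P) [ p * p ]
  [1+2p]^P = let W , eq = binomial₃ (p * 2) P in
    ≈-trans (≈-reflexive (trans eq (r p P (triangular P) W))) (∣⇒+-≈ (1 + p * (2 * P)) (m∣m*n (4 * triangular P + 8 * p * W)))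
    where
    r : ∀ p P T W → 1 + P * (p * 2) + T * (p * 2 * (p * 2)) + p * 2 * (p * 2) * (p * 2) * W ≡ 1 + p * (2 * P) + p * p * (4 * T + 8 * p * W)
    r = solve-∀

  2∤⇒>0 : ∀ {x} → 2 ∤ x → 0 < x
  2∤⇒>0 {zero}  2∤0 = contradiction (2 ∣0) 2∤0
  2∤⇒>0 {suc x} _   = s≤s z≤n

  -- If g₀ is a primitive root mod p, then g₀ᵖ ≡ g₀ mod p has order p - 1 also mod p², and the
  -- factor 1 + 2p (odd, and ≡ 1 mod p) turns the (p-1)-st power into 1 + 2(p-1)p mod p².
  module Lift (g₀ : ℕ) (odd₀ : 2 ∤ g₀) (p∤g₀ : p ∤ g₀) (o₀ : Order p g₀ P) where

    s : ℕ
    s = 1 + p * 2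

    g : ℕ
    g = g₀ ^ p * s

    odd-s : 2 ∤ s
    odd-s 2∣s = contradiction (∣1⇒≡1 (∣m+n∣m⇒∣n (subst (2 ∣_) (+-comm 1 (p * 2)) 2∣s) (n∣m*n p))) λ ()

    odd : 2 ∤ g
    odd = ∤-* prime[2] (∤-^ prime[2] odd₀ p) odd-s

    g₀^p : g₀ ^ p ≈ g₀ [ p ]
    g₀^p = ≈-trans (≈-reflexive (trans (cong (g₀ ^_) (sym 1+P≡p)) (*-comm g₀ (g₀ ^ P)))) (≈-trans (≈-*ʳ g₀ (fermat p∤g₀)) (≈-reflexive (+-identityʳ g₀)))

    g≈g₀ : g ≈ g₀ [ p ]
    g≈g₀ = ≈-trans (≈-* g₀^p (∣⇒+-≈ 1 (m∣m*n 2))) (≈-reflexive (*-identityʳ g₀))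

    p∤g : p ∤ g
    p∤g = p∤g₀ ∘ ∣-resp-≈ ∣-refl g≈g₀

    order-p : Order p g P
    order-p = Order-resp (≈-sym g≈g₀) o₀

    first-factor : (g₀ ^ p) ^ P ≈ 1 [ p * p ]
    first-factor = let z , eq = ≈1⇒1+ (2∤⇒>0 (∤-^ prime[2] odd₀ P)) (fermat p∤g₀) in
      ≈-trans (≈-reflexive (trans (^-*-assoc g₀ p P) (trans (cong (g₀ ^_) (*-comm p P)) (trans (sym (^-*-assoc g₀ P p)) (cong (_^ p) eq))))) (^p-≈1 z)

    u : ℕ
    u = proj₁ (≈1⇒1+ (2∤⇒>0 (∤-^ prime[2] odd P)) (pow order-p))

    g^P : g ^ P ≡ 1 + p * u
    g^P = proj₂ (≈1⇒1+ (2∤⇒>0 (∤-^ prime[2] odd P)) (pow order-p))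

    u≈ : u ≈ 2 * P [ p ]
    u≈ = ≈-unscale p (1+-cancel (≈-trans (≈-reflexive (trans (sym g^P) (^-* (g₀ ^ p) s P)))
           (≈-trans (≈-* first-factor [1+2p]^P) (≈-reflexive (+-identityʳ (1 + p * (2 * P)))))))
      where
      1+-cancel : ∀ {a b q} → 1 + a ≈ 1 + b [ q ] → a ≈ b [ q ]
      1+-cancel (cg v w eq) = cg v w (suc-injective eq)

    p∤u : p ∤ u
    p∤u = ∤-* pr p∤2 p∤P ∘ ∣-resp-≈ ∣-refl u≈

  abstract
    lifted : ∃[ g ] (2 ∤ g × p ∤ g × Order p g P × ∃[ u ] (p ∤ u × g ^ P ≡ 1 + p * u))
    lifted = let g₁ , p∤g₁ , o₁ = primitive-root
                 g₀ , odd₀ , g₀≈g₁ = odd-lift g₁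
                 module L = Lift g₀ odd₀ (p∤g₁ ∘ ∣-resp-≈ ∣-refl g₀≈g₁) (Order-resp (≈-sym g₀≈g₁) o₁)
             in L.g , L.odd , L.p∤g , L.order-p , L.u , L.p∤u , L.g^P

  g : ℕ
  g = proj₁ lifted

  2∤g : 2 ∤ g
  2∤g = proj₁ (proj₂ lifted)

  p∤g : p ∤ g
  p∤g = proj₁ (proj₂ (proj₂ lifted))

  -- The order of g modulo p gives that P divides e. The remaining factor f of e is an exponent of
  -- g^P = 1 + p u with p not dividing u, whose order modulo p^(j+1) is p^j by `raise-power` and
  -- `raise-order`.
  g-order : ∀ j → Order (p ^ suc j) g (p ^ j * P)
  g-order j = record { pow = power ; least = divisor }
    where
    o : Order p g P
    o = proj₁ (proj₂ (proj₂ (proj₂ lifted)))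
    u : ℕ
    u = proj₁ (proj₂ (proj₂ (proj₂ (proj₂ lifted))))
    p∤u : p ∤ u
    p∤u = proj₁ (proj₂ (proj₂ (proj₂ (proj₂ (proj₂ lifted)))))
    eq : g ^ P ≡ 1 + p * u
    eq = proj₂ (proj₂ (proj₂ (proj₂ (proj₂ (proj₂ lifted)))))
    eq′ : g ^ P ≡ 1 + p ^ 1 * u
    eq′ = trans eq (cong (λ q → 1 + q * u) (sym (*-identityʳ p)))
    power : g ^ (p ^ j * P) ≈ 1 [ p ^ suc j ]
    power = ≈-trans (≈-reflexive (trans (cong (g ^_) (*-comm (p ^ j) P)) (trans (sym (^-*-assoc g P (p ^ j))) (cong (_^ (p ^ j)) eq′)))) (raise-power j 0 u p∤u)
    divisor : ∀ e → g ^ e ≈ 1 [ p ^ suc j ] → p ^ j * P ∣ e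
    divisor e h with least o e (≈-∣ (m∣m*n (p ^ j)) h)
    ... | divides f refl = *-monoˡ-∣ P (raise-order j 0 u f p∤u
      (≈-trans (≈-reflexive (trans (cong (_^ f) (sym eq′)) (trans (^-*-assoc g P f) (cong (g ^_) (*-comm P f))))) h))

  count-∤ : ∀ N → ∑< (N * p) (λ i → ind (¬? (p ∣? i))) ≡ N * P
  count-∤ N = trans (∑<-blocks N p _) (trans (∑-cong (upTo N) block) (∑<-const N P))
    where
    block : ∀ a → ∑< p (λ b → ind (¬? (p ∣? (a * p + b)))) ≡ P
    block a = trans (cong (λ n → ∑< n F) (sym 1+P≡p)) (trans (∑<-suc P F) (trans
      (cong₂ _+_ (ind-no (¬? (p ∣? (a * p + 0))) (λ ∤ → ∤ (subst (p ∣_) (sym (+-identityʳ _)) (n∣m*n a))))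
        (∑<-cong P λ b b<P → ind-yes (¬? (p ∣? (a * p + suc b))) (λ p∣ → small∤ (s≤s z≤n) (≤-trans (s≤s b<P) P<p) (∣m+n∣m⇒∣n p∣ (n∣m*n a)))))
      (trans (∑<-const P 1) (*-identityʳ P))))
      where
      F : ℕ → ℕ
      F b = ind (¬? (p ∣? (a * p + b)))

  φ-prime-power : ∀ j → φ (p ^ suc j) ≡ p ^ j * P
  φ-prime-power j = begin
    φ q                                        ≡⟨ φ-∑ q ⟩
    ∑< q (λ i → ind (gcd (suc i) q ≟ 1))       ≡⟨ ∑-cong (upTo q) (λ i → trans (ind-cong (gcd (suc i) q ≟ 1) (¬? (p ∣? suc i)) (to i) (from i)) (cong F (+-comm 1 i))) ⟩
    ∑< q (λ i → F (i + 1))                     ≡⟨ ∑<-periodic q F periodic 1 ⟩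
    ∑< q F                                     ≡⟨ cong (λ n → ∑< n F) (*-comm p (p ^ j)) ⟩
    ∑< (p ^ j * p) F                           ≡⟨ count-∤ (p ^ j) ⟩
    p ^ j * P ∎
    where
    open ≡-Reasoning
    q = p ^ suc j
    F : ℕ → ℕ
    F i = ind (¬? (p ∣? i))
    p∣q : p ∣ q
    p∣q = m∣m*n (p ^ j)
    to : ∀ i → gcd (suc i) q ≡ 1 → p ∤ suc i
    to i eq p∣i = p∤1 (subst (p ∣_) eq (gcd-greatest p∣i p∣q))
    from : ∀ i → p ∤ suc i → gcd (suc i) q ≡ 1
    from i p∤i = coprime⇒gcd≡1 (coprime-^ (suc j) (∤⇒coprime pr p∤i))
    periodic : ∀ i → F (i + q) ≡ F i
    periodic i = ind-cong (¬? (p ∣? (i + q))) (¬? (p ∣? i)) (λ ∤ p∣i → ∤ (∣m∣n⇒∣m+n p∣i p∣q))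
                   (λ ∤ p∣ → ∤ (∣m+n∣m⇒∣n (subst (p ∣_) (+-comm i q) p∣) p∣q))

  -- Discrete logarithms modulo powers of p

  g-Inv : ∀ j → Inv (p ^ j) g
  g-Inv j = ∤⇒Inv j pr p∤g

  order : ℕ → ℕ
  order j = p ^ j * P

  residue : ℕ → ℕ → ℕ
  residue j x = _%_ x (p ^ suc j) {{p^≢0 (suc j)}}

  residue-≈ : ∀ j x → residue j x ≈ x [ p ^ suc j ]
  residue-≈ j x = ≈-% x (p ^ suc j) {{p^≢0 (suc j)}}

  residue< : ∀ j x → residue j x < p ^ suc j
  residue< j x = m%n<n x (p ^ suc j) {{p^≢0 (suc j)}}

  residue-≡⇒≈ : ∀ j x y → residue j x ≡ residue j y → x ≈ y [ p ^ suc j ]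
  residue-≡⇒≈ j x y = %⇒≈ (p ^ suc j) {{p^≢0 (suc j)}}

  -- The exponents below the order give distinct units, so every residue is hit at most as often as
  -- the right-hand side says. There are as many exponents as units, and the squeeze yields
  -- equality.
  log-count : ∀ j i → i < p ^ suc j → ∑< (order j) (λ t → ind (i ≟ residue j (g ^ t))) ≡ ind (¬? (p ∣? i))
  log-count j i i<q = ∑<-squeeze q at-most-one total i i<q
    where
    q = p ^ suc j
    c = order j
    hit : ℕ → ℕ → ℕ
    hit t i = ind (i ≟ residue j (g ^ t))
    F : ℕ → ℕ
    F i = ind (¬? (p ∣? i))
    at-most-one : ∀ i → i < q → ∑< c (λ t → hit t i) ≤ F i
    at-most-one i _ with p ∣? i
    ... | yes p∣i = ≤-reflexive (∑-zero (upTo c) λ t → ind-no (i ≟ residue j (g ^ t)) λ eq →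
                      ∤-^ pr p∤g t (∣-resp-≈ (m∣m*n (p ^ j)) (residue-≈ j (g ^ t)) (subst (p ∣_) eq p∣i)))
    ... | no _    = ∑<-ind≤1 c (λ t → i ≟ residue j (g ^ t)) λ s t s<c t<c es et →
                      ≈⇒≡ c {{>-nonZero (≤-<-trans z≤n s<c)}} s<c t<c (Order-inj (g-order j) (g-Inv (suc j)) (residue-≡⇒≈ j (g ^ s) (g ^ t) (trans (sym es) et)))
    total : ∑< q (λ i → ∑< c (λ t → hit t i)) ≡ ∑< q F
    total = trans (∑-swap (upTo q) (upTo c) _) (trans (∑-cong (upTo c) λ t →
        trans (∑<-single q (residue j (g ^ t)) (residue< j (g ^ t)) (λ i _ i≢ → ind-no (i ≟ residue j (g ^ t)) i≢)) (ind-yes (residue j (g ^ t) ≟ residue j (g ^ t)) refl))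
      (trans (trans (∑<-const c 1) (*-identityʳ c)) (sym (trans (cong (λ n → ∑< n F) (*-comm p (p ^ j))) (count-∤ (p ^ j))))))

  abstract
    discrete-log : ∀ j {x} → p ∤ x → ∃[ t ] (x ≈ g ^ t [ p ^ suc j ])
    discrete-log j {x} p∤x = found (∑<>0⇒ (order j) _ (subst (0 <_) (sym everywhere) (s≤s z≤n)))
      where
      q : ℕ
      q = p ^ suc j
      everywhere : ∑< (order j) (λ t → ind (residue j x ≟ residue j (g ^ t))) ≡ 1
      everywhere = trans (log-count j (residue j x) (residue< j x)) (ind-yes (¬? (p ∣? (residue j x))) (p∤x ∘ ∣-resp-≈ (m∣m*n (p ^ j)) (residue-≈ j x)))
      found : ∃[ t ] (t < order j × 0 < ind (residue j x ≟ residue j (g ^ t))) → ∃[ t ] (x ≈ g ^ t [ q ])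
      found (t , _ , pos) = t , residue-≡⇒≈ j x (g ^ t) (ind>0⇒ (residue j x ≟ residue j (g ^ t)) pos)

-- Generating functions

infix 4 _≋_
_≋_ : Poly → Poly → Set
f ≋ g = ∀ k → f k ≡ g k

≋-trans : ∀ {f g h} → f ≋ g → g ≋ h → f ≋ h
≋-trans e e′ k = trans (e k) (e′ k)

⊛-∑ : ∀ f g k → (f ⊛ g) k ≡ ∑< (suc k) (λ i → f i * g (k ∸ i))
⊛-∑ f g k = ∑-sum (upTo (suc k)) _

⊛-cong : ∀ {f f′ g g′} → f ≋ f′ → g ≋ g′ → f ⊛ g ≋ f′ ⊛ g′
⊛-cong {f} {f′} {g} {g′} e e′ k = trans (⊛-∑ f g k) (trans (∑-cong (upTo (suc k)) λ i → cong₂ _*_ (e i) (e′ (k ∸ i))) (sym (⊛-∑ f′ g′ k)))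

minus1-cong : ∀ {f g} → f ≋ g → minus1 f ≋ minus1 g
minus1-cong e zero    = cong (_∸ 1) (e 0)
minus1-cong e (suc k) = e (suc k)

xpow-ind : ∀ e k → xpow e k ≡ ind (e ≟ k)
xpow-ind e k with e ≟ k
... | yes _ = refl
... | no _  = refl

pconst-ind : ∀ k → pconst 1 k ≡ ind (0 ≟ k)
pconst-ind zero    = refl
pconst-ind (suc k) = refl

psum-at : {A : Set} (xs : List A) (f : A → Poly) (k : ℕ) → psum (map f xs) k ≡ ∑ xs (λ x → f x k)
psum-at []       f zero    = refl
psum-at []       f (suc k) = refl
psum-at (x ∷ xs) f k = cong (f x k +_) (psum-at xs f k)

-- The generating polynomial of the statistic w: the sum of ι(x) X^(w x), where ι is an indicator or
-- a product of indicators.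
gf : {A : Set} → List A → (A → ℕ) → (A → ℕ) → Poly
gf xs ι w k = ∑ xs (λ x → ι x * ind (w x ≟ k))

∑<-convolution : ∀ a b k → ∑< (suc k) (λ i → ind (a ≟ i) * ind (b ≟ k ∸ i)) ≡ ind (a + b ≟ k)
∑<-convolution a b k with a ≤? k
... | yes a≤k = trans (∑<-single (suc k) a (s≤s a≤k) (λ i _ i≢a → cong (_* ind (b ≟ k ∸ i)) (ind-no (a ≟ i) (i≢a ∘ sym))))
  (trans (cong (_* ind (b ≟ k ∸ a)) (ind-yes (a ≟ a) refl)) (trans (*-identityˡ _)
    (ind-cong (b ≟ k ∸ a) (a + b ≟ k) (λ eq → trans (cong (a +_) eq) (m+[n∸m]≡n a≤k)) (λ eq → trans (sym (m+n∸m≡n a b)) (cong (_∸ a) eq)))))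
... | no a≰k = trans (trans (∑<-cong (suc k) λ i i≤k → cong (_* ind (b ≟ k ∸ i)) (ind-no (a ≟ i) (λ { refl → a≰k (≤-pred i≤k) }))) (∑-zero (upTo (suc k)) λ _ → refl))
  (sym (ind-no (a + b ≟ k) λ eq → a≰k (subst (a ≤_) eq (m≤m+n a b))))

gf-* : {A B C : Set} (xs : List A) (ys : List B) (c : A → B → C) {ι w : A → ℕ} {κ v : B → ℕ} {ζ u : C → ℕ} →
       (∀ x y → ζ (c x y) ≡ ι x * κ y) → (∀ x y → u (c x y) ≡ w x + v y) →
       gf (cartesianProductWith c xs ys) ζ u ≋ gf xs ι w ⊛ gf ys κ v
gf-* xs ys c {ι} {w} {κ} {v} {ζ} {u} ζ≡ u≡ k = begin
  gf (cartesianProductWith c xs ys) ζ u k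
    ≡⟨ ∑-prod c xs ys _ ⟩
  ∑ xs (λ x → ∑ ys (λ y → ζ (c x y) * ind (u (c x y) ≟ k)))
    ≡⟨ ∑-cong xs (λ x → ∑-cong ys λ y → term x y) ⟩
  ∑ xs (λ x → ∑ ys (λ y → ∑< (suc k) (λ i → (ι x * ind (w x ≟ i)) * (κ y * ind (v y ≟ k ∸ i)))))
    ≡⟨ ∑-cong xs (λ x → ∑-swap ys (upTo (suc k)) _) ⟩
  ∑ xs (λ x → ∑< (suc k) (λ i → ∑ ys (λ y → (ι x * ind (w x ≟ i)) * (κ y * ind (v y ≟ k ∸ i)))))
    ≡⟨ ∑-cong xs (λ x → ∑-cong (upTo (suc k)) λ i → ∑-*ˡ ys (ι x * ind (w x ≟ i)) (λ y → κ y * ind (v y ≟ k ∸ i))) ⟩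
  ∑ xs (λ x → ∑< (suc k) (λ i → (ι x * ind (w x ≟ i)) * gf ys κ v (k ∸ i)))
    ≡⟨ ∑-swap xs (upTo (suc k)) _ ⟩
  ∑< (suc k) (λ i → ∑ xs (λ x → (ι x * ind (w x ≟ i)) * gf ys κ v (k ∸ i)))
    ≡⟨ ∑-cong (upTo (suc k)) (λ i → ∑-*ʳ xs (gf ys κ v (k ∸ i)) (λ x → ι x * ind (w x ≟ i))) ⟩
  ∑< (suc k) (λ i → gf xs ι w i * gf ys κ v (k ∸ i))
    ≡⟨ ⊛-∑ (gf xs ι w) (gf ys κ v) k ⟨
  (gf xs ι w ⊛ gf ys κ v) k ∎
  where
  open ≡-Reasoning
  r : ∀ a b c d → (a * b) * (c * d) ≡ (a * c) * (b * d)
  r = solve-∀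
  term : ∀ x y → ζ (c x y) * ind (u (c x y) ≟ k) ≡ ∑< (suc k) (λ i → (ι x * ind (w x ≟ i)) * (κ y * ind (v y ≟ k ∸ i)))
  term x y = trans (cong₂ _*_ (ζ≡ x y) (trans (cong (λ a → ind (a ≟ k)) (u≡ x y)) (sym (∑<-convolution (w x) (v y) k))))
    (trans (sym (∑-*ˡ (upTo (suc k)) (ι x * κ y) (λ i → ind (w x ≟ i) * ind (v y ≟ k ∸ i)))) (∑-cong (upTo (suc k)) λ i → r (ι x) (κ y) _ _))

-- The omitted element has weight 0 and contributes exactly 1 to the constant term, so the truncated
-- subtraction in `minus1` is exact.
gf-minus1 : {A : Set} {_≟A_ : DecidableEquality A} {xs : List A} → Enum _≟A_ xs → (z : A) (w : A → ℕ) → w z ≡ 0 →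
            gf xs (λ x → ind (¬? (x ≟A z))) w ≋ minus1 (gf xs (λ _ → 1) w)
gf-minus1 {_≟A_ = _≟A_} {xs} en z w wz k = go k
  where
  split : ∀ k → gf xs (λ _ → 1) w k ≡ pconst 1 k + gf xs (λ x → ind (¬? (x ≟A z))) w k
  split k = trans (∑-cong xs λ x → trans (cong (_* ind (w x ≟ k)) (one x)) (*-distribʳ-+ _ (ind (x ≟A z)) _))
    (trans (∑-+ xs _ _) (cong (_+ gf xs (λ x → ind (¬? (x ≟A z))) w k)
      (trans (∑-collapse en z (λ x → ind (w x ≟ k))) (trans (cong (λ a → ind (a ≟ k)) wz) (sym (pconst-ind k))))))
    where
    one : ∀ x → 1 ≡ ind (x ≟A z) + ind (¬? (x ≟A z))
    one x with x ≟A z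
    ... | yes _ = refl
    ... | no _  = refl
  go : ∀ k → gf xs (λ x → ind (¬? (x ≟A z))) w k ≡ minus1 (gf xs (λ _ → 1) w) k
  go zero    = sym (cong (_∸ 1) (split 0))
  go (suc k) = sym (split (suc k))

-- Bit vectors and families of bit vectors

⟦_⟧ : Bool → ℕ
⟦ false ⟧ = 0
⟦ true ⟧  = 1

bools : List Bool
bools = false ∷ true ∷ []

Enum-bools : Enum Bool._≟_ bools
Enum-bools = mk-enum λ { false → refl ; true → refl }

gf-bools : ∀ e → gf bools (λ _ → 1) (λ b → e * ⟦ b ⟧) ≋ pconst 1 ⊕ xpow e
gf-bools e k = cong₂ _+_
  (trans (+-identityʳ _) (trans (cong (λ a → ind (a ≟ k)) (*-zeroʳ e)) (sym (pconst-ind k))))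
  (trans (+-identityʳ _) (trans (+-identityʳ _) (trans (cong (λ a → ind (a ≟ k)) (*-identityʳ e)) (sym (xpow-ind e k)))))

vecs : ∀ n → List (Vec Bool n)
vecs zero    = [] ∷ []
vecs (suc n) = cartesianProductWith _∷_ bools (vecs n)

_≟V_ : ∀ {n} → DecidableEquality (Vec Bool n)
_≟V_ = Vecₚ.≡-dec Bool._≟_

Enum-vecs : ∀ n → Enum _≟V_ (vecs n)
Enum-vecs zero    = mk-enum λ { [] → refl }
Enum-vecs (suc n) = mk-enum λ { (b ∷ v) → Enum-prod Enum-bools (Enum-vecs n) _≟V_ _∷_ Vecₚ.∷-injective b v }

weight : ∀ {n} → Vec Bool n → ℕ
weight []      = 0
weight (b ∷ v) = ⟦ b ⟧ + weight v

weight-0 : ∀ n → weight (replicate n false) ≡ 0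
weight-0 zero    = refl
weight-0 (suc n) = weight-0 n

gf-vecs : ∀ e n → gf (vecs n) (λ _ → 1) (λ v → e * weight v) ≋ ppow (pconst 1 ⊕ xpow e) n
gf-vecs e zero    k = trans (+-identityʳ _) (trans (+-identityʳ _) (trans (cong (λ a → ind (a ≟ k)) (*-zeroʳ e)) (sym (pconst-ind k))))
gf-vecs e (suc n) = ≋-trans (gf-* bools (vecs n) _∷_ {ι = λ _ → 1} {λ b → e * ⟦ b ⟧} {λ _ → 1} {λ v → e * weight v} {λ _ → 1} {λ v → e * weight v} (λ _ _ → refl) (λ b v → *-distribˡ-+ e ⟦ b ⟧ (weight v)))
                            (⊛-cong (gf-bools e) (gf-vecs e n))

-- Nested pairs follow the recursion y ↦ p y: the head concerns the residues prime to p, and the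
-- tail, with shifted lengths, the multiples of p divided by p.
Blocks : (ℕ → ℕ) → ℕ → Set
Blocks s zero    = ⊤
Blocks s (suc M) = Vec Bool (s 0) × Blocks (s ∘ suc) M

blocks : ∀ s M → List (Blocks s M)
blocks s zero    = tt ∷ []
blocks s (suc M) = cartesianProductWith _,_ (vecs (s 0)) (blocks (s ∘ suc) M)

≟Blocks : ∀ s M → DecidableEquality (Blocks s M)
≟Blocks s zero    tt      tt        = yes refl
≟Blocks s (suc M) = Prodₚ.≡-dec _≟V_ (≟Blocks (s ∘ suc) M)

,-inj : {A B : Set} {x x′ : A} {y y′ : B} → (x , y) ≡ (x′ , y′) → x ≡ x′ × y ≡ y′
,-inj refl = refl , refl

Enum-blocks : ∀ s M → Enum (≟Blocks s M) (blocks s M)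
Enum-blocks s zero    = mk-enum λ { tt → refl }
Enum-blocks s (suc M) = mk-enum λ { (v , b) →
  Enum-prod (Enum-vecs (s 0)) (Enum-blocks (s ∘ suc) M) (≟Blocks s (suc M)) _,_ ,-inj v b }

-- A bit of the k-th block decides a whole class of exponents modulo `s k`, that is, `e k` residues
-- at once; hence the factor.
weights : ∀ (e s : ℕ → ℕ) M → Blocks s M → ℕ
weights e s zero    tt      = 0
weights e s (suc M) (v , b) = e 0 * weight v + weights (e ∘ suc) (s ∘ suc) M b

empty : ∀ s M → Blocks s M
empty s zero    = tt
empty s (suc M) = replicate (s 0) false , empty (s ∘ suc) M

weights-empty : ∀ e s M → weights e s M (empty s M) ≡ 0
weights-empty e s zero    = refl
weights-empty e s (suc M) = cong₂ _+_ (trans (cong (e 0 *_) (weight-0 (s 0))) (*-zeroʳ (e 0))) (weights-empty (e ∘ suc) (s ∘ suc) M)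

gf-blocks : ∀ e s M → gf (blocks s M) (λ _ → 1) (weights e s M) ≋ pprod (map (λ j → ppow (pconst 1 ⊕ xpow (e j)) (s j)) (upTo M))
gf-blocks e s zero    k = trans (+-identityʳ _) (trans (+-identityʳ _) (sym (pconst-ind k)))
gf-blocks e s (suc M) = ≋-trans
  (gf-* (vecs (s 0)) (blocks (s ∘ suc) M) _,_ {ι = λ _ → 1} {λ v → e 0 * weight v} {λ _ → 1} {weights (e ∘ suc) (s ∘ suc) M} {λ _ → 1} {weights e s (suc M)} (λ _ _ → refl) (λ _ _ → refl))
  (≋-trans (⊛-cong (gf-vecs (e 0) (s 0)) (gf-blocks (e ∘ suc) (s ∘ suc) M)) λ k → cong (λ l → (ppow (pconst 1 ⊕ xpow (e 0)) (s 0) ⊛ pprod l) k)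
    (trans (map-upTo _ M) (sym (map-applyUpTo suc (λ j → ppow (pconst 1 ⊕ xpow (e j)) (s j)) M))))

length-vecs : ∀ n → ∑ (vecs n) (λ _ → 1) ≡ 2 ^ n
length-vecs zero    = refl
length-vecs (suc n) = trans (∑-prod _∷_ bools (vecs n) _) (cong₂ _+_ (length-vecs n) (cong (_+ 0) (length-vecs n)))

length-blocks : ∀ s M → ∑ (blocks s M) (λ _ → 1) ≡ product (map (λ j → 2 ^ s j) (upTo M))
length-blocks s zero    = refl
length-blocks s (suc M) = trans (∑-prod _,_ (vecs (s 0)) (blocks (s ∘ suc) M) _)
  (trans (∑-cong (vecs (s 0)) λ _ → trans (length-blocks (s ∘ suc) M) (sym (*-identityˡ _)))
  (trans (∑-*ʳ (vecs (s 0)) _ (λ _ → 1)) (cong₂ _*_ (length-vecs (s 0))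
    (cong product (trans (map-upTo _ M) (sym (map-applyUpTo suc (λ j → 2 ^ s j) M)))))))

length-nonzero : {A : Set} {_≟A_ : DecidableEquality A} {xs : List A} → Enum _≟A_ xs → (z : A) →
                 ∑ xs (λ x → ind (¬? (x ≟A z))) ≡ ∑ xs (λ _ → 1) ∸ 1
length-nonzero {_≟A_ = _≟A_} {xs} en z = sym (cong (_∸ 1) (trans (∑-cong xs one) (trans (∑-+ xs _ _) (cong (_+ ∑ xs (λ x → ind (¬? (x ≟A z)))) (once en z)))))
  where
  one : ∀ x → 1 ≡ ind (x ≟A z) + ind (¬? (x ≟A z))
  one x with x ≟A z
  ... | yes _ = refl
  ... | no _  = refl

-- A pair of block families and a bit describe a symmetric connection set of ℤ_{2pᵐ}: its odd elements
-- other than pᵐ, its even elements, and whether it contains pᵐ. The 0-th blocks describe the elements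
-- prime to p.
module Tuples (s e : ℕ → ℕ) (M : ℕ) where

  d = s 0
  S = s ∘ suc

  Tuple : Set
  Tuple = (Blocks s (suc M) × Blocks s (suc M)) × Bool

  tuples : List Tuple
  tuples = cartesianProductWith _,_ (cartesianProductWith _,_ (blocks s (suc M)) (blocks s (suc M))) bools

  _≟XY_ : DecidableEquality (Blocks s (suc M) × Blocks s (suc M))
  _≟XY_ = Prodₚ.≡-dec (≟Blocks s (suc M)) (≟Blocks s (suc M))

  Enum-pairs : Enum _≟XY_ (cartesianProductWith _,_ (blocks s (suc M)) (blocks s (suc M)))
  Enum-pairs = mk-enum λ { (X , Y) → Enum-prod (Enum-blocks s (suc M)) (Enum-blocks s (suc M)) _≟XY_ _,_ ,-inj X Y }

  _≟T_ : DecidableEquality Tuple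
  _≟T_ = Prodₚ.≡-dec _≟XY_ Bool._≟_

  Enum-tuples : Enum _≟T_ tuples
  Enum-tuples = mk-enum λ { (XY , z) → Enum-prod Enum-pairs Enum-bools _≟T_ _,_ ,-inj XY z }

  -- The first condition asks for an odd element, the second for one prime to p. The element pᵐ,
  -- represented by z, is odd but not prime to p, so it occurs only in the first.
  Generating : Tuple → Set
  Generating ((X@(A , _) , (B , _)) , z) = (X ≢ empty s (suc M) ⊎ z ≡ true) × (A ≢ replicate d false ⊎ B ≢ replicate d false)

  Generating? : ∀ t → Dec (Generating t)
  Generating? ((X@(A , _) , (B , _)) , z) =
    (¬? (≟Blocks s (suc M) X (empty s (suc M))) ⊎-dec (z Bool.≟ true)) ×-dec (¬? (A ≟V replicate d false) ⊎-dec ¬? (B ≟V replicate d false))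

  VA = vecs d
  PC = blocks S M
  0V = replicate d false
  CZ = cartesianProductWith _,_ PC bools

  _≟CZ_ : DecidableEquality (Blocks S M × Bool)
  _≟CZ_ = Prodₚ.≡-dec (≟Blocks S M) Bool._≟_

  0CZ : Blocks S M × Bool
  0CZ = empty S M , false

  Enum-CZ : Enum _≟CZ_ CZ
  Enum-CZ = mk-enum λ { (c , z) → Enum-prod (Enum-blocks S M) Enum-bools _≟CZ_ _,_ ,-inj c z }

  -- A nonzero `A` satisfies both conditions at once. If `A` is zero, the element prime to p must
  -- come from `B` and the odd one from `C` or z.
  ind-Generating : ∀ A B C E z → ind (Generating? (((A , C) , (B , E)) , z)) ≡
    ind (¬? (A ≟V 0V)) + ind (A ≟V 0V) * (ind (¬? (B ≟V 0V)) * ind (¬? ((C , z) ≟CZ 0CZ)))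
  ind-Generating A B C E z = go (A ≟V 0V)
    where
    gen : ∀ z → (C , z) ≢ 0CZ → ((A , C) ≢ empty s (suc M)) ⊎ z ≡ true
    gen true  _   = inj₂ refl
    gen false cz≢ = inj₁ λ eq → cz≢ (cong (_, false) (cong proj₂ eq))
    go : (dA : Dec (A ≡ 0V)) → ind (Generating? (((A , C) , (B , E)) , z)) ≡
         ind (¬? dA) + ind dA * (ind (¬? (B ≟V 0V)) * ind (¬? ((C , z) ≟CZ 0CZ)))
    go (no A≢)  = ind-yes (Generating? (((A , C) , (B , E)) , z)) (inj₁ (A≢ ∘ cong proj₁) , inj₁ A≢)
    go (yes A≡) = trans (ind-cong (Generating? (((A , C) , (B , E)) , z)) (¬? (B ≟V 0V) ×-dec ¬? ((C , z) ≟CZ 0CZ))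
        (λ { (p , q) → [ contradiction A≡ , id ]′ q ,
             λ cz≡ → [ (λ ¬r → ¬r (cong₂ _,_ A≡ (cong proj₁ cz≡))) , (λ z≡ → case trans (sym z≡) (cong proj₂ cz≡) of λ ()) ]′ p })
        (λ { (B≢ , cz≢) → gen z cz≢ , inj₂ B≢ }))
      (trans (ind-× (¬? (B ≟V 0V)) (¬? ((C , z) ≟CZ 0CZ))) (sym (*-identityˡ _)))

  -- Either the odd units are represented, or only the even ones are and some odd non-unit must be present.
  ∑-Generating : (h : Tuple → ℕ) → ∑ tuples (λ t → ind (Generating? t) * h t) ≡
    ∑ VA (λ A → ∑ VA (λ B → ∑ PC (λ C → ∑ PC (λ E → ∑ bools (λ z → ind (¬? (A ≟V 0V)) * h (((A , C) , (B , E)) , z))))))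
    + ∑ VA (λ B → ∑ CZ (λ cz → ∑ PC (λ E → (ind (¬? (B ≟V 0V)) * ind (¬? (cz ≟CZ 0CZ))) * h (((0V , proj₁ cz) , (B , E)) , proj₂ cz))))
  ∑-Generating h = begin
    ∑ tuples (λ t → ind (Generating? t) * h t)
      ≡⟨ trans (∑-prod _,_ (cartesianProductWith _,_ (blocks s (suc M)) (blocks s (suc M))) bools _) (∑-prod _,_ (blocks s (suc M)) (blocks s (suc M)) _) ⟩
    ∑ (blocks s (suc M)) (λ X → ∑ (blocks s (suc M)) (λ Y → ∑ bools (λ z → F X Y z)))
      ≡⟨ trans (∑-prod _,_ VA PC _) (∑-cong VA λ A → ∑-cong PC λ C → ∑-prod _,_ VA PC _) ⟩
    ∑ VA (λ A → ∑ PC (λ C → ∑ VA (λ B → ∑ PC (λ E → ∑ bools (λ z → F (A , C) (B , E) z)))))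
      ≡⟨ ∑-cong VA (λ A → ∑-swap PC VA _) ⟩
    ∑ VA (λ A → ∑ VA (λ B → ∑ PC (λ C → ∑ PC (λ E → ∑ bools (λ z → F (A , C) (B , E) z)))))
      ≡⟨ ∑-cong VA (λ A → trans (∑-cong VA λ B → trans (∑-cong PC λ C → trans (∑-cong PC λ E → trans (∑-cong bools λ z → split A B C E z)
           (∑-+ bools (λ z → ind (¬? (A ≟V 0V)) * H A B C E z) (λ z → ind (A ≟V 0V) * (G B C z * H A B C E z)))) (∑-+ PC _ _)) (∑-+ PC _ _)) (∑-+ VA _ _)) ⟩
    ∑ VA (λ A → ∑ VA (λ B → ∑ PC (λ C → ∑ PC (λ E → ∑ bools (λ z → ind (¬? (A ≟V 0V)) * H A B C E z))))
              + ∑ VA (λ B → ∑ PC (λ C → ∑ PC (λ E → ∑ bools (λ z → ind (A ≟V 0V) * (G B C z * H A B C E z))))))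
      ≡⟨ ∑-+ VA _ _ ⟩
    _ ≡⟨ cong (∑ VA (λ A → ∑ VA (λ B → ∑ PC (λ C → ∑ PC (λ E → ∑ bools (λ z → ind (¬? (A ≟V 0V)) * H A B C E z))))) +_)
           (trans (∑-cong VA λ A → pull A) (trans (∑-collapse (Enum-vecs d) 0V K) (∑-cong VA λ B →
             trans (∑-cong PC λ C → ∑-swap PC bools (λ E z → G B C z * H 0V B C E z)) (sym (∑-prod _,_ PC bools _))))) ⟩
    _ ∎
    where
    open ≡-Reasoning
    F : Blocks s (suc M) → Blocks s (suc M) → Bool → ℕ
    F X Y z = ind (Generating? ((X , Y) , z)) * h ((X , Y) , z)
    H : Vec Bool d → Vec Bool d → Blocks S M → Blocks S M → Bool → ℕ
    H A B C E z = h (((A , C) , (B , E)) , z)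
    G : Vec Bool d → Blocks S M → Bool → ℕ
    G B C z = ind (¬? (B ≟V 0V)) * ind (¬? ((C , z) ≟CZ 0CZ))
    K : Vec Bool d → ℕ
    K A = ∑ VA (λ B → ∑ PC (λ C → ∑ PC (λ E → ∑ bools (λ z → G B C z * H A B C E z))))
    split : ∀ A B C E z → F (A , C) (B , E) z ≡ ind (¬? (A ≟V 0V)) * H A B C E z + ind (A ≟V 0V) * (G B C z * H A B C E z)
    split A B C E z = trans (cong (_* H A B C E z) (ind-Generating A B C E z))
      (trans (*-distribʳ-+ _ (ind (¬? (A ≟V 0V))) _) (cong (ind (¬? (A ≟V 0V)) * H A B C E z +_) (*-assoc (ind (A ≟V 0V)) _ _)))
    pull : ∀ A → ∑ VA (λ B → ∑ PC (λ C → ∑ PC (λ E → ∑ bools (λ z → ind (A ≟V 0V) * (G B C z * H A B C E z))))) ≡ ind (A ≟V 0V) * K A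
    pull A = trans (∑-cong VA λ B → trans (∑-cong PC λ C → trans (∑-cong PC λ E → ∑-*ˡ bools (ind (A ≟V 0V)) (λ z → G B C z * H A B C E z))
      (∑-*ˡ PC (ind (A ≟V 0V)) (λ E → ∑ bools (λ z → G B C z * H A B C E z)))) (∑-*ˡ PC (ind (A ≟V 0V)) (λ C → ∑ PC (λ E → ∑ bools (λ z → G B C z * H A B C E z)))))
      (∑-*ˡ VA (ind (A ≟V 0V)) (λ B → ∑ PC (λ C → ∑ PC (λ E → ∑ bools (λ z → G B C z * H A B C E z)))))

  weightT : Tuple → ℕ
  weightT ((X , Y) , z) = weights e s (suc M) X + weights e s (suc M) Y + ⟦ z ⟧

  Q : Poly
  Q = ppow (pconst 1 ⊕ xpow (e 0)) d

  R : Poly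
  R = pprod (map (λ j → ppow (pconst 1 ⊕ xpow (e (suc j))) (s (suc j))) (upTo M))

  wV : Vec Bool d → ℕ
  wV v = e 0 * weight v

  wP : Blocks S M → ℕ
  wP = weights (e ∘ suc) S M

  -- The factor 1 makes the bit an instance of `gf-bools 1`, whose polynomial is `onePlusX`.
  wz : Bool → ℕ
  wz z = 1 * ⟦ z ⟧

  wCZ : Blocks S M × Bool → ℕ
  wCZ (c , z) = wP c + wz z

  one : {A : Set} → A → ℕ
  one _ = 1

  nzV : Vec Bool d → ℕ
  nzV v = ind (¬? (v ≟V 0V))

  nzCZ : Blocks S M × Bool → ℕ
  nzCZ cz = ind (¬? (cz ≟CZ 0CZ))

  wV-0 : wV 0V ≡ 0
  wV-0 = trans (cong (e 0 *_) (weight-0 d)) (*-zeroʳ (e 0))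

  gf-nzV : gf VA nzV wV ≋ minus1 Q
  gf-nzV = ≋-trans (gf-minus1 (Enum-vecs d) 0V wV wV-0) (minus1-cong (gf-vecs (e 0) d))

  gf-PC : gf PC one wP ≋ R
  gf-PC = gf-blocks (e ∘ suc) S M

  gf-nzCZ : gf CZ nzCZ wCZ ≋ minus1 (R ⊛ onePlusX)
  gf-nzCZ = ≋-trans (gf-minus1 Enum-CZ 0CZ wCZ (trans (+-identityʳ _) (weights-empty (e ∘ suc) S M)))
    (minus1-cong (≋-trans (gf-* PC bools _,_ {ι = one} {wP} {one} {wz} {one} {wCZ} (λ _ _ → refl) (λ _ _ → refl)) (⊛-cong gf-PC (gf-bools 1))))

  gf-Generating : gf tuples (λ t → ind (Generating? t)) weightT ≋
    (minus1 Q ⊛ Q ⊛ R ⊛ R ⊛ onePlusX) ⊕ (minus1 Q ⊛ minus1 (R ⊛ onePlusX) ⊛ R)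
  gf-Generating k = trans (∑-Generating (λ t → ind (weightT t ≟ k))) (cong₂ _+_ units non-units)
    where
    -- The products are nested to the left in the order A, B, C, E, z, so that `gf-*` peels off the
    -- factors of the left-associated product one by one.
    L₂ = cartesianProductWith _,_ VA VA
    L₃ = cartesianProductWith _,_ L₂ PC
    L₄ = cartesianProductWith _,_ L₃ PC
    w₂ : Vec Bool d × Vec Bool d → ℕ
    w₂ (a , b) = wV a + wV b
    w₃ : (Vec Bool d × Vec Bool d) × Blocks S M → ℕ
    w₃ (x , c) = w₂ x + wP c
    w₄ : ((Vec Bool d × Vec Bool d) × Blocks S M) × Blocks S M → ℕ
    w₄ (x , c) = w₃ x + wP c
    w₅ : (((Vec Bool d × Vec Bool d) × Blocks S M) × Blocks S M) × Bool → ℕ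
    w₅ (x , z) = w₄ x + wz z
    u-reorder : ∀ a c b e z → a + c + (b + e) + z ≡ a + b + c + e + 1 * z
    u-reorder = solve-∀
    units : ∑ VA (λ A → ∑ VA (λ B → ∑ PC (λ C → ∑ PC (λ E → ∑ bools (λ z → nzV A * ind (weightT (((A , C) , (B , E)) , z) ≟ k))))))
            ≡ (minus1 Q ⊛ Q ⊛ R ⊛ R ⊛ onePlusX) k
    units = trans (sym (trans (∑-prod _,_ L₄ bools _) (trans (∑-prod _,_ L₃ PC _) (trans (∑-prod _,_ L₂ PC _) (trans (∑-prod _,_ VA VA _)
        (∑-cong VA λ A → ∑-cong VA λ B → ∑-cong PC λ C → ∑-cong PC λ E → ∑-cong bools λ z →
          cong (λ w → nzV A * ind (w ≟ k)) (sym (u-reorder (wV A) (wP C) (wV B) (wP E) ⟦ z ⟧))))))))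
      (≋-trans (gf-* L₄ bools _,_ {ι = λ x → nzV (proj₁ (proj₁ (proj₁ x)))} {w₄} {one} {wz} {λ x → nzV (proj₁ (proj₁ (proj₁ (proj₁ x))))} {w₅} (λ _ _ → sym (*-identityʳ _)) (λ _ _ → refl))
        (⊛-cong (≋-trans (gf-* L₃ PC _,_ {ι = λ x → nzV (proj₁ (proj₁ x))} {w₃} {one} {wP} {λ x → nzV (proj₁ (proj₁ (proj₁ x)))} {w₄} (λ _ _ → sym (*-identityʳ _)) (λ _ _ → refl))
          (⊛-cong (≋-trans (gf-* L₂ PC _,_ {ι = λ x → nzV (proj₁ x)} {w₂} {one} {wP} {λ x → nzV (proj₁ (proj₁ x))} {w₃} (λ _ _ → sym (*-identityʳ _)) (λ _ _ → refl))
            (⊛-cong (≋-trans (gf-* VA VA _,_ {ι = nzV} {wV} {one} {wV} {λ x → nzV (proj₁ x)} {w₂} (λ _ _ → sym (*-identityʳ _)) (λ _ _ → refl)) (⊛-cong gf-nzV (gf-vecs (e 0) d))) gf-PC)) gf-PC)) (gf-bools 1)) k)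
    v₂ : Vec Bool d × (Blocks S M × Bool) → ℕ
    v₂ (b , cz) = wV b + wCZ cz
    v₃ : (Vec Bool d × (Blocks S M × Bool)) × Blocks S M → ℕ
    v₃ (x , c) = v₂ x + wP c
    N₂ = cartesianProductWith _,_ VA CZ
    n-reorder : ∀ c b e z → c + (b + e) + z ≡ b + (c + 1 * z) + e
    n-reorder = solve-∀
    non-units : ∑ VA (λ B → ∑ CZ (λ cz → ∑ PC (λ E → (nzV B * nzCZ cz) * ind (weightT (((0V , proj₁ cz) , (B , E)) , proj₂ cz) ≟ k))))
                ≡ (minus1 Q ⊛ minus1 (R ⊛ onePlusX) ⊛ R) k
    non-units = trans (sym (trans (∑-prod _,_ N₂ PC _) (trans (∑-prod _,_ VA CZ _)
        (∑-cong VA λ B → ∑-cong CZ λ cz → ∑-cong PC λ E → cong (λ w → (nzV B * nzCZ cz) * ind (w ≟ k))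
          (sym (trans (cong (λ w → w + wP (proj₁ cz) + (wV B + wP E) + ⟦ proj₂ cz ⟧) wV-0) (n-reorder (wP (proj₁ cz)) (wV B) (wP E) ⟦ proj₂ cz ⟧)))))))
      (≋-trans (gf-* N₂ PC _,_ {ι = λ x → nzV (proj₁ x) * nzCZ (proj₂ x)} {v₂} {one} {wP} {λ x → nzV (proj₁ (proj₁ x)) * nzCZ (proj₂ (proj₁ x))} {v₃} (λ _ _ → sym (*-identityʳ _)) (λ _ _ → refl))
        (⊛-cong (≋-trans (gf-* VA CZ _,_ {ι = nzV} {wV} {nzCZ} {wCZ} {λ x → nzV (proj₁ x) * nzCZ (proj₂ x)} {v₂} (λ _ _ → refl) (λ _ _ → refl)) (⊛-cong gf-nzV gf-nzCZ)) gf-PC) k)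

  Π : ℕ
  Π = product (map (λ j → 2 ^ s (suc j)) (upTo M))

  ∑-factor : {A B : Set} (xs : List A) (ys : List B) (f : A → ℕ) (g : B → ℕ) → ∑ xs (λ x → ∑ ys (λ y → f x * g y)) ≡ ∑ xs f * ∑ ys g
  ∑-factor xs ys f g = trans (∑-cong xs λ x → ∑-*ˡ ys (f x) g) (∑-*ʳ xs (∑ ys g) f)

  -- Obtained from the same splitting with constant summand 1 instead of evaluating the polynomial
  -- at 1.
  count-Generating : ∑ tuples (λ t → ind (Generating? t)) ≡ (2 ^ d ∸ 1) * 2 ^ d * Π * Π * 2 + (2 ^ d ∸ 1) * (Π * 2 ∸ 1) * Π
  count-Generating = trans (∑-cong tuples λ t → sym (*-identityʳ _)) (trans (∑-Generating (λ _ → 1)) (cong₂ _+_ units non-units))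
    where
    nV : ∑ VA nzV ≡ 2 ^ d ∸ 1
    nV = trans (length-nonzero (Enum-vecs d) 0V) (cong (_∸ 1) (length-vecs d))
    nC : ∑ PC one ≡ Π
    nC = length-blocks S M
    nCZ : ∑ CZ nzCZ ≡ Π * 2 ∸ 1
    nCZ = trans (length-nonzero Enum-CZ 0CZ) (cong (_∸ 1) (trans (∑-prod _,_ PC bools _) (trans (∑-factor PC bools one one) (cong (_* 2) nC))))
    units : ∑ VA (λ A → ∑ VA (λ B → ∑ PC (λ C → ∑ PC (λ E → ∑ bools (λ z → nzV A * 1))))) ≡ (2 ^ d ∸ 1) * 2 ^ d * Π * Π * 2
    units = trans (∑-cong VA λ A → trans (∑-cong VA λ B → trans (∑-cong PC λ C → trans (∑-cong PC λ E → ∑-*ˡ bools (nzV A) one)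
        (trans (∑-*ʳ PC 2 (λ _ → nzV A)) (cong (_* 2) (trans (∑-cong PC λ _ → sym (*-identityʳ _)) (∑-*ˡ PC (nzV A) one)))))
        (trans (∑-cong PC λ _ → sym (*-identityʳ _)) (∑-*ˡ PC (nzV A * ∑ PC one * 2) one)))
        (trans (∑-cong VA λ _ → sym (*-identityʳ _)) (∑-*ˡ VA (nzV A * ∑ PC one * 2 * ∑ PC one) one)))
      (trans (∑-cong VA λ A → reorder (nzV A) (∑ PC one) (∑ VA one)) (trans (∑-*ʳ VA (∑ VA one * ∑ PC one * ∑ PC one * 2) nzV)
        (trans (cong₂ (λ a b → a * (b * ∑ PC one * ∑ PC one * 2)) nV (length-vecs d)) (trans (cong (λ c → (2 ^ d ∸ 1) * (2 ^ d * c * c * 2)) nC) (assoc (2 ^ d ∸ 1) (2 ^ d) Π)))))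
      where
      reorder : ∀ a c v → a * c * 2 * c * v ≡ a * (v * c * c * 2)
      reorder = solve-∀
      assoc : ∀ a b c → a * (b * c * c * 2) ≡ a * b * c * c * 2
      assoc = solve-∀
    non-units : ∑ VA (λ B → ∑ CZ (λ cz → ∑ PC (λ E → (nzV B * nzCZ cz) * 1))) ≡ (2 ^ d ∸ 1) * (Π * 2 ∸ 1) * Π
    non-units = trans (∑-cong VA λ B → trans (∑-cong CZ λ cz → ∑-*ˡ PC (nzV B * nzCZ cz) one) (∑-*ʳ CZ (∑ PC one) (λ cz → nzV B * nzCZ cz)))
      (trans (∑-*ʳ VA (∑ PC one) (λ B → ∑ CZ (λ cz → nzV B * nzCZ cz)))
      (trans (cong (_* ∑ PC one) (∑-factor VA CZ nzV nzCZ)) (cong₂ _*_ (cong₂ _*_ nV nCZ) nC)))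

-- Periodic bit sequences

-- Reads a vector as a periodic sequence; the constant false for length 0 keeps the reading total.
lookup% : ∀ {n} → Vec Bool n → ℕ → Bool
lookup% {zero}  v t = false
lookup% {suc n} v t = Vec.lookup v (t mod suc n)

tabulate% : ∀ n → (ℕ → Bool) → Vec Bool n
tabulate% n ψ = Vec.tabulate (ψ ∘ toℕ)

mod-cong : ∀ {a b} n .{{_ : NonZero n}} → a ≈ b [ n ] → a mod n ≡ b mod n
mod-cong {a} {b} n e = toℕ-injective (trans (toℕ-mod a n) (trans (≈⇒% n e) (sym (toℕ-mod b n))))

toℕ-mod-id : ∀ {n} (i : Fin (suc n)) → toℕ i mod suc n ≡ i
toℕ-mod-id {n} i = toℕ-injective (trans (toℕ-mod (toℕ i) (suc n)) (m<n⇒m%n≡m (toℕ<n i)))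

lookup%-≈ : ∀ {n} (v : Vec Bool n) {t t′} → t ≈ t′ [ n ] → lookup% v t ≡ lookup% v t′
lookup%-≈ {zero}  v e = refl
lookup%-≈ {suc n} v e = cong (Vec.lookup v) (mod-cong (suc n) e)

lookup%-tabulate% : ∀ n .{{_ : NonZero n}} (ψ : ℕ → Bool) t → lookup% (tabulate% n ψ) t ≡ ψ (t % n)
lookup%-tabulate% (suc n) ψ t = trans (Vecₚ.lookup∘tabulate (ψ ∘ toℕ) (t mod suc n)) (cong ψ (toℕ-mod t (suc n)))

tabulate%-lookup% : ∀ {n} (v : Vec Bool n) → tabulate% n (lookup% v) ≡ v
tabulate%-lookup% {zero}  [] = refl
tabulate%-lookup% {suc n} v  = trans (Vecₚ.tabulate-cong λ i → cong (Vec.lookup v) (toℕ-mod-id i)) (Vecₚ.tabulate∘lookup v)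

tabulate%-cong : ∀ n {ψ χ : ℕ → Bool} → (∀ t → ψ t ≡ χ t) → tabulate% n ψ ≡ tabulate% n χ
tabulate%-cong n eq = Vecₚ.tabulate-cong (eq ∘ toℕ)

lookup%-false : ∀ n t → lookup% (replicate n false) t ≡ false
lookup%-false zero    t = refl
lookup%-false (suc n) t = Vecₚ.lookup-replicate (t mod suc n) false

∑-lookup : ∀ {n} (v : Vec Bool n) (h : ℕ → ℕ) → (∀ i → h (toℕ i) ≡ ⟦ Vec.lookup v i ⟧) → ∑< n h ≡ weight v
∑-lookup []            h eq = refl
∑-lookup {suc n} (b ∷ v) h eq = trans (∑<-suc n h) (cong₂ _+_ (eq Fin.zero) (∑-lookup v (h ∘ suc) (eq ∘ Fin.suc)))

∑-lookup% : ∀ {n} (v : Vec Bool n) k → ∑< (k * n) (λ t → ⟦ lookup% v t ⟧) ≡ k * weight v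
∑-lookup% {zero}  [] k = trans (cong (λ m → ∑< m (λ _ → 0)) (*-zeroʳ k)) (sym (*-zeroʳ k))
∑-lookup% {suc n} v  k = trans (∑<-blocks k (suc n) _) (trans (∑-cong (upTo k) λ i →
    trans (∑-cong (upTo (suc n)) λ j → cong ⟦_⟧ (lookup%-≈ v {i * suc n + j} {j} (≈-trans (≈-reflexive (+-comm (i * suc n) j)) (∣⇒+-≈ j (n∣m*n i)))))
      (∑-lookup v _ λ i → cong (λ j → ⟦ Vec.lookup v j ⟧) (toℕ-mod-id i)))
  (∑<-const k (weight v)))

nonzero-bit : ∀ {n} (v : Vec Bool n) → v ≢ replicate n false → ∃[ i ] (Vec.lookup v i ≡ true)
nonzero-bit []          v≢ = contradiction refl v≢
nonzero-bit (true ∷ v)  v≢ = Fin.zero , refl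
nonzero-bit (false ∷ v) v≢ with nonzero-bit v (v≢ ∘ cong (false ∷_))
... | i , eq = Fin.suc i , eq

nonzero-bit% : ∀ {n} (v : Vec Bool n) → v ≢ replicate n false → ∃[ t ] (lookup% v t ≡ true)
nonzero-bit% {zero}  [] v≢ = contradiction refl v≢
nonzero-bit% {suc n} v  v≢ with nonzero-bit v v≢
... | i , eq = toℕ i , trans (cong (Vec.lookup v) (toℕ-mod-id i)) eq

Period : (ℕ → Bool) → ℕ → Set
Period ψ a = ∀ t → ψ (t + a) ≡ ψ t

Period-* : ∀ {ψ a} k → Period ψ a → Period ψ (k * a)
Period-* {ψ} zero    per t = cong ψ (+-identityʳ t)
Period-* {ψ} {a} (suc k) per t = trans (cong ψ (reassoc t a (k * a))) (trans (per (t + k * a)) (Period-* k per t))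
  where
  reassoc : ∀ t a b → t + (a + b) ≡ t + b + a
  reassoc = solve-∀

-- The exponent sequence of a function invariant under g^d has both d and the order of g as periods;
-- their gcd becomes the block length. Bézout is used in its additive form, as in `iter-gcd`.
Period-gcd : ∀ {ψ} a b → Period ψ a → Period ψ b → Period ψ (gcd a b)
Period-gcd {ψ} a b pa pb = go (Bézout.identity (gcd-GCD a b))
  where
  go : Bézout.Identity (gcd a b) a b → Period ψ (gcd a b)
  go (Bézout.+- x y eq) t = trans (sym (Period-* y pb (t + gcd a b))) (trans (cong ψ (trans (+-assoc t (gcd a b) (y * b)) (cong (t +_) eq))) (Period-* x pa t))
  go (Bézout.-+ x y eq) t = trans (sym (Period-* x pa (t + gcd a b))) (trans (cong ψ (trans (+-assoc t (gcd a b) (x * a)) (cong (t +_) eq))) (Period-* y pb t))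

Period-% : ∀ {ψ a} .{{_ : NonZero a}} → Period ψ a → ∀ t → ψ (t % a) ≡ ψ t
Period-% {ψ} {a} per t = trans (sym (Period-* (t / a) per (t % a))) (cong ψ (sym (m≡m%n+[m/n]*n t a)))

gcd≡⇒∣ˡ : ∀ a b {c} → gcd a b ≡ c → c ∣ a
gcd≡⇒∣ˡ a b eq = subst (_∣ a) eq (gcd[m,n]∣m a b)

gcd≡⇒∣ʳ : ∀ a b {c} → gcd a b ≡ c → c ∣ b
gcd≡⇒∣ʳ a b eq = subst (_∣ b) eq (gcd[m,n]∣n a b)

-- Bit-valued functions modulo p^M. A residue y prime to p is located in the 0-th block at its discrete
-- logarithm, and p * y is located where y is in the remaining blocks.

module BlockFunctions (p : ℕ) (pr : Prime p) (p-odd : p % 2 ≡ 1) where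

  open OddPrime p pr p-odd public

  ∑-units : ∀ M (f : ℕ → ℕ) → (∀ {x y} → x ≈ y [ p ^ suc M ] → f x ≡ f y) →
            ∑< (p ^ suc M) (λ i → ind (¬? (p ∣? i)) * f i) ≡ ∑< (order M) (λ t → f (g ^ t))
  ∑-units M f resp = begin
    ∑< q (λ i → ind (¬? (p ∣? i)) * f i)                            ≡⟨ ∑<-cong q (λ i i<q → cong (_* f i) (sym (log-count M i i<q))) ⟩
    ∑< q (λ i → ∑< (order M) (λ t → ind (i ≟ residue M (g ^ t))) * f i)      ≡⟨ ∑-cong (upTo q) (λ i → sym (∑-*ʳ (upTo (order M)) (f i) _)) ⟩
    ∑< q (λ i → ∑< (order M) (λ t → ind (i ≟ residue M (g ^ t)) * f i))      ≡⟨ ∑-swap (upTo q) (upTo (order M)) _ ⟩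
    ∑< (order M) (λ t → ∑< q (λ i → ind (i ≟ residue M (g ^ t)) * f i))      ≡⟨ ∑-cong (upTo (order M)) (λ t →
      trans (∑<-single q (residue M (g ^ t)) (residue< M (g ^ t)) (λ i _ i≢ → cong (_* f i) (ind-no (i ≟ residue M (g ^ t)) i≢)))
        (trans (cong (_* f (residue M (g ^ t))) (ind-yes (residue M (g ^ t) ≟ residue M (g ^ t)) refl)) (trans (+-identityʳ _) (resp (residue-≈ M (g ^ t)))))) ⟩
    ∑< (order M) (λ t → f (g ^ t)) ∎
    where
    open ≡-Reasoning
    q = p ^ suc M

  ∑-multiples : ∀ N (f : ℕ → ℕ) → ∑< (N * p) (λ i → ind (p ∣? i) * f i) ≡ ∑< N (λ i → f (p * i))
  ∑-multiples N f = trans (∑<-blocks N p _) (∑-cong (upTo N) λ a →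
    trans (∑<-single p 0 (<-trans (s≤s z≤n) 1<p) λ b b<p b≢0 → cong (_* f (a * p + b)) (ind-no (p ∣? (a * p + b)) λ p∣ → small∤ (n≢0⇒n>0 b≢0) b<p (∣m+n∣m⇒∣n p∣ (n∣m*n a))))
      (trans (cong (_* f (a * p + 0)) (ind-yes (p ∣? (a * p + 0)) (subst (p ∣_) (sym (+-identityʳ _)) (n∣m*n a))))
        (trans (+-identityʳ _) (cong f (trans (+-identityʳ _) (*-comm a p))))))

  ∑-residues : ∀ M (f : ℕ → ℕ) → (∀ {x y} → x ≈ y [ p ^ suc M ] → f x ≡ f y) →
               ∑< (p ^ suc M) f ≡ ∑< (order M) (λ t → f (g ^ t)) + ∑< (p ^ M) (λ i → f (p * i))
  ∑-residues M f resp = trans (∑-cong (upTo (p ^ suc M)) split) (trans (∑-+ (upTo (p ^ suc M)) _ _)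
    (cong₂ _+_ (∑-units M f resp) (trans (cong (λ n → ∑< n (λ i → ind (p ∣? i) * f i)) (*-comm p (p ^ M))) (∑-multiples (p ^ M) f))))
    where
    split : ∀ i → f i ≡ ind (¬? (p ∣? i)) * f i + ind (p ∣? i) * f i
    split i with p ∣? i
    ... | yes _ = sym (+-identityʳ (f i))
    ... | no _  = trans (sym (+-identityʳ (f i))) (sym (+-identityʳ (f i + 0)))

  abstract
    log : ℕ → ℕ → ℕ
    log M y with p ∣? y
    ... | yes _  = 0
    ... | no p∤y = proj₁ (discrete-log M p∤y)

    log-spec : ∀ M {y} → p ∤ y → y ≈ g ^ log M y [ p ^ suc M ]
    log-spec M {y} p∤y with p ∣? y
    ... | yes p∣y = contradiction p∣y p∤y
    ... | no p∤y′ = proj₂ (discrete-log M p∤y′)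

  p∤g^ : ∀ t → p ∤ g ^ t
  p∤g^ = ∤-^ pr p∤g

  log-unique : ∀ M {y t} → p ∤ y → y ≈ g ^ t [ p ^ suc M ] → log M y ≈ t [ order M ]
  log-unique M p∤y e = Order-inj (g-order M) (g-Inv (suc M)) (≈-trans (≈-sym (log-spec M p∤y)) e)

  blockAt : ∀ s M → Blocks s M → ℕ → Bool
  blockAt s zero    tt      y = false
  blockAt s (suc M) (v , b) y with p ∣? y
  ... | yes (divides r _) = blockAt (s ∘ suc) M b r
  ... | no _              = lookup% v (log M y)

  blockTab : ∀ s M → (ℕ → Bool) → Blocks s M
  blockTab s zero    f = tt
  blockTab s (suc M) f = tabulate% (s 0) (λ t → f (g ^ t)) , blockTab (s ∘ suc) M (λ y → f (p * y))

  blockAt-unit : ∀ s M v b {y} → p ∤ y → blockAt s (suc M) (v , b) y ≡ lookup% v (log M y)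
  blockAt-unit s M v b {y} p∤y with p ∣? y
  ... | yes p∣y = contradiction p∣y p∤y
  ... | no _    = refl

  blockAt-multiple : ∀ s M v b y → blockAt s (suc M) (v , b) (p * y) ≡ blockAt (s ∘ suc) M b y
  blockAt-multiple s M v b y with p ∣? (p * y)
  ... | yes (divides r eq) = cong (blockAt (s ∘ suc) M b) (*-cancelʳ-≡ r y p (trans (sym eq) (*-comm p y)))
  ... | no p∤py            = contradiction (m∣m*n y) p∤py

  blockAt-0 : ∀ s M b → blockAt s M b 0 ≡ false
  blockAt-0 s zero    b       = refl
  blockAt-0 s (suc M) (v , b) = trans (cong (blockAt s (suc M) (v , b)) (sym (*-zeroʳ p))) (trans (blockAt-multiple s M v b 0) (blockAt-0 (s ∘ suc) M b))

  blockAt-empty : ∀ s M y → blockAt s M (empty s M) y ≡ false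
  blockAt-empty s zero    y = refl
  blockAt-empty s (suc M) y with p ∣? y
  ... | yes (divides r _) = blockAt-empty (s ∘ suc) M r
  ... | no _              = lookup%-false (s 0) (log M y)

  -- The blocks sample f only at p^k g^t with k < M, never at a multiple of p^M. The restriction
  -- matters for the odd elements, where the residue 0 belongs to the separate bit z.
  blockTab-cong : ∀ s M {f f′ : ℕ → Bool} → (∀ y → p ^ M ∤ y → f y ≡ f′ y) → blockTab s M f ≡ blockTab s M f′
  blockTab-cong s zero    eq = refl
  blockTab-cong s (suc M) eq = cong₂ _,_
    (tabulate%-cong (s 0) (λ t → eq (g ^ t) (p∤g^ t ∘ ∣-trans (m∣m*n (p ^ M)))))
    (blockTab-cong (s ∘ suc) M (λ y q∤y → eq (p * y) (q∤y ∘ *-cancelˡ-∣ p)))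

  -- Multiplication by g^d shifts the k-th block by d, so the functions invariant under it are given by
  -- blocks of length gcd(d, length of the k-th block).
  Fits : (ℕ → ℕ) → ℕ → ℕ → Set
  Fits s d zero    = ⊤
  Fits s d (suc M) = gcd d (order M) ≡ s 0 × Fits (s ∘ suc) d M

  blockAt-≈ : ∀ s {d} M b → Fits s d M → ∀ {x y} → x ≈ y [ p ^ M ] → blockAt s M b x ≡ blockAt s M b y
  blockAt-≈ s {d} zero    b       _           e = refl
  blockAt-≈ s {d} (suc M) (v , b) (s≡ , fits) {x} {y} e with p ∣? x
  ... | no p∤x = trans (lookup%-≈ v (≈-∣ (gcd≡⇒∣ʳ d (order M) s≡) (log-unique M p∤x (≈-trans e (log-spec M p∤y))))) (sym (blockAt-unit s M v b p∤y))
    where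
    p∤y : p ∤ y
    p∤y = p∤x ∘ ∣-resp-≈ (m∣m*n (p ^ M)) (≈-sym e)
  ... | yes (divides r refl) with ∣-resp-≈ (m∣m*n (p ^ M)) e (n∣m*n r)
  ...   | divides r′ refl = trans (blockAt-≈ (s ∘ suc) M b fits (≈-unscale p (subst₂ (λ a b → a ≈ b [ p ^ suc M ]) (*-comm r p) (*-comm r′ p) e)))
                              (sym (trans (cong (blockAt s (suc M) (v , b)) (*-comm r′ p)) (blockAt-multiple s M v b r′)))

  blockTab-blockAt : ∀ s {d} M b → Fits s d M → blockTab s M (blockAt s M b) ≡ b
  blockTab-blockAt s {d} zero    tt      _           = refl
  blockTab-blockAt s {d} (suc M) (v , b) (s≡ , fits) = cong₂ _,_
    (trans (tabulate%-cong (s 0) λ t → trans (blockAt-unit s M v b (p∤g^ t)) (lookup%-≈ v (≈-∣ (gcd≡⇒∣ʳ d (order M) s≡) (log-unique M {t = t} (p∤g^ t) ≈-refl))))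
      (tabulate%-lookup% v))
    (trans (blockTab-cong (s ∘ suc) M (λ y _ → blockAt-multiple s M v b y)) (blockTab-blockAt (s ∘ suc) M b fits))

  -- On residues prime to p, f is the sequence t ↦ f(g^t), whose period gcd(d, order) is the length
  -- of the head block. On multiples of p, the function y ↦ f(p y) is again invariant under g^d.
  blockAt-blockTab : ∀ s {d} .{{_ : NonZero d}} M (f : ℕ → Bool) → Fits s d M →
    (∀ {x y} → x ≈ y [ p ^ M ] → f x ≡ f y) → (∀ y → f (g ^ d * y) ≡ f y) →
    ∀ y → p ^ M ∤ y → blockAt s M (blockTab s M f) y ≡ f y
  blockAt-blockTab s zero    f _ resp inv y q∤y = contradiction (1∣ y) q∤y
  blockAt-blockTab s {d} (suc M) f (s≡ , fits) resp inv y q∤y with p ∣? y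
  ... | yes (divides r refl) = trans (blockAt-blockTab (s ∘ suc) M (λ y → f (p * y)) fits (λ e → resp (≈-scale p e))
          (λ y → trans (cong f (reorder p (g ^ d) y)) (inv (p * y))) r (λ q∣r → q∤y (subst (_∣ r * p) (*-comm (p ^ M) p) (*-monoˡ-∣ p q∣r))))
          (cong f (*-comm p r))
    where
    reorder : ∀ p a y → p * (a * y) ≡ a * (p * y)
    reorder = solve-∀
  ... | no p∤y = trans (lookup%-tabulate% (s 0) {{s≢0}} ψ (log M y)) (trans (Period-% {{s≢0}} period (log M y)) (sym (resp (log-spec M p∤y))))
    where
    ψ : ℕ → Bool
    ψ t = f (g ^ t)
    s≢0 : NonZero (s 0)
    s≢0 = ≢-nonZero λ s≡0 → ≢-nonZero⁻¹ d (0∣⇒≡0 (subst (_∣ d) s≡0 (gcd≡⇒∣ˡ d (order M) s≡)))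
    period : Period ψ (s 0)
    period = subst (Period ψ) s≡ (Period-gcd d (order M)
      (λ t → trans (cong f (trans (^-distribˡ-+-* g t d) (*-comm (g ^ t) (g ^ d)))) (inv (g ^ t)))
      (λ t → resp (Order-≈ (g-order M) (∣⇒+-≈ t ∣-refl))))

  blockAt-invariant : ∀ s {d} M b → Fits s d M → ∀ y → blockAt s M b (g ^ d * y) ≡ blockAt s M b y
  blockAt-invariant s {d} zero    b       _           y = refl
  blockAt-invariant s {d} (suc M) (v , b) (s≡ , fits) y with p ∣? y
  ... | yes (divides r refl) = trans (cong (blockAt s (suc M) (v , b)) (reorder (g ^ d) r p))
          (trans (blockAt-multiple s M v b (g ^ d * r)) (blockAt-invariant (s ∘ suc) M b fits r))
    where
    reorder : ∀ a r p → a * (r * p) ≡ p * (a * r)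
    reorder = solve-∀
  ... | no p∤y = trans (blockAt-unit s M v b (∤-* pr (p∤g^ d) p∤y)) (lookup%-≈ v (≈-trans
          (≈-∣ (gcd≡⇒∣ʳ d (order M) s≡) (log-unique M (∤-* pr (p∤g^ d) p∤y) (≈-trans (≈-*ˡ (g ^ d) (log-spec M p∤y)) (≈-reflexive (trans (*-comm (g ^ d) _) (sym (^-distribˡ-+-* g (log M y) d)))))))
          (∣⇒+-≈ (log M y) (gcd≡⇒∣ˡ d (order M) s≡))))

  Lengths : (ℕ → ℕ) → (ℕ → ℕ) → ℕ → Set
  Lengths e s zero    = ⊤
  Lengths e s (suc M) = order M ≡ e 0 * s 0 × Lengths (e ∘ suc) (s ∘ suc) M

  -- The units are listed by their exponents, which run through `e 0` full periods of the head
  -- block; the multiples of p are left to the tail.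
  ∑-blockAt : ∀ e s {d} M b → Fits s d M → Lengths e s M → ∑< (p ^ M) (λ y → ⟦ blockAt s M b y ⟧) ≡ weights e s M b
  ∑-blockAt e s {d} zero    b       _                _         = refl
  ∑-blockAt e s {d} (suc M) (v , b) fs@(s≡ , fits) (l , len) = trans
    (∑-residues M (λ y → ⟦ blockAt s (suc M) (v , b) y ⟧) (λ e → cong ⟦_⟧ (blockAt-≈ s (suc M) (v , b) fs e)))
    (cong₂ _+_
      (trans (∑-cong (upTo (order M)) λ t → cong ⟦_⟧ (trans (blockAt-unit s M v b (p∤g^ t)) (lookup%-≈ v (≈-∣ (gcd≡⇒∣ʳ d (order M) s≡) (log-unique M {t = t} (p∤g^ t) ≈-refl)))))
        (trans (cong (λ n → ∑< n (λ t → ⟦ lookup% v t ⟧)) l) (∑-lookup% v (e 0))))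
      (trans (∑-cong (upTo (p ^ M)) λ y → cong ⟦_⟧ (blockAt-multiple s M v b y)) (∑-blockAt (e ∘ suc) (s ∘ suc) M b fits len)))

  blockAt-head : ∀ s {d} M v b → Fits s d (suc M) → v ≢ replicate (s 0) false → ∃[ y ] (p ∤ y × blockAt s (suc M) (v , b) y ≡ true)
  blockAt-head s {d} M v b (s≡ , _) v≢ with nonzero-bit% v v≢
  ... | t , eq = g ^ t , p∤g^ t , trans (blockAt-unit s M v b (p∤g^ t)) (trans (lookup%-≈ v (≈-∣ (gcd≡⇒∣ʳ d (order M) s≡) (log-unique M {t = t} (p∤g^ t) ≈-refl))) eq)

  blockAt-nonempty : ∀ s {d} M b → Fits s d M → b ≢ empty s M → ∃[ y ] (blockAt s M b y ≡ true)
  blockAt-nonempty s {d} zero    tt      _               b≢ = contradiction refl b≢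
  blockAt-nonempty s {d} (suc M) (v , b) fs@(_ , fits) b≢ with v ≟V replicate (s 0) false
  ... | no v≢ with blockAt-head s M v b fs v≢
  ...   | y , _ , eq = y , eq
  blockAt-nonempty s {d} (suc M) (v , b) fs@(_ , fits) b≢ | yes v≡ with blockAt-nonempty (s ∘ suc) M b fits (λ b≡ → b≢ (cong₂ _,_ v≡ b≡))
  ... | y , eq = p * y , trans (blockAt-multiple s M v b y) eq

  blockAt-head-true : ∀ s M v b {y} → p ∤ y → blockAt s (suc M) (v , b) y ≡ true → v ≢ replicate (s 0) false
  blockAt-head-true s M v b {y} p∤y eq refl = case trans (sym eq) (trans (blockAt-unit s M v b p∤y) (lookup%-false (s 0) (log M y))) of λ ()

-- Connection sets in ℤ_{2pᵐ}, m = M + 1, under multiplication by g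

≈-cancelʳ : ∀ {q a b} c → a + c ≈ b + c [ q ] → a ≈ b [ q ]
≈-cancelʳ {q} {a} {b} c (cg u v eq) = cg u v (+-cancelʳ-≡ c _ _ (trans (r a c (u * q)) (trans eq (sym (r b c (v * q))))))
  where
  r : ∀ a c u → a + u + c ≡ a + c + u
  r = solve-∀

bool-≡ : ∀ {a b} → (a ≡ true → b ≡ true) → (b ≡ true → a ≡ true) → a ≡ b
bool-≡ {false} {false} f g = refl
bool-≡ {false} {true}  f g = g refl
bool-≡ {true}  {b}     f g = sym (f refl)

odd-% : ∀ {a} → 2 ∤ a → a % 2 ≡ 1
odd-% {a} 2∤a = go (a % 2) refl (m%n<n a 2)
  where
  go : ∀ r → a % 2 ≡ r → r < 2 → a % 2 ≡ 1
  go zero          eq _ = contradiction (m%n≡0⇒n∣m a 2 eq) 2∤a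
  go (suc zero)    eq _ = eq
  go (suc (suc r)) eq (s≤s (s≤s ()))

odd-≈ : ∀ {a b} → 2 ∤ a → 2 ∤ b → a ≈ b [ 2 ]
odd-≈ 2∤a 2∤b = %⇒≈ 2 (trans (odd-% 2∤a) (sym (odd-% 2∤b)))

even-≈ : ∀ {a b} → 2 ∣ a → 2 ∣ b → a ≈ b [ 2 ]
even-≈ 2∣a 2∣b = ≈-trans (∣⇒≈0 2∣a) (≈-sym (∣⇒≈0 2∣b))

size-weight : ∀ {n} (Ω : Subset n) → ∣ Ω ∣ ≡ weight Ω
size-weight []          = refl
size-weight (true ∷ Ω)  = cong suc (size-weight Ω)
size-weight (false ∷ Ω) = size-weight Ω

module Sets (p : ℕ) (pr : Prime p) (p-odd : p % 2 ≡ 1) (M n′ : ℕ) (n≡ : suc n′ ≡ 2 * p ^ suc M) where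

  open BlockFunctions p pr p-odd public
  open Cyclic n′ public

  q : ℕ
  q = p ^ suc M

  2∣n : 2 ∣ n
  2∣n = subst (2 ∣_) (sym n≡) (m∣m*n q)

  q∣n : q ∣ n
  q∣n = subst (q ∣_) (sym n≡) (n∣m*n 2)

  p∣q : p ∣ q
  p∣q = m∣m*n (p ^ M)

  p∣n : p ∣ n
  p∣n = ∣-trans p∣q q∣n

  2∤q : 2 ∤ q
  2∤q = ∤-^ prime[2] 2∤p (suc M)

  ≈-n : ∀ {a b} → a ≈ b [ 2 ] → a ≈ b [ q ] → a ≈ b [ n ]
  ≈-n {a} {b} e₂ e-q = subst (λ n → a ≈ b [ n ]) (sym n≡) (chinese (coprime-^ (suc M) (∤⇒coprime pr p∤2)) e₂ e-q)

  ≈-odd : ∀ {a b} → 2 ∤ a → 2 ∤ b → a ≈ b [ q ] → a ≈ b [ n ]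
  ≈-odd 2∤a 2∤b = ≈-n (odd-≈ 2∤a 2∤b)

  ≈-even : ∀ {a b} → 2 ∣ a → 2 ∣ b → a ≈ b [ q ] → a ≈ b [ n ]
  ≈-even 2∣a 2∣b = ≈-n (even-≈ 2∣a 2∣b)

  o : ℕ
  o = order M

  -- Since p is odd, this is (p - 1)/2.
  H : ℕ
  H = p / 2

  P≡2H : P ≡ 2 * H
  P≡2H = trans (cong (_∸ 1) (trans (m≡m%n+[m/n]*n p 2) (cong (_+ p / 2 * 2) p-odd))) (*-comm (p / 2) 2)

  h : ℕ
  h = p ^ M * H

  o≡2h : o ≡ 2 * h
  o≡2h = trans (cong (p ^ M *_) P≡2H) (r (p ^ M) H)
    where
    r : ∀ a b → a * (2 * b) ≡ 2 * (a * b)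
    r = solve-∀

  0<o : 0 < o
  0<o = *-mono-≤ (m^n>0 p M) 0<P

  0<h : 0 < h
  0<h = n≢0⇒n>0 λ h≡0 → <-irrefl (sym (trans o≡2h (cong (2 *_) h≡0))) 0<o

  2∤g^ : ∀ i → 2 ∤ g ^ i
  2∤g^ = ∤-^ prime[2] 2∤g

  2∤1 : 2 ∤ 1
  2∤1 2∣1 = contradiction (∣1⇒≡1 2∣1) λ ()

  g^o : g ^ o ≈ 1 [ n ]
  g^o = ≈-odd (2∤g^ o) 2∤1 (pow (g-order M))

  g⁻¹ : ℕ
  g⁻¹ = g ^ (o ∸ 1)

  g*g⁻¹ : g * g⁻¹ ≈ 1 [ n ]
  g*g⁻¹ = subst (λ i → g ^ i ≈ 1 [ n ]) (sym (m+[n∸m]≡n 0<o)) g^o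

  -- Modulo q, -1 is a unit, say g^t. From g^(2t) = 1 it follows that 2h divides 2t, so t = k h. An
  -- even k would give -1 = 1 and p dividing 2; hence k is odd and g^t = g^h. Modulo 2 only parity
  -- is involved.
  g^h : g ^ h + 1 ≈ 0 [ n ]
  g^h = ≈-n (∣⇒≈0 even) half
    where
    even : 2 ∣ g ^ h + 1
    even = ≈0⇒∣ (≈-trans (≈-+ (odd-≈ (2∤g^ h) 2∤1) (≈-refl {a = 1})) (∣⇒≈0 ∣-refl))
    0<q : 0 < q
    0<q = m^n>0 p (suc M)
    q-1+1 : q ∸ 1 + 1 ≡ q
    q-1+1 = m∸n+n≡m 0<q
    p∤q-1 : p ∤ q ∸ 1
    p∤q-1 p∣ = p∤1 (∣m+n∣m⇒∣n (subst (p ∣_) (sym q-1+1) p∣q) p∣)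
    t : ℕ
    t = proj₁ (discrete-log M p∤q-1)
    g^t : g ^ t + 1 ≈ 0 [ q ]
    g^t = ≈-trans (≈-+ (≈-sym (proj₂ (discrete-log M p∤q-1))) (≈-refl {a = 1})) (≈-trans (≈-reflexive q-1+1) (∣⇒≈0 ∣-refl))
    square : g ^ (t + t) ≈ 1 [ q ]
    square = ≈-cancelʳ (g ^ t) (≈-trans (≈-reflexive (trans (cong (_+ g ^ t) (^-distribˡ-+-* g t t)) (r (g ^ t))))
      (≈-trans (≈-*ˡ (g ^ t) g^t) (≈-trans (≈-reflexive (*-zeroʳ (g ^ t))) (≈-trans (≈-sym g^t) (≈-reflexive (+-comm (g ^ t) 1))))))
      where
      r : ∀ y → y * y + y ≡ y * (y + 1)
      r = solve-∀
    h∣t : h ∣ t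
    h∣t = *-cancelˡ-∣ 2 (subst₂ _∣_ o≡2h (r t) (least (g-order M) (t + t) square))
      where
      r : ∀ t → t + t ≡ 2 * t
      r = solve-∀
    multiple : ∀ k → t ≡ k * h → g ^ h + 1 ≈ 0 [ q ]
    multiple k t≡ = go (2 ∣? k)
      where
      r₁ : ∀ j h → j * 2 * h ≡ j * (2 * h)
      r₁ = solve-∀
      r₂ : ∀ j h → (1 + j * 2) * h ≡ h + j * (2 * h)
      r₂ = solve-∀
      go : Dec (2 ∣ k) → g ^ h + 1 ≈ 0 [ q ]
      go (yes (divides j k≡)) = contradiction (∣-trans p∣q (≈0⇒∣ (≈-trans (≈-+ (≈-sym g^t≈1) (≈-refl {a = 1})) g^t))) p∤2
        where
        o∣t : o ∣ t
        o∣t = divides j (trans t≡ (trans (cong (_* h) k≡) (trans (r₁ j h) (cong (j *_) (sym o≡2h)))))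
        g^t≈1 : g ^ t ≈ 1 [ q ]
        g^t≈1 = Order-≈ (g-order M) (∣⇒≈0 o∣t)
      go (no 2∤k) = ≈-trans (≈-+ (Order-≈ (g-order M) (≈-sym t≈h)) (≈-refl {a = 1})) g^t
        where
        t≈h : t ≈ h [ o ]
        t≈h = ≈-trans (≈-reflexive (trans t≡ (trans (cong (_* h) (trans (m≡m%n+[m/n]*n k 2) (cong (_+ k / 2 * 2) (odd-% 2∤k))))
                (trans (r₂ (k / 2) h) (cong (λ x → h + k / 2 * x) (sym o≡2h)))))) (∣⇒+-≈ h (n∣m*n (k / 2)))
    half : g ^ h + 1 ≈ 0 [ q ]
    half = let open _∣_ h∣t in multiple quotient equality

  toℕ-modₙ : ∀ a → toℕ (a mod n) ≈ a [ n ]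
  toℕ-modₙ a = ≈-trans (≈-reflexive (toℕ-mod a n)) (≈-% a n)

  toℕ-+ₙ : ∀ x y → toℕ (x +ₙ y) ≈ toℕ x + toℕ y [ n ]
  toℕ-+ₙ x y = toℕ-modₙ (toℕ x + toℕ y)

  toℕ-negₙ : ∀ x → toℕ (-ₙ x) + toℕ x ≈ 0 [ n ]
  toℕ-negₙ x = ≈-trans (≈-+ (toℕ-modₙ (n ∸ toℕ x)) (≈-refl {a = toℕ x})) (≈-trans (≈-reflexive (m∸n+n≡m (<⇒≤ (toℕ<n x)))) (∣⇒≈0 ∣-refl))

  neg-g^h : ∀ x → toℕ (-ₙ x) ≈ g ^ h * toℕ x [ n ]
  neg-g^h x = ≈-cancelʳ (toℕ x) (≈-trans (toℕ-negₙ x) (≈-sym (≈-trans (≈-reflexive (r (g ^ h) (toℕ x))) (≈-*ʳ (toℕ x) g^h))))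
    where
    r : ∀ a x → a * x + x ≡ (a + 1) * x
    r = solve-∀

  toℕ--ₙ : ∀ x y → toℕ (x -ₙ y) + toℕ y ≈ toℕ x [ n ]
  toℕ--ₙ x y = ≈-trans (≈-+ (toℕ-+ₙ x (-ₙ y)) (≈-refl {a = toℕ y}))
    (≈-trans (≈-reflexive (+-assoc (toℕ x) _ _)) (≈-trans (≈-+ (≈-refl {a = toℕ x}) (toℕ-negₙ y)) (≈-reflexive (+-identityʳ (toℕ x)))))

  mod-toℕ : ∀ {a} (x : Zn) → a ≈ toℕ x [ n ] → a mod n ≡ x
  mod-toℕ x e = trans (mod-cong n e) (toℕ-mod-id x)

  at : Subset n → ℕ → Bool
  at = lookup%

  at-≈ : ∀ Ω {x y} → x ≈ y [ n ] → at Ω x ≡ at Ω y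
  at-≈ Ω = lookup%-≈ Ω

  at-tabulate : ∀ f → (∀ {x y} → x ≈ y [ n ] → f x ≡ f y) → ∀ x → at (tabulate% n f) x ≡ f x
  at-tabulate f resp x = trans (lookup%-tabulate% n f x) (resp (≈-% x n))

  at-ext : ∀ {Ω Ω′} → (∀ x → at Ω x ≡ at Ω′ x) → Ω ≡ Ω′
  at-ext {Ω} {Ω′} eq = trans (sym (tabulate%-lookup% Ω)) (trans (tabulate%-cong n eq) (tabulate%-lookup% Ω′))

  at⇒∈ : ∀ {Ω} (x : Zn) → at Ω (toℕ x) ≡ true → x ∈ Ω
  at⇒∈ {Ω} x eq = Vecₚ.lookup⇒[]= x Ω (trans (cong (Vec.lookup Ω) (sym (toℕ-mod-id x))) eq)

  ∈⇒at : ∀ {Ω} {x : Zn} → x ∈ Ω → at Ω (toℕ x) ≡ true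
  ∈⇒at {Ω} {x} x∈ = trans (cong (Vec.lookup Ω) (toℕ-mod-id x)) (Vecₚ.[]=⇒lookup x∈)

  T : Subset n → Subset n
  T Ω = tabulate% n (λ x → at Ω (g * x))

  at-T : ∀ Ω x → at (T Ω) x ≡ at Ω (g * x)
  at-T Ω = at-tabulate (λ x → at Ω (g * x)) (λ e → at-≈ Ω (≈-*ˡ g e))

  at-iter : ∀ i Ω x → at (iter T i Ω) x ≡ at Ω (g ^ i * x)
  at-iter zero    Ω x = cong (at Ω) (sym (+-identityʳ x))
  at-iter (suc i) Ω x = trans (at-T (iter T i Ω) x) (trans (at-iter i Ω (g * x)) (cong (at Ω) (r (g ^ i) g x)))
    where
    r : ∀ a b x → a * (b * x) ≡ b * a * x
    r = solve-∀

  fixed⇒ : ∀ {i Ω} → iter T i Ω ≡ Ω → ∀ x → at Ω (g ^ i * x) ≡ at Ω x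
  fixed⇒ {i} {Ω} eq x = trans (sym (at-iter i Ω x)) (cong (λ Ω → at Ω x) eq)

  ⇒fixed : ∀ {i Ω} → (∀ x → at Ω (g ^ i * x) ≡ at Ω x) → iter T i Ω ≡ Ω
  ⇒fixed {i} {Ω} eq = at-ext λ x → trans (at-iter i Ω x) (eq x)

  -- Admissibility in terms of parity and divisibility by p

  Contains∤ : ℕ → Subset n → Set
  Contains∤ d Ω = ∃[ x ] (x < n × (d ∤ x × at Ω x ≡ true))

  Contains∤? : ∀ d Ω → Dec (Contains∤ d Ω)
  Contains∤? d Ω = anyUpTo? (λ x → ¬? (d ∣? x) ×-dec (at Ω x Bool.≟ true)) n

  contains∤ : ∀ {d Ω} → d ∣ n → ∀ x → d ∤ x → at Ω x ≡ true → Contains∤ d Ω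
  contains∤ {d} {Ω} d∣n x d∤x eq = x % n , m%n<n x n , d∤x ∘ ∣-resp-≈ d∣n (≈-% x n) , trans (at-≈ Ω (≈-% x n)) eq

  -- Admissibility in decidable form: Ω generates iff it contains an odd element and one prime to p.
  Good : Subset n → Set
  Good Ω = iter T h Ω ≡ Ω × at Ω 0 ≡ false × Contains∤ 2 Ω × Contains∤ p Ω

  Good? : ∀ Ω → Dec (Good Ω)
  Good? Ω = (iter T h Ω ≟V Ω) ×-dec ((at Ω 0 Bool.≟ false) ×-dec (Contains∤? 2 Ω ×-dec Contains∤? p Ω))

  gen-multiples : ∀ {Ω a} → at Ω a ≡ true → ∀ i y → Gen Ω (y mod n) → Gen Ω ((i * a + y) mod n)
  gen-multiples         eq zero    y G = G
  gen-multiples {Ω} {a} eq (suc i) y G = subst (Gen Ω)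
    (mod-cong n (≈-trans (≈-+ (toℕ-modₙ a) (toℕ-modₙ (i * a + y))) (≈-reflexive (sym (+-assoc a (i * a) y)))))
    (genS (at⇒∈ (a mod n) (trans (at-≈ Ω (toℕ-modₙ a)) eq)) (gen-multiples eq i y G))

  -- Given a odd, b prime to p, and w inverse to 2b modulo q, the combination (q y) a + (2 y w) b is
  -- y modulo 2, where the second term vanishes, and y modulo q, where the first one does.
  generates : ∀ {Ω} → Contains∤ 2 Ω → Contains∤ p Ω → ∀ x → Gen Ω x
  generates {Ω} (a , _ , 2∤a , Ωa) (b , _ , p∤b , Ωb) x =
    subst (Gen Ω) (mod-toℕ x (≈-n mod-2 mod-q)) (gen-multiples Ωa (q * y) (2 * (y * w) * b + 0) (gen-multiples Ωb (2 * (y * w)) 0 gen0))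
    where
    y : ℕ
    y = toℕ x
    inv : Inv q (2 * b)
    inv = ∤⇒Inv (suc M) pr (∤-* pr p∤2 p∤b)
    w : ℕ
    w = proj₁ inv
    mod-2 : q * y * a + (2 * (y * w) * b + 0) ≈ y [ 2 ]
    mod-2 = ≈-trans (≈-reflexive (r q y a w b)) (≈-trans (∣⇒+-≈ (y * (q * a)) (m∣m*n (y * w * b)))
      (≈-trans (≈-*ˡ y (odd-≈ (∤-* prime[2] 2∤q 2∤a) 2∤1)) (≈-reflexive (*-identityʳ y))))
      where
      r : ∀ q y a w b → q * y * a + (2 * (y * w) * b + 0) ≡ y * (q * a) + 2 * (y * w * b)
      r = solve-∀
    mod-q : q * y * a + (2 * (y * w) * b + 0) ≈ y [ q ]
    mod-q = ≈-trans (≈-reflexive (r q y a w b)) (≈-trans (∣⇒+-≈ (y * (2 * b * w)) (m∣m*n (y * a)))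
      (≈-trans (≈-*ˡ y (proj₂ inv)) (≈-reflexive (*-identityʳ y))))
      where
      r : ∀ q y a w b → q * y * a + (2 * (y * w) * b + 0) ≡ y * (2 * b * w) + q * (y * a)
      r = solve-∀

  Good⇒Admissible : ∀ {Ω} → Good Ω → Admissible Ω
  Good⇒Admissible {Ω} (sym-Ω , Ω0 , c₂ , c-p) = symmetric , no-zero , generates c₂ c-p
    where
    symmetric : ∀ x → x ∈ Ω → (-ₙ x) ∈ Ω
    symmetric x x∈ = at⇒∈ (-ₙ x) (trans (at-≈ Ω (neg-g^h x)) (trans (fixed⇒ {h} sym-Ω (toℕ x)) (∈⇒at x∈)))
    no-zero : 0ₙ ∉ Ω
    no-zero 0∈ = case trans (sym Ω0) (trans (at-≈ Ω (≈-sym (toℕ-modₙ 0))) (∈⇒at 0∈)) of λ ()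

  gen-divisible : ∀ {Ω d} → d ∣ n → (∀ x → x ∈ Ω → d ∣ toℕ x) → ∀ {x} → Gen Ω x → d ∣ toℕ x
  gen-divisible d∣n all gen0 = ∣-resp-≈ d∣n (≈-sym (toℕ-modₙ 0)) (_ ∣0)
  gen-divisible d∣n all (genS {x} {y} x∈ G) = ∣-resp-≈ d∣n (≈-sym (toℕ-+ₙ x y)) (∣m∣n⇒∣m+n (all x x∈) (gen-divisible d∣n all G))

  -- If d divided every element of Ω, it would divide every generated element, in particular 1.
  generates⇒contains : ∀ {Ω} d → d ∣ n → d ∤ 1 → (∀ x → Gen Ω x) → Contains∤ d Ω
  generates⇒contains {Ω} d d∣n d∤1 G = decidable-stable (Contains∤? d Ω) λ ¬c →
    d∤1 (∣-resp-≈ d∣n (toℕ-modₙ 1) (gen-divisible {Ω} d∣n (λ x x∈ → decidable-stable (d ∣? toℕ x) λ d∤x → ¬c (toℕ x , toℕ<n x , d∤x , ∈⇒at x∈)) (G (1 mod n))))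

  Admissible⇒Good : ∀ {Ω} → Admissible Ω → Good Ω
  Admissible⇒Good {Ω} (symmetric , no-zero , G) = ⇒fixed {h} (λ x → bool-≡ (back x) (forth x)) , zero-false (at Ω 0) refl ,
      generates⇒contains 2 2∣n 2∤1 G , generates⇒contains p p∣n p∤1 G
    where
    forth : ∀ x → at Ω x ≡ true → at Ω (g ^ h * x) ≡ true
    forth x eq = trans (at-≈ Ω (≈-sym (≈-trans (neg-g^h (x mod n)) (≈-*ˡ (g ^ h) (toℕ-modₙ x)))))
      (∈⇒at (symmetric (x mod n) (at⇒∈ (x mod n) (trans (at-≈ Ω (toℕ-modₙ x)) eq))))
    twice : ∀ x → g ^ h * (g ^ h * x) ≈ x [ n ]
    twice x = ≈-trans (≈-reflexive (trans (sym (*-assoc (g ^ h) (g ^ h) x)) (cong (_* x) (trans (sym (^-distribˡ-+-* g h h)) (cong (g ^_) (trans (r h) (sym o≡2h)))))))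
      (≈-trans (≈-*ʳ x g^o) (≈-reflexive (*-identityˡ x)))
      where
      r : ∀ h → h + h ≡ 2 * h
      r = solve-∀
    back : ∀ x → at Ω (g ^ h * x) ≡ true → at Ω x ≡ true
    back x eq = trans (at-≈ Ω (≈-sym (twice x))) (forth (g ^ h * x) eq)
    zero-false : ∀ b → at Ω 0 ≡ b → at Ω 0 ≡ false
    zero-false false eq = eq
    zero-false true  eq = contradiction (at⇒∈ 0ₙ (trans (at-≈ Ω (toℕ-modₙ 0)) eq)) no-zero

  -- The action of g and weak equivalence

  g*[g⁻¹*] : ∀ x → g * (g⁻¹ * x) ≈ x [ n ]
  g*[g⁻¹*] x = ≈-trans (≈-reflexive (sym (*-assoc g g⁻¹ x))) (≈-trans (≈-*ʳ x g*g⁻¹) (≈-reflexive (*-identityˡ x)))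

  Good-T : ∀ Ω → Good Ω → Good (T Ω)
  Good-T Ω (sym-Ω , Ω0 , c₂ , c-p) =
    trans (sym (iter-+ T h 1 Ω)) (trans (cong (λ j → iter T j Ω) (+-comm h 1)) (cong T sym-Ω)) ,
    trans (at-T Ω 0) (trans (cong (at Ω) (*-zeroʳ g)) Ω0) ,
    move 2∣n prime[2] (2∤g^ (o ∸ 1)) c₂ , move p∣n pr (p∤g^ (o ∸ 1)) c-p
    where
    move : ∀ {d} → d ∣ n → Prime d → d ∤ g⁻¹ → Contains∤ d Ω → Contains∤ d (T Ω)
    move d∣n prd d∤ (x , _ , d∤x , Ωx) = contains∤ {Ω = T Ω} d∣n (g⁻¹ * x) (∤-* prd d∤ d∤x)
      (trans (at-T Ω (g⁻¹ * x)) (trans (at-≈ Ω (g*[g⁻¹*] x)) Ωx))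

  size-∑ : ∀ Ω → ∣ Ω ∣ ≡ ∑< n (λ x → ⟦ at Ω x ⟧)
  size-∑ Ω = trans (size-weight Ω) (sym (∑-lookup Ω _ (λ i → cong (λ j → ⟦ Vec.lookup Ω j ⟧) (toℕ-mod-id i))))

  size-T : ∀ Ω → ∣ T Ω ∣ ≡ ∣ Ω ∣
  size-T Ω = begin
    ∣ T Ω ∣                                        ≡⟨ size-∑ (T Ω) ⟩
    ∑< n (λ x → ⟦ at (T Ω) x ⟧)                    ≡⟨ ∑-allFin n (λ x → ⟦ at (T Ω) x ⟧) ⟨
    ∑ (allFin n) (λ u → ⟦ at (T Ω) (toℕ u) ⟧)      ≡⟨ ∑-cong (allFin n) (λ u → trans (cong ⟦_⟧ (trans (at-T Ω (toℕ u)) (at-≈ Ω (≈-sym (toℕ-modₙ (g * toℕ u)))))) (sym (*-identityˡ _))) ⟩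
    ∑ (allFin n) (λ u → 1 * ⟦ at Ω (toℕ (mul u)) ⟧) ≡⟨ ∑-bijection {_≟A_ = Fin._≟_} {Fin._≟_} (Enum-allFin n) (Enum-allFin n) (λ _ → yes tt) (λ _ → yes tt) mul mul⁻¹
                                                        (λ u _ → mul-mul⁻¹ u) (λ u _ → mul⁻¹-mul u) (λ _ _ → tt) (λ _ _ → tt) (λ u → ⟦ at Ω (toℕ u) ⟧) ⟨
    ∑ (allFin n) (λ u → 1 * ⟦ at Ω (toℕ u) ⟧)      ≡⟨ ∑-cong (allFin n) (λ u → *-identityˡ _) ⟩
    ∑ (allFin n) (λ u → ⟦ at Ω (toℕ u) ⟧)          ≡⟨ ∑-allFin n (λ x → ⟦ at Ω x ⟧) ⟩
    ∑< n (λ x → ⟦ at Ω x ⟧)                        ≡⟨ size-∑ Ω ⟨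
    ∣ Ω ∣ ∎
    where
    open ≡-Reasoning
    mul mul⁻¹ : Zn → Zn
    mul u = (g * toℕ u) mod n
    mul⁻¹ u = (g⁻¹ * toℕ u) mod n
    mul-mul⁻¹ : ∀ u → mul (mul⁻¹ u) ≡ u
    mul-mul⁻¹ u = mod-toℕ u (≈-trans (≈-*ˡ g (toℕ-modₙ (g⁻¹ * toℕ u))) (g*[g⁻¹*] (toℕ u)))
    mul⁻¹-mul : ∀ u → mul⁻¹ (mul u) ≡ u
    mul⁻¹-mul u = mod-toℕ u (≈-trans (≈-*ˡ g⁻¹ (toℕ-modₙ (g * toℕ u))) (≈-trans (≈-reflexive (r g⁻¹ g (toℕ u))) (g*[g⁻¹*] (toℕ u))))
      where
      r : ∀ a b x → a * (b * x) ≡ b * (a * x)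
      r = solve-∀

  -- T^i Ω is g^(-i) Ω, so multiplication by g^(-i) serves both as the graph isomorphism and as the
  -- automorphism.
  iterate⇒WeakEquiv : ∀ i Ω → WeakEquiv Ω (iter T i Ω)
  iterate⇒WeakEquiv i Ω = α , α , (bijective , λ x y → mk⇔ (adjacent x y) (adjacent⁻¹ x y)) , (bijective , α-+) , α-+
    where
    a : ℕ
    a = g⁻¹ ^ i
    α : Zn → Zn
    α x = (a * toℕ x) mod n
    α⁻¹ : Zn → Zn
    α⁻¹ x = (g ^ i * toℕ x) mod n
    g^i*a : ∀ x → g ^ i * (a * x) ≈ x [ n ]
    g^i*a x = ≈-trans (≈-reflexive (trans (sym (*-assoc (g ^ i) a x)) (cong (_* x) (sym (^-* g g⁻¹ i)))))
                (≈-trans (≈-*ʳ x (≈1-^ i g*g⁻¹)) (≈-reflexive (*-identityˡ x)))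
    bijective : Bijective α
    bijective = α⁻¹ , (λ x → mod-toℕ x (≈-trans (≈-*ˡ (g ^ i) (toℕ-modₙ (a * toℕ x))) (g^i*a (toℕ x)))) ,
      (λ x → mod-toℕ x (≈-trans (≈-*ˡ a (toℕ-modₙ (g ^ i * toℕ x))) (≈-trans (≈-reflexive (r a (g ^ i) (toℕ x))) (g^i*a (toℕ x)))))
      where
      r : ∀ a b x → a * (b * x) ≡ b * (a * x)
      r = solve-∀
    α-+ : ∀ x y → α (x +ₙ y) ≡ α x +ₙ α y
    α-+ x y = mod-cong n (≈-trans (≈-*ˡ a (toℕ-+ₙ x y)) (≈-trans (≈-reflexive (*-distribˡ-+ a (toℕ x) (toℕ y)))
                (≈-sym (≈-+ (toℕ-modₙ (a * toℕ x)) (toℕ-modₙ (a * toℕ y))))))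
    difference : ∀ x y → toℕ (α y -ₙ α x) ≈ a * toℕ (y -ₙ x) [ n ]
    difference x y = ≈-cancelʳ (toℕ (α x)) (≈-trans (toℕ--ₙ (α y) (α x)) (≈-trans (toℕ-modₙ (a * toℕ y)) (≈-trans (≈-*ˡ a (≈-sym (toℕ--ₙ y x)))
      (≈-trans (≈-reflexive (*-distribˡ-+ a (toℕ (y -ₙ x)) (toℕ x))) (≈-+ (≈-refl {a = a * toℕ (y -ₙ x)}) (≈-sym (toℕ-modₙ (a * toℕ x))))))))
    same : ∀ x y → at (iter T i Ω) (toℕ (α y -ₙ α x)) ≡ at Ω (toℕ (y -ₙ x))
    same x y = trans (at-iter i Ω _) (at-≈ Ω (≈-trans (≈-*ˡ (g ^ i) (difference x y)) (g^i*a (toℕ (y -ₙ x)))))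
    adjacent : ∀ x y → Adj Ω x y → Adj (iter T i Ω) (α x) (α y)
    adjacent x y e = at⇒∈ (α y -ₙ α x) (trans (same x y) (∈⇒at e))
    adjacent⁻¹ : ∀ x y → Adj (iter T i Ω) (α x) (α y) → Adj Ω x y
    adjacent⁻¹ x y e = at⇒∈ (y -ₙ x) (trans (sym (same x y)) (∈⇒at e))

  -- The automorphism is multiplication by a = α(1), and a is a unit because 1 is attained, hence a
  -- power of g. As f(x) - f(0) = a x, comparing the edges {0, x} and {f(0), f(x)} shows that x is
  -- in Ω iff a x is in Ω′.
  WeakEquiv⇒iterate : ∀ {Ω Ω′} → WeakEquiv Ω Ω′ → ∃[ t ] (iter T t Ω′ ≡ Ω)
  WeakEquiv⇒iterate {Ω} {Ω′} (f , α , (_ , adj) , ((α⁻¹ , _ , α-α⁻¹) , α-+) , f-+) =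
    t , at-ext λ x → trans (at-iter t Ω′ x) (trans (at-≈ Ω′ (≈-*ʳ x (≈-sym a≈g^t))) (sym (transport x)))
    where
    a : ℕ
    a = toℕ (α (1 mod n))
    α-0 : toℕ (α 0ₙ) ≈ 0 [ n ]
    α-0 = ≈-cancelʳ (toℕ (α 0ₙ)) (≈-trans (≈-sym (toℕ-+ₙ (α 0ₙ) (α 0ₙ))) (≈-reflexive (cong toℕ (trans (sym (α-+ 0ₙ 0ₙ)) (cong α (mod-toℕ 0ₙ (≈-+ (toℕ-modₙ 0) (≈-refl {a = toℕ 0ₙ}))))))))
    α-multiple : ∀ k → toℕ (α (k mod n)) ≈ k * a [ n ]
    α-multiple zero    = α-0
    α-multiple (suc k) = ≈-trans (≈-reflexive (cong toℕ (trans (cong α (sym split)) (α-+ (1 mod n) (k mod n)))))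
      (≈-trans (toℕ-+ₙ (α (1 mod n)) (α (k mod n))) (≈-+ (≈-refl {a = a}) (α-multiple k)))
      where
      split : (1 mod n) +ₙ (k mod n) ≡ suc k mod n
      split = mod-cong n (≈-+ (toℕ-modₙ 1) (toℕ-modₙ k))
    inverse : toℕ (α⁻¹ (1 mod n)) * a ≈ 1 [ n ]
    inverse = ≈-trans (≈-sym (α-multiple (toℕ (α⁻¹ (1 mod n))))) (≈-trans (≈-reflexive (cong toℕ (trans (cong α (toℕ-mod-id (α⁻¹ (1 mod n)))) (α-α⁻¹ (1 mod n))))) (toℕ-modₙ 1))
    ∤a : ∀ {d} → d ∣ n → d ∤ 1 → d ∤ a
    ∤a d∣n d∤1 d∣a = d∤1 (∣-resp-≈ d∣n inverse (∣n⇒∣m*n (toℕ (α⁻¹ (1 mod n))) d∣a))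
    t : ℕ
    t = proj₁ (discrete-log M (∤a p∣n p∤1))
    a≈g^t : a ≈ g ^ t [ n ]
    a≈g^t = ≈-odd (∤a 2∣n 2∤1) (2∤g^ t) (proj₂ (discrete-log M (∤a p∣n p∤1)))
    x-0 : ∀ (x : Zn) → toℕ (x -ₙ 0ₙ) ≈ toℕ x [ n ]
    x-0 x = ≈-trans (≈-reflexive (sym (+-identityʳ _))) (≈-trans (≈-+ (≈-refl {a = toℕ (x -ₙ 0ₙ)}) (≈-sym (toℕ-modₙ 0))) (toℕ--ₙ x 0ₙ))
    f-difference : ∀ (x : Zn) → toℕ (f x -ₙ f 0ₙ) ≈ a * toℕ x [ n ]
    f-difference x = ≈-cancelʳ (toℕ (f 0ₙ)) (≈-trans (toℕ--ₙ (f x) (f 0ₙ)) (≈-trans (≈-reflexive (cong toℕ (trans (cong f (sym x+0)) (f-+ x 0ₙ))))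
      (≈-trans (toℕ-+ₙ (α x) (f 0ₙ)) (≈-+ (≈-trans (≈-reflexive (cong (toℕ ∘ α) (sym (toℕ-mod-id x)))) (≈-trans (α-multiple (toℕ x)) (≈-reflexive (*-comm (toℕ x) a)))) (≈-refl {a = toℕ (f 0ₙ)})))))
      where
      x+0 : x +ₙ 0ₙ ≡ x
      x+0 = mod-toℕ x (≈-trans (≈-+ (≈-refl {a = toℕ x}) (toℕ-modₙ 0)) (≈-reflexive (+-identityʳ (toℕ x))))
    transport-Zn : ∀ (x : Zn) → at Ω (toℕ x) ≡ at Ω′ (a * toℕ x)
    transport-Zn x = bool-≡
      (λ e → trans (at-≈ Ω′ (≈-sym (f-difference x))) (∈⇒at (Equivalence.to (adj 0ₙ x) (at⇒∈ (x -ₙ 0ₙ) (trans (at-≈ Ω (x-0 x)) e)))))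
      (λ e → trans (at-≈ Ω (≈-sym (x-0 x))) (∈⇒at (Equivalence.from (adj 0ₙ x) (at⇒∈ (f x -ₙ f 0ₙ) (trans (at-≈ Ω′ (f-difference x)) e)))))
    transport : ∀ x → at Ω x ≡ at Ω′ (a * x)
    transport x = trans (at-≈ Ω (≈-sym (toℕ-modₙ x))) (trans (transport-Zn (x mod n)) (at-≈ Ω′ (≈-*ˡ a (toℕ-modₙ x))))

-- Connection sets fixed by g^d, counted by tuples of blocks

div-* : ∀ {s x} → s ≢ 0 → s ∣ x → (x div s) * s ≡ x
div-* {zero}  s≢0 _   = contradiction refl s≢0
div-* {suc s} _   s∣x = m/n*n≡m s∣x

module FixedSets (p : ℕ) (pr : Prime p) (p-odd : p % 2 ≡ 1) (M n′ : ℕ) (n≡ : suc n′ ≡ 2 * p ^ suc M)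
                 (d : ℕ) (d≢0 : d ≢ 0) (d∣h : d ∣ Sets.h p pr p-odd M n′ n≡) where

  open Sets p pr p-odd M n′ n≡

  -- `lengths` and `shifts` are written as in `Qd` and `Pd`, so that the polynomial of `Tuples` is
  -- the bracket of the theorem by computation. Their meaning as gcd and cofactor is supplied by
  -- `gcd-lengths` and `order-lengths`.
  lengths : ℕ → ℕ
  lengths zero    = d
  lengths (suc j) = gk p (suc M) d (suc j)

  shifts : ℕ → ℕ
  shifts zero    = φ (p ^ suc M) div d
  shifts (suc j) = φ (p ^ (suc M ∸ suc j)) div gk p (suc M) d (suc j)

  module L = Tuples lengths shifts M

  open L using (Tuple; tuples; Generating; Generating?; weightT; _≟T_; Enum-tuples)

  d∣o : d ∣ o
  d∣o = subst (d ∣_) (sym o≡2h) (∣n⇒∣m*n 2 d∣h)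

  -- Since d divides (p - 1)/2 times a power of the odd number p, halving the second argument does not
  -- change the gcd.
  gcd-half : ∀ K → gcd d (order K) ≡ gcd d (φ (p ^ suc K) / 2)
  gcd-half K = trans (∣-antisym (gcd-greatest (gcd[m,n]∣m d (order K)) D∣half)
      (gcd-greatest (gcd[m,n]∣m d half) (∣-trans (gcd[m,n]∣n d half) half∣order))) (cong (gcd d) (sym φ/2))
    where
    half : ℕ
    half = p ^ K * H
    D : ℕ
    D = gcd d (order K)
    order≡ : order K ≡ half * 2
    order≡ = trans (cong (p ^ K *_) P≡2H) (r (p ^ K) H)
      where
      r : ∀ a b → a * (2 * b) ≡ a * b * 2
      r = solve-∀
    φ/2 : φ (p ^ suc K) / 2 ≡ half
    φ/2 = trans (cong (_/ 2) (trans (φ-prime-power K) order≡)) (m*n/n≡m half 2)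
    half∣order : half ∣ order K
    half∣order = subst (half ∣_) (sym order≡) (m∣m*n 2)
    p^M-odd : p ^ M ≡ 1 + p ^ M / 2 * 2
    p^M-odd = trans (m≡m%n+[m/n]*n (p ^ M) 2) (cong (_+ p ^ M / 2 * 2) (odd-% (∤-^ prime[2] 2∤p M)))
    D∣2half : D ∣ half * 2
    D∣2half = subst (D ∣_) order≡ (gcd[m,n]∣n d (order K))
    D∣odd-multiple : D ∣ p ^ M * half
    D∣odd-multiple = ∣-trans (∣-trans (gcd[m,n]∣m d (order K)) d∣h) (subst (h ∣_) (r (p ^ K) (p ^ M) H) (n∣m*n (p ^ K)))
      where
      r : ∀ a b c → a * (b * c) ≡ b * (a * c)
      r = solve-∀
    D∣half : D ∣ half
    D∣half = ∣m+n∣m⇒∣n (subst (D ∣_) (trans (cong (_* half) p^M-odd) (r half (p ^ M / 2))) D∣odd-multiple) (∣n⇒∣m*n (p ^ M / 2) D∣2half)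
      where
      r : ∀ a b → (1 + b * 2) * a ≡ b * (a * 2) + a
      r = solve-∀

  exponent : ∀ {j} → j < M → M ∸ j ≡ suc (M ∸ suc j)
  exponent {j} j<M = +-cancelʳ-≡ j (M ∸ j) (suc (M ∸ suc j)) (trans (m∸n+n≡m (<⇒≤ j<M)) (sym (trans (sym (+-suc (M ∸ suc j) j)) (m∸n+n≡m j<M))))

  fits-from : ∀ s K → (∀ i → i < K → gcd d (order (K ∸ suc i)) ≡ s i) → Fits s d K
  fits-from s zero    eq = tt
  fits-from s (suc K) eq = eq 0 (s≤s z≤n) , fits-from (s ∘ suc) K (λ i i<K → eq (suc i) (s≤s i<K))

  lengths-from : ∀ e s K → (∀ i → i < K → order (K ∸ suc i) ≡ e i * s i) → Lengths e s K
  lengths-from e s zero    eq = tt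
  lengths-from e s (suc K) eq = eq 0 (s≤s z≤n) , lengths-from (e ∘ suc) (s ∘ suc) K (λ i i<K → eq (suc i) (s≤s i<K))

  gcd-lengths : ∀ i → i < suc M → gcd d (order (M ∸ i)) ≡ lengths i
  gcd-lengths zero    _         = ∣-antisym (gcd[m,n]∣m d o) (gcd-greatest ∣-refl d∣o)
  gcd-lengths (suc j) (s≤s j<M) = trans (gcd-half (M ∸ suc j)) (cong (λ k → gcd d (φ (p ^ k) / 2)) (sym (exponent j<M)))

  lengths≢0 : ∀ i → i < suc M → lengths i ≢ 0
  lengths≢0 i i< eq = d≢0 (0∣⇒≡0 (subst (_∣ d) (trans (gcd-lengths i i<) eq) (gcd[m,n]∣m d (order (M ∸ i)))))

  order-lengths : ∀ i → i < suc M → order (M ∸ i) ≡ shifts i * lengths i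
  order-lengths i i< = trans (sym (div-* (lengths≢0 i i<) (subst (_∣ order (M ∸ i)) (gcd-lengths i i<) (gcd[m,n]∣n d (order (M ∸ i)))))) (cong (_* lengths i) (shift i i<))
    where
    shift : ∀ i → i < suc M → order (M ∸ i) div lengths i ≡ shifts i
    shift zero    _         = cong (_div d) (sym (φ-prime-power M))
    shift (suc j) (s≤s j<M) = cong (_div lengths (suc j)) (trans (sym (φ-prime-power (M ∸ suc j))) (cong (λ k → φ (p ^ k)) (sym (exponent j<M))))

  fits : Fits lengths d (suc M)
  fits = fits-from lengths (suc M) gcd-lengths

  lens : Lengths shifts lengths (suc M)
  lens = lengths-from shifts lengths (suc M) order-lengths

  -- Translation between tuples and connection sets

  Block : Set
  Block = Blocks lengths (suc M)

  atB : Block → ℕ → Bool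
  atB = blockAt lengths (suc M)

  tabB : (ℕ → Bool) → Block
  tabB = blockTab lengths (suc M)

  atB-≈ : ∀ X {x y} → x ≈ y [ q ] → atB X x ≡ atB X y
  atB-≈ X = blockAt-≈ lengths (suc M) X fits

  atB-q : ∀ X {x} → q ∣ x → atB X x ≡ false
  atB-q X q∣x = trans (atB-≈ X (∣⇒≈0 q∣x)) (blockAt-0 lengths (suc M) X)

  -- The even and the odd element of ℤ_{2q} over a residue modulo q.
  evenₗ : ℕ → ℕ
  evenₗ y = y * (q + 1)

  oddₗ : ℕ → ℕ
  oddₗ y = y * (q + 1) + q

  2∣q+1 : 2 ∣ q + 1
  2∣q+1 = ≈0⇒∣ (≈-trans (≈-+ (odd-≈ 2∤q 2∤1) (≈-refl {a = 1})) (∣⇒≈0 ∣-refl))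

  even-evenₗ : ∀ y → 2 ∣ evenₗ y
  even-evenₗ y = ∣n⇒∣m*n y 2∣q+1

  odd-oddₗ : ∀ y → 2 ∤ oddₗ y
  odd-oddₗ y 2∣ = 2∤q (∣m+n∣m⇒∣n 2∣ (even-evenₗ y))

  evenₗ-≈ : ∀ y → evenₗ y ≈ y [ q ]
  evenₗ-≈ y = ≈-trans (≈-reflexive (trans (*-distribˡ-+ y q 1) (trans (+-comm (y * q) (y * 1)) (cong (_+ y * q) (*-identityʳ y))))) (∣⇒+-≈ y (n∣m*n y))

  oddₗ-≈ : ∀ y → oddₗ y ≈ y [ q ]
  oddₗ-≈ y = ≈-trans (∣⇒+-≈ (evenₗ y) ∣-refl) (evenₗ-≈ y)

  ≈evenₗ : ∀ {x y} → 2 ∣ x → x ≈ y [ q ] → x ≈ evenₗ y [ n ]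
  ≈evenₗ {x} {y} 2∣x e = ≈-even 2∣x (even-evenₗ y) (≈-trans e (≈-sym (evenₗ-≈ y)))

  ≈oddₗ : ∀ {x y} → 2 ∤ x → x ≈ y [ q ] → x ≈ oddₗ y [ n ]
  ≈oddₗ {x} {y} 2∤x e = ≈-odd 2∤x (odd-oddₗ y) (≈-trans e (≈-sym (oddₗ-≈ y)))

  select : ∀ {A B : Set} → Dec A → Dec B → Bool → Bool → Bool → Bool
  select (yes _) _       a b c = a
  select (no _)  (yes _) a b c = b
  select (no _)  (no _)  a b c = c

  -- All odd multiples of q are q modulo n, so one bit z decides them. The even multiples are 0
  -- modulo n, and there `atB Y` is false by `atB-q`.
  elt : Tuple → ℕ → Bool
  elt ((X , Y) , z) x = select (2 ∣? x) (q ∣? x) (atB Y x) z (atB X x)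

  elt-even : ∀ X Y z {x} → 2 ∣ x → elt ((X , Y) , z) x ≡ atB Y x
  elt-even X Y z {x} 2∣x with 2 ∣? x
  ... | yes _  = refl
  ... | no 2∤x = contradiction 2∣x 2∤x

  elt-q : ∀ X Y z {x} → 2 ∤ x → q ∣ x → elt ((X , Y) , z) x ≡ z
  elt-q X Y z {x} 2∤x q∣x with 2 ∣? x | q ∣? x
  ... | yes 2∣x | _      = contradiction 2∣x 2∤x
  ... | no _    | yes _  = refl
  ... | no _    | no q∤x = contradiction q∣x q∤x

  elt-odd : ∀ X Y z {x} → 2 ∤ x → q ∤ x → elt ((X , Y) , z) x ≡ atB X x
  elt-odd X Y z {x} 2∤x q∤x with 2 ∣? x | q ∣? x
  ... | yes 2∣x | _       = contradiction 2∣x 2∤x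
  ... | no _    | yes q∣x = contradiction q∣x q∤x
  ... | no _    | no _    = refl

  elt-cong : ∀ t {x y} → (2 ∣ x → 2 ∣ y) → (2 ∣ y → 2 ∣ x) → (q ∣ x → q ∣ y) → (q ∣ y → q ∣ x) →
             (∀ X → atB X x ≡ atB X y) → elt t x ≡ elt t y
  elt-cong ((X , Y) , z) {x} {y} f f⁻¹ k k⁻¹ same = go (2 ∣? x) (q ∣? x)
    where
    go : Dec (2 ∣ x) → Dec (q ∣ x) → elt ((X , Y) , z) x ≡ elt ((X , Y) , z) y
    go (yes a) _       = trans (elt-even X Y z a) (trans (same Y) (sym (elt-even X Y z (f a))))
    go (no a)  (yes b) = trans (elt-q X Y z a b) (sym (elt-q X Y z (a ∘ f⁻¹) (k b)))
    go (no a)  (no b)  = trans (elt-odd X Y z a b) (trans (same X) (sym (elt-odd X Y z (a ∘ f⁻¹) (b ∘ k⁻¹))))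

  elt-≈ : ∀ t {x y} → x ≈ y [ n ] → elt t x ≡ elt t y
  elt-≈ t e = elt-cong t (∣-resp-≈ 2∣n e) (∣-resp-≈ 2∣n (≈-sym e)) (∣-resp-≈ q∣n e) (∣-resp-≈ q∣n (≈-sym e)) (λ X → atB-≈ X (≈-∣ q∣n e))

  toSet : Tuple → Subset n
  toSet t = tabulate% n (elt t)

  at-toSet : ∀ t x → at (toSet t) x ≡ elt t x
  at-toSet t = at-tabulate (elt t) (elt-≈ t)

  fromSet : Subset n → Tuple
  fromSet Ω = (tabB (λ y → at Ω (oddₗ y)) , tabB (λ y → at Ω (evenₗ y))) , at Ω q

  private
    instance
      d-nonZero : NonZero d
      d-nonZero = ≢-nonZero d≢0

  shift-odd : ∀ y → oddₗ (g ^ d * y) ≈ g ^ d * oddₗ y [ n ]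
  shift-odd y = ≈-odd (odd-oddₗ (g ^ d * y)) (∤-* prime[2] (2∤g^ d) (odd-oddₗ y)) (≈-trans (oddₗ-≈ (g ^ d * y)) (≈-*ˡ (g ^ d) (≈-sym (oddₗ-≈ y))))

  shift-even : ∀ y → evenₗ (g ^ d * y) ≈ g ^ d * evenₗ y [ n ]
  shift-even y = ≈-even (even-evenₗ (g ^ d * y)) (∣n⇒∣m*n (g ^ d) (even-evenₗ y)) (≈-trans (evenₗ-≈ (g ^ d * y)) (≈-*ˡ (g ^ d) (≈-sym (evenₗ-≈ y))))

  -- Away from the multiples of q this is `blockAt-blockTab`, applied to membership of the odd and
  -- of the even lift: the lifts commute with g^d modulo n. An even multiple of q is 0, absent from
  -- Ω by hypothesis, and an odd one is q.
  toSet-fromSet : ∀ Ω → at Ω 0 ≡ false → iter T d Ω ≡ Ω → toSet (fromSet Ω) ≡ Ω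
  toSet-fromSet Ω Ω0 fixed = at-ext λ x → trans (at-toSet (fromSet Ω) x) (go x (2 ∣? x) (q ∣? x))
    where
    X Y : Block
    X = tabB (λ y → at Ω (oddₗ y))
    Y = tabB (λ y → at Ω (evenₗ y))
    X-at : ∀ x → q ∤ x → atB X x ≡ at Ω (oddₗ x)
    X-at = blockAt-blockTab lengths {d} (suc M) (λ y → at Ω (oddₗ y)) fits
      (λ {x} {y} e → at-≈ Ω (≈oddₗ (odd-oddₗ x) (≈-trans (oddₗ-≈ x) e)))
      (λ y → trans (at-≈ Ω (shift-odd y)) (fixed⇒ {d} fixed (oddₗ y)))
    Y-at : ∀ x → q ∤ x → atB Y x ≡ at Ω (evenₗ x)
    Y-at = blockAt-blockTab lengths {d} (suc M) (λ y → at Ω (evenₗ y)) fits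
      (λ {x} {y} e → at-≈ Ω (≈evenₗ (even-evenₗ x) (≈-trans (evenₗ-≈ x) e)))
      (λ y → trans (at-≈ Ω (shift-even y)) (fixed⇒ {d} fixed (evenₗ y)))
    go : ∀ x → Dec (2 ∣ x) → Dec (q ∣ x) → elt (fromSet Ω) x ≡ at Ω x
    go x (yes 2∣x) (yes q∣x) = trans (elt-even X Y _ 2∣x) (trans (atB-q Y q∣x) (sym (trans (at-≈ Ω (≈-even 2∣x (2 ∣0) (∣⇒≈0 q∣x))) Ω0)))
    go x (yes 2∣x) (no q∤x)  = trans (elt-even X Y _ 2∣x) (trans (Y-at x q∤x) (at-≈ Ω (≈-sym (≈evenₗ 2∣x ≈-refl))))
    go x (no 2∤x)  (yes q∣x) = trans (elt-q X Y _ 2∤x q∣x) (at-≈ Ω (≈-odd 2∤q 2∤x (≈-trans (∣⇒≈0 ∣-refl) (≈-sym (∣⇒≈0 q∣x)))))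
    go x (no 2∤x)  (no q∤x)  = trans (elt-odd X Y _ 2∤x q∤x) (trans (X-at x q∤x) (at-≈ Ω (≈-sym (≈oddₗ 2∤x ≈-refl))))

  q∤-resp : ∀ {x y} → x ≈ y [ q ] → q ∤ y → q ∤ x
  q∤-resp e q∤y = q∤y ∘ ∣-resp-≈ ∣-refl e

  elt-oddₗ : ∀ X Y z y → q ∤ y → elt ((X , Y) , z) (oddₗ y) ≡ atB X y
  elt-oddₗ X Y z y q∤y = trans (elt-odd X Y z (odd-oddₗ y) (q∤-resp (oddₗ-≈ y) q∤y)) (atB-≈ X (oddₗ-≈ y))

  elt-evenₗ : ∀ X Y z y → elt ((X , Y) , z) (evenₗ y) ≡ atB Y y
  elt-evenₗ X Y z y = trans (elt-even X Y z (even-evenₗ y)) (atB-≈ Y (evenₗ-≈ y))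

  fromSet-toSet : ∀ t → fromSet (toSet t) ≡ t
  fromSet-toSet ((X , Y) , z) = cong₂ _,_ (cong₂ _,_
      (trans (blockTab-cong lengths (suc M) λ y q∤y → trans (at-toSet t (oddₗ y)) (elt-oddₗ X Y z y q∤y)) (blockTab-blockAt lengths (suc M) X fits))
      (trans (blockTab-cong lengths (suc M) λ y _ → trans (at-toSet t (evenₗ y)) (elt-evenₗ X Y z y)) (blockTab-blockAt lengths (suc M) Y fits)))
    (trans (at-toSet t q) (elt-q X Y z 2∤q ∣-refl))
    where
    t : Tuple
    t = (X , Y) , z

  toSet-fixed : ∀ t → iter T d (toSet t) ≡ toSet t
  toSet-fixed t = ⇒fixed {d} λ x → trans (at-toSet t (g ^ d * x)) (trans (invariant x) (sym (at-toSet t x)))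
    where
    q∣g^d* : ∀ x → q ∣ g ^ d * x → q ∣ x
    q∣g^d* x q∣ = ≈0⇒∣ (Inv-cancel (g ^ d) (Inv-^ d (g-Inv (suc M))) (≈-trans (∣⇒≈0 q∣) (≈-reflexive (sym (*-zeroʳ (g ^ d))))))
    invariant : ∀ x → elt t (g ^ d * x) ≡ elt t x
    invariant x = elt-cong t (λ 2∣ → [ (λ e → contradiction e (2∤g^ d)) , id ]′ (euclidsLemma (g ^ d) x prime[2] 2∣)) (∣n⇒∣m*n (g ^ d))
      (q∣g^d* x) (∣n⇒∣m*n (g ^ d)) (λ X → blockAt-invariant lengths (suc M) X fits x)

  toSet-Good : ∀ t → Generating t → Good (toSet t)
  toSet-Good t@((X@(A , C) , Y@(B , E)) , z) (odd , unit) = sym-t , zero-t , contains-odd odd , contains-unit unit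
    where
    sym-t : iter T h (toSet t) ≡ toSet t
    -- Symmetry comes for free: a set fixed by g^d is fixed by g^h, as d divides h.
    sym-t = let open _∣_ d∣h in trans (cong (λ j → iter T j (toSet t)) equality) (iter-fixed T d quotient (toSet-fixed t))
    zero-t : at (toSet t) 0 ≡ false
    zero-t = trans (at-toSet t 0) (trans (elt-even X Y z (2 ∣0)) (atB-q Y (q ∣0)))
    contains-odd : X ≢ empty lengths (suc M) ⊎ z ≡ true → Contains∤ 2 (toSet t)
    contains-odd (inj₁ X≢) = let y , Xy = blockAt-nonempty lengths (suc M) X fits X≢ in
      contains∤ {Ω = toSet t} 2∣n (oddₗ y) (odd-oddₗ y) (trans (at-toSet t (oddₗ y)) (trans (elt-oddₗ X Y z y (λ q∣y → case trans (sym Xy) (atB-q X q∣y) of λ ())) Xy))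
    contains-odd (inj₂ z≡) = contains∤ {Ω = toSet t} 2∣n q 2∤q (trans (at-toSet t q) (trans (elt-q X Y z 2∤q ∣-refl) z≡))
    contains-unit : A ≢ replicate d false ⊎ B ≢ replicate d false → Contains∤ p (toSet t)
    contains-unit (inj₁ A≢) = let y , p∤y , Xy = blockAt-head lengths M A C fits A≢ in
      contains∤ {Ω = toSet t} p∣n (oddₗ y) (p∤y ∘ ∣-resp-≈ p∣q (oddₗ-≈ y)) (trans (at-toSet t (oddₗ y)) (trans (elt-oddₗ X Y z y (p∤y ∘ ∣-trans p∣q)) Xy))
    contains-unit (inj₂ B≢) = let y , p∤y , Yy = blockAt-head lengths M B E fits B≢ in
      contains∤ {Ω = toSet t} p∣n (evenₗ y) (p∤y ∘ ∣-resp-≈ p∣q (evenₗ-≈ y)) (trans (at-toSet t (evenₗ y)) (trans (elt-evenₗ X Y z y) Yy))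

  toSet-Generating : ∀ t → Good (toSet t) → Generating t
  toSet-Generating t@((X@(A , C) , Y@(B , E)) , z) (_ , _ , (x , _ , 2∤x , tx) , (y , _ , p∤y , ty)) =
    odd (q ∣? x) (trans (sym (at-toSet t x)) tx) , unit (2 ∣? y) (trans (sym (at-toSet t y)) ty)
    where
    odd : Dec (q ∣ x) → elt t x ≡ true → X ≢ empty lengths (suc M) ⊎ z ≡ true
    odd (yes q∣x) tx = inj₂ (trans (sym (elt-q X Y z 2∤x q∣x)) tx)
    odd (no q∤x)  tx = inj₁ λ X≡ → case trans (sym tx) (trans (elt-odd X Y z 2∤x q∤x) (trans (cong (λ X → atB X x) X≡) (blockAt-empty lengths (suc M) x))) of λ ()
    unit : Dec (2 ∣ y) → elt t y ≡ true → A ≢ replicate d false ⊎ B ≢ replicate d false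
    unit (yes 2∣y) ty = inj₂ (blockAt-head-true lengths M B E p∤y (trans (sym (elt-even X Y z 2∣y)) ty))
    unit (no 2∤y)  ty = inj₁ (blockAt-head-true lengths M A C p∤y (trans (sym (elt-odd X Y z 2∤y (p∤y ∘ ∣-trans p∣q))) ty))

  -- Exactly one of x and q + x is even, q being odd; modulo n the two are the even and the odd lift
  -- of x, in an order that depends on the parity of x.
  ∑-parity : ∀ (f : ℕ → ℕ) → (∀ {x y} → x ≈ y [ n ] → f x ≡ f y) → ∑< n f ≡ ∑< q (f ∘ evenₗ) + ∑< q (f ∘ oddₗ)
  ∑-parity f resp = begin
    ∑< n f                                  ≡⟨ cong (λ n → ∑< n f) (trans n≡ (cong (q +_) (+-identityʳ q))) ⟩
    ∑< (q + q) f                            ≡⟨ ∑<-+ q q f ⟩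
    ∑< q f + ∑< q (λ x → f (q + x))         ≡⟨ ∑-+ (upTo q) f (λ x → f (q + x)) ⟨
    ∑< q (λ x → f x + f (q + x))            ≡⟨ ∑-cong (upTo q) (λ x → pair x (2 ∣? x)) ⟩
    ∑< q (λ x → f (evenₗ x) + f (oddₗ x))   ≡⟨ ∑-+ (upTo q) (f ∘ evenₗ) (f ∘ oddₗ) ⟩
    ∑< q (f ∘ evenₗ) + ∑< q (f ∘ oddₗ) ∎
    where
    open ≡-Reasoning
    q+x≈x : ∀ x → q + x ≈ x [ q ]
    q+x≈x x = ≈-trans (≈-reflexive (+-comm q x)) (∣⇒+-≈ x ∣-refl)
    pair : ∀ x → Dec (2 ∣ x) → f x + f (q + x) ≡ f (evenₗ x) + f (oddₗ x)
    pair x (yes 2∣x) = cong₂ _+_ (resp (≈evenₗ 2∣x ≈-refl))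
      (resp (≈oddₗ (λ 2∣q+x → 2∤q (∣m+n∣m⇒∣n (subst (2 ∣_) (+-comm q x) 2∣q+x) 2∣x)) (q+x≈x x)))
    pair x (no 2∤x)  = trans (+-comm (f x) (f (q + x))) (cong₂ _+_
      (resp (≈evenₗ (≈0⇒∣ (≈-trans (≈-+ (odd-≈ 2∤q 2∤1) (odd-≈ 2∤x 2∤1)) (∣⇒≈0 ∣-refl))) (q+x≈x x))) (resp (≈oddₗ 2∤x ≈-refl)))

  size-toSet : ∀ t → ∣ toSet t ∣ ≡ weightT t
  size-toSet t@((X , Y) , z) = begin
    ∣ toSet t ∣                                          ≡⟨ size-∑ (toSet t) ⟩
    ∑< n (λ x → ⟦ at (toSet t) x ⟧)                      ≡⟨ ∑-cong (upTo n) (λ x → cong ⟦_⟧ (at-toSet t x)) ⟩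
    ∑< n (λ x → ⟦ elt t x ⟧)                             ≡⟨ ∑-parity (λ x → ⟦ elt t x ⟧) (λ e → cong ⟦_⟧ (elt-≈ t e)) ⟩
    ∑< q (λ y → ⟦ elt t (evenₗ y) ⟧) + ∑< q (λ y → ⟦ elt t (oddₗ y) ⟧)
      ≡⟨ cong₂ _+_ (trans (∑-cong (upTo q) λ y → cong ⟦_⟧ (elt-evenₗ X Y z y)) (∑-blockAt shifts lengths (suc M) Y fits lens)) odd-part ⟩
    weights shifts lengths (suc M) Y + (weights shifts lengths (suc M) X + ⟦ z ⟧)
      ≡⟨ r (weights shifts lengths (suc M) Y) (weights shifts lengths (suc M) X) ⟦ z ⟧ ⟩
    weightT t ∎
    where
    open ≡-Reasoning
    r : ∀ y x z → y + (x + z) ≡ x + y + z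
    r = solve-∀
    0<q : 0 < q
    0<q = m^n>0 p (suc M)
    -- At y = 0 the odd lift is q, governed by z, while the block function is false there.
    pointwise : ∀ y → y < q → (dec : Dec (y ≡ 0)) → ⟦ elt t (oddₗ y) ⟧ ≡ ⟦ atB X y ⟧ + ind dec * ⟦ z ⟧
    pointwise y y<q (yes refl) = trans (cong ⟦_⟧ (elt-q X Y z (odd-oddₗ 0) (∣-resp-≈ ∣-refl (≈-sym (oddₗ-≈ 0)) (q ∣0))))
      (sym (trans (cong₂ _+_ (cong ⟦_⟧ (atB-q X (q ∣0))) (+-identityʳ ⟦ z ⟧)) refl))
    pointwise y y<q (no y≢0) = trans (cong ⟦_⟧ (elt-oddₗ X Y z y λ q∣y → <⇒≱ y<q (∣⇒≤ {{≢-nonZero y≢0}} q∣y))) (sym (+-identityʳ ⟦ atB X y ⟧))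
    odd-part : ∑< q (λ y → ⟦ elt t (oddₗ y) ⟧) ≡ weights shifts lengths (suc M) X + ⟦ z ⟧
    odd-part = trans (∑<-cong q λ y y<q → pointwise y y<q (y ≟ 0)) (trans (∑-+ (upTo q) (λ y → ⟦ atB X y ⟧) (λ y → ind (y ≟ 0) * ⟦ z ⟧))
      (cong₂ _+_ (∑-blockAt shifts lengths (suc M) X fits lens)
        (trans (∑<-single q 0 0<q (λ y _ y≢0 → cong (_* ⟦ z ⟧) (ind-no (y ≟ 0) y≢0))) (+-identityʳ ⟦ z ⟧))))

  count-fixed : (F : Subset n → ℕ) → ∑ (vecs n) (λ Ω → ind (Good? Ω ×-dec (iter T d Ω ≟V Ω)) * F Ω) ≡
                ∑ tuples (λ t → ind (Generating? t) * F (toSet t))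
  count-fixed F = ∑-bijection {_≟A_ = _≟V_} {_≟T_} (Enum-vecs n) Enum-tuples (λ Ω → Good? Ω ×-dec (iter T d Ω ≟V Ω)) Generating? toSet fromSet
    (λ { Ω ((_ , Ω0 , _) , fixed) → toSet-fromSet Ω Ω0 fixed }) (λ t _ → fromSet-toSet t)
    (λ t gen → toSet-Good t gen , toSet-fixed t) (λ { t (good , _) → toSet-Generating t good }) F

  count-size : ∀ k → ∑ (vecs n) (λ Ω → ind (Good? Ω ×-dec (iter T d Ω ≟V Ω)) * ind (∣ Ω ∣ ≟ k)) ≡ bracket p (suc M) d k
  count-size k = trans (count-fixed (λ Ω → ind (∣ Ω ∣ ≟ k)))
    (trans (∑-cong tuples λ t → cong (λ w → ind (Generating? t) * ind (w ≟ k)) (size-toSet t)) (L.gf-Generating k))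

  count-all : ∑ (vecs n) (λ Ω → ind (Good? Ω ×-dec (iter T d Ω ≟V Ω)) * 1) ≡
              2 ^ (d + 1) * (2 ^ d ∸ 1) * prodK (suc M) (λ k → 2 ^ (2 * gk p (suc M) d k))
              + (2 ^ d ∸ 1) * (2 * prodK (suc M) (λ k → 2 ^ gk p (suc M) d k) ∸ 1) * prodK (suc M) (λ k → 2 ^ gk p (suc M) d k)
  count-all = trans (count-fixed (λ _ → 1)) (trans (∑-cong tuples λ t → *-identityʳ (ind (Generating? t))) (trans L.count-Generating (cong₂ _+_
      (trans (r (2 ^ d ∸ 1) (2 ^ d) Π) (cong₂ (λ a b → a * (2 ^ d ∸ 1) * b) (trans (*-comm 2 (2 ^ d)) (sym (^-distribˡ-+-* 2 d 1))) (sym (squares (upTo M)))))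
      (cong (λ w → (2 ^ d ∸ 1) * (w ∸ 1) * Π) (*-comm Π 2)))))
    where
    Π : ℕ
    Π = prodK (suc M) (λ k → 2 ^ gk p (suc M) d k)
    r : ∀ a b c → a * b * c * c * 2 ≡ 2 * b * a * (c * c)
    r = solve-∀
    r′ : ∀ a b → a * a * (b * b) ≡ a * b * (a * b)
    r′ = solve-∀
    squares : ∀ (l : List ℕ) → product (map (λ j → 2 ^ (2 * lengths (suc j))) l) ≡ product (map (λ j → 2 ^ lengths (suc j)) l) * product (map (λ j → 2 ^ lengths (suc j)) l)
    squares []      = refl
    squares (j ∷ l) = trans (cong₂ _*_ (trans (cong (2 ^_) (cong (lengths (suc j) +_) (+-identityʳ _))) (^-distribˡ-+-* 2 (lengths (suc j)) (lengths (suc j)))) (squares l))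
      (r′ (2 ^ lengths (suc j)) (product (map (λ j → 2 ^ lengths (suc j)) l)))

-- Counting orbits

module Classes (p : ℕ) (pr : Prime p) (p-odd : p % 2 ≡ 1) (M n′ : ℕ) (n≡ : suc n′ ≡ 2 * p ^ suc M) where

  open Sets p pr p-odd M n′ n≡

  module Orbits (S : Subset n → Set) (S? : ∀ Ω → Dec (S Ω)) (S-T : ∀ Ω → S Ω → S (T Ω)) where

    open Burnside _≟V_ (vecs n) (Enum-vecs n) T h 0<h (λ Ω → Good Ω × S Ω) (λ Ω → Good? Ω ×-dec S? Ω)
      (λ Ω (good , s) → Good-T Ω good , S-T Ω s) (λ Ω (good , _) → proj₁ good)
      public

    classes : ℕ
    classes = length reps

    numClasses : NumClasses S classes
    numClasses = lookup reps , member , separate , cover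
      where
      member : ∀ i → Admissible (lookup reps i) × S (lookup reps i)
      member i = let (good , s) , _ = reps-Rep i in Good⇒Admissible good , s
      separate : ∀ i j → WeakEquiv (lookup reps i) (lookup reps j) → i ≡ j
      -- A weak equivalence from the i-th to the j-th set exhibits the i-th as an iterate of the
      -- j-th, whence the exchanged indices.
      separate i j w = let t , eq = WeakEquiv⇒iterate w in sym (reps-separate j i (orbit-any t (proj₁ (reps-Rep j)) eq))
      cover : ∀ Ω → Admissible Ω → S Ω → ∃[ i ] WeakEquiv Ω (lookup reps i)
      cover Ω adm s = let i , t , _ , eq = reps-cover Ω (Admissible⇒Good adm , s) in i , subst (WeakEquiv Ω) eq (iterate⇒WeakEquiv t Ω)

    fixed-gcd : ∀ i → fixed i ≡ fixed (gcd i h)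
    fixed-gcd i = ∑-cong (vecs n) λ Ω → ind-cong ((Good? Ω ×-dec S? Ω) ×-dec (iter T i Ω ≟V Ω)) ((Good? Ω ×-dec S? Ω) ×-dec (iter T (gcd i h) Ω ≟V Ω))
      (λ { (r@(good , _) , eq) → r , iter-gcd T i h eq (proj₁ good) })
      (λ { (r , eq) → r , multiple Ω (gcd[m,n]∣m i h) eq })
      where
      multiple : ∀ Ω {a b} → a ∣ b → iter T a Ω ≡ Ω → iter T b Ω ≡ Ω
      multiple Ω (divides k refl) eq = iter-fixed T _ k eq

    fixed-split : ∀ d → fixed d ≡ ∑ (vecs n) (λ Ω → ind (Good? Ω ×-dec (iter T d Ω ≟V Ω)) * ind (S? Ω))
    fixed-split d = ∑-cong (vecs n) λ Ω → trans (ind-cong ((Good? Ω ×-dec S? Ω) ×-dec (iter T d Ω ≟V Ω)) ((Good? Ω ×-dec (iter T d Ω ≟V Ω)) ×-dec S? Ω)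
      (λ { ((a , b) , c) → (a , c) , b }) (λ { ((a , c) , b) → (a , b) , c })) (ind-× (Good? Ω ×-dec (iter T d Ω ≟V Ω)) (S? Ω))

    -- By Burnside's lemma, with the exponents i = 1 , … , h grouped by gcd(i, h).
    classes-∑ : (G : ℕ → ℕ) → (∀ d → d ≢ 0 → d ∣ h → fixed d ≡ G d) →
                h * classes ≡ ∑< (φ (p ^ suc M) / 2) (λ i → ind (suc i ∣? (φ (p ^ suc M) / 2)) * (φ (φ (p ^ suc M) div (2 * suc i)) * G (suc i)))
    classes-∑ G G≡ = begin
      h * classes                           ≡⟨ burnside ⟩
      ∑< h (λ i → fixed (suc i))            ≡⟨ ∑-cong (upTo h) (λ i → fixed-gcd (suc i)) ⟩
      ∑< h (λ i → fixed (gcd (suc i) h))    ≡⟨ ∑<-gcd h fixed ⟩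
      ∑< h (λ i → ind (suc i ∣? h) * (φ (h div suc i) * fixed (suc i)))
        ≡⟨ ∑-cong (upTo h) (λ i → ind-*-cong (suc i ∣? h) λ i∣h → cong₂ _*_ (cong φ (double i i∣h)) (G≡ (suc i) 1+n≢0 i∣h)) ⟩
      ∑< h (term h)                         ≡⟨ cong (λ x → ∑< x (term x)) φ/2 ⟨
      ∑< (φ (p ^ suc M) / 2) (term (φ (p ^ suc M) / 2)) ∎
      where
      open ≡-Reasoning
      term : ℕ → ℕ → ℕ
      term x i = ind (suc i ∣? x) * (φ (φ (p ^ suc M) div (2 * suc i)) * G (suc i))
      φ≡ : φ (p ^ suc M) ≡ 2 * h
      φ≡ = trans (φ-prime-power M) o≡2h
      φ/2 : φ (p ^ suc M) / 2 ≡ h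
      φ/2 = trans (cong (_/ 2) (trans φ≡ (*-comm 2 h))) (m*n/n≡m h 2)
      double : ∀ i → suc i ∣ h → h div suc i ≡ φ (p ^ suc M) div (2 * suc i)
      double i (divides e h≡) = trans (trans (cong (_div suc i) h≡) (div-∣ e i))
        (sym (trans (cong (_div (2 * suc i)) (trans φ≡ (trans (cong (2 *_) h≡) (r e (suc i))))) (div-∣ e (i + suc (i + 0)))))
        where
        r : ∀ e i → 2 * (e * i) ≡ e * (2 * i)
        r = solve-∀

  module OfSize (k : ℕ) = Orbits (λ Ω → ∣ Ω ∣ ≡ k) (λ Ω → ∣ Ω ∣ ≟ k) (λ Ω eq → trans (size-T Ω) eq)

  module AnySize = Orbits (λ _ → ⊤) (λ _ → yes tt) (λ _ _ → tt)

  m : ℕ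
  m = suc M

  RHSpoly≡ : ∀ k → h * OfSize.classes k ≡ RHSpoly p m k
  RHSpoly≡ k = trans (OfSize.classes-∑ k (λ d → bracket p m d k)
      (λ d d≢0 d∣h → trans (OfSize.fixed-split k d) (FixedSets.count-size p pr p-odd M n′ n≡ d d≢0 d∣h k)))
    (sym (trans (psum-at (filter (λ i → suc i ∣? X) (upTo X)) (λ i → pscale (φ (φ (p ^ m) div (2 * suc i))) (bracket p m (suc i))) k)
      (∑-filter (λ i → suc i ∣? X) (upTo X) _)))
    where
    X : ℕ
    X = φ (p ^ m) / 2

  RHSnum≡ : h * AnySize.classes ≡ RHSnum p m
  RHSnum≡ = trans (AnySize.classes-∑ total (λ d d≢0 d∣h → trans (AnySize.fixed-split d) (FixedSets.count-all p pr p-odd M n′ n≡ d d≢0 d∣h)))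
    (sym (trans (∑-sum (filter (λ i → suc i ∣? X) (upTo X)) _) (∑-filter (λ i → suc i ∣? X) (upTo X) _)))
    where
    X : ℕ
    X = φ (p ^ m) / 2
    total : ℕ → ℕ
    total d = 2 ^ (d + 1) * (2 ^ d ∸ 1) * prodK m (λ k → 2 ^ (2 * gk p m d k))
              + (2 ^ d ∸ 1) * (2 * prodK m (λ k → 2 ^ gk p m d k) ∸ 1) * prodK m (λ k → 2 ^ gk p m d k)

  -- Burnside divides by h, half of p^(m-1)(p-1); this is the origin of the factor 2.
  order-scale : ∀ c r → h * c ≡ r → p ^ (m ∸ 1) * (p ∸ 1) * c ≡ 2 * r
  order-scale c r eq = trans (cong (_* c) o≡2h) (trans (*-assoc 2 h c) (cong (2 *_) eq))

  -- Possible sizes and the sum over all sizes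

  ⟦⟧≤1 : ∀ b → ⟦ b ⟧ ≤ 1
  ⟦⟧≤1 false = z≤n
  ⟦⟧≤1 true  = ≤-refl

  Good-size : ∀ {Ω} → Good Ω → 0 < ∣ Ω ∣ × ∣ Ω ∣ ≤ n′
  Good-size {Ω} (_ , Ω0 , (x , x<n , _ , Ωx) , _) =
    subst (0 <_) (sym (size-∑ Ω)) (≤-trans (≤-reflexive (cong ⟦_⟧ (sym Ωx))) (∑<-≥ n (λ x → ⟦ at Ω x ⟧) x x<n)) ,
    ≤-trans (≤-reflexive (trans (size-∑ Ω) (trans (∑<-suc n′ (λ x → ⟦ at Ω x ⟧)) (cong (λ b → ⟦ b ⟧ + ∑< n′ (λ x → ⟦ at Ω (suc x) ⟧)) Ω0))))
      (≤-trans (∑-mono (upTo n′) (λ x → ⟦⟧≤1 (at Ω (suc x)))) (≤-reflexive (trans (∑<-const n′ 1) (*-identityʳ n′))))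

  -- A class would have a representative of impossible size. Since h times this number is the k-th
  -- coefficient of `RHSpoly`, that polynomial has no terms outside 1 , ... , n - 1.
  no-classes : ∀ k → k ≡ 0 ⊎ n ≤ k → OfSize.classes k ≡ 0
  no-classes k out = go (OfSize.classes k) (OfSize.numClasses k)
    where
    go : ∀ c → NumClasses (λ Ω → ∣ Ω ∣ ≡ k) c → c ≡ 0
    go zero    _               = refl
    go (suc c) (r , member , _) =
      let adm , size = member Fin.zero
          pos , small = Good-size (Admissible⇒Good adm)
      in [ (λ k≡0 → contradiction (trans size k≡0) (n>0⇒n≢0 pos)) , (λ n≤k → contradiction n≤k (<⇒≱ (s≤s (subst (_≤ n′) size small)))) ]′ out

  -- `rep` searches the same list for the same orbits whatever the property `S` is, so both counts
  -- choose the same representatives, and each of these has exactly one size.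
  classes-sum : AnySize.classes ≡ ∑< n′ (λ i → OfSize.classes (suc i))
  classes-sum = begin
    AnySize.classes                                             ≡⟨ length-filter-∑ AnySize.Rep? (vecs n) ⟩
    ∑ (vecs n) (λ Ω → ind (AnySize.Rep? Ω))                     ≡⟨ ∑-cong (vecs n) (λ Ω → pointwise Ω (AnySize.Rep? Ω)) ⟩
    ∑ (vecs n) (λ Ω → ∑< n′ (λ i → ind (OfSize.Rep? (suc i) Ω))) ≡⟨ ∑-swap (vecs n) (upTo n′) (λ Ω i → ind (OfSize.Rep? (suc i) Ω)) ⟩
    ∑< n′ (λ i → ∑ (vecs n) (λ Ω → ind (OfSize.Rep? (suc i) Ω))) ≡⟨ ∑-cong (upTo n′) (λ i → length-filter-∑ (OfSize.Rep? (suc i)) (vecs n)) ⟨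
    ∑< n′ (λ i → OfSize.classes (suc i)) ∎
    where
    open ≡-Reasoning
    pointwise : ∀ Ω (dec : Dec ((Good Ω × ⊤) × AnySize.rep Ω ≡ Ω)) → ind dec ≡ ∑< n′ (λ i → ind (OfSize.Rep? (suc i) Ω))
    pointwise Ω (no ¬r)  = sym (∑-zero (upTo n′) λ i → ind-no (OfSize.Rep? (suc i) Ω) λ { ((good , _) , eq) → ¬r ((good , tt) , eq) })
    pointwise Ω (yes ((good , _) , eq)) = sym (trans
      (∑<-single n′ (pred ∣ Ω ∣) (≤-trans (≤-reflexive size≡) (proj₂ (Good-size good)))
        (λ i _ i≢ → ind-no (OfSize.Rep? (suc i) Ω) λ { ((_ , size) , _) → i≢ (sym (cong pred size)) }))
      (ind-yes (OfSize.Rep? (suc (pred ∣ Ω ∣)) Ω) ((good , sym size≡) , eq)))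
      where
      size≡ : suc (pred ∣ Ω ∣) ≡ ∣ Ω ∣
      size≡ = suc-pred ∣ Ω ∣ {{>-nonZero (proj₁ (Good-size good))}}

-- The modulus is a separate argument so that the proof can take it as a successor, on which `IsAwK`
-- and `IsEw` unfold; the result is then transported to `2 * p ^ m`.
Conclusion : ℕ → ℕ → ℕ → Set
Conclusion p m n =
    ( (∀ k → 1 ≤ k → k ≤ n ∸ 1 → ∃ λ N → IsAwK n k N × p ^ (m ∸ 1) * (p ∸ 1) * N ≡ 2 * RHSpoly p m k)
    × (∀ k → (k ≡ 0 ⊎ n ≤ k) → RHSpoly p m k ≡ 0) )
  × (∃ λ N → IsEw n N
      × (∃ λ coeffs → (∀ k → 1 ≤ k → k ≤ n ∸ 1 → IsAwK n k (coeffs k)) × N ≡ sumRange 1 (n ∸ 1) coeffs)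
      × p ^ (m ∸ 1) * (p ∸ 1) * N ≡ 2 * RHSnum p m)

conclusion : ∀ p M → Prime p → p % 2 ≡ 1 → ∀ n′ → suc n′ ≡ 2 * p ^ suc M → Conclusion p (suc M) (suc n′)
conclusion p M pr p-odd n′ n≡ =
    ( (λ k _ _ → OfSize.classes k , OfSize.numClasses k , order-scale (OfSize.classes k) (RHSpoly p m k) (RHSpoly≡ k))
    , (λ k out → trans (sym (RHSpoly≡ k)) (trans (cong (h *_) (no-classes k out)) (*-zeroʳ h))) )
  , ( AnySize.classes , AnySize.numClasses
    , ((λ k → OfSize.classes k) , (λ k _ _ → OfSize.numClasses k) , trans classes-sum (sym (∑-sum (upTo n′) (λ i → OfSize.classes (suc i)))))
    , order-scale AnySize.classes (RHSnum p m) RHSnum≡ )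
  where
  open Classes p pr p-odd M n′ n≡
  open Sets p pr p-odd M n′ n≡ using (h)

theorem4p4 : ∀ (p m : ℕ) → Prime p → p % 2 ≡ 1 → 1 ≤ m →
    -- coefficientwise: Ψ^w(x) = 2/(p^{m-1}(p-1)) · RHSpoly(x)
    ( (∀ k → 1 ≤ k → k ≤ 2 * p ^ m ∸ 1 →
        ∃ λ N → IsAwK (2 * p ^ m) k N
              × p ^ (m ∸ 1) * (p ∸ 1) * N ≡ 2 * RHSpoly p m k)
    × (∀ k → (k ≡ 0 ⊎ 2 * p ^ m ≤ k) → RHSpoly p m k ≡ 0) )
    -- 𝓔^w = Ψ^w(1) = 2/(p^{m-1}(p-1)) · RHSnum
  × (∃ λ N → IsEw (2 * p ^ m) N
           × (∃ λ coeffs → (∀ k → 1 ≤ k → k ≤ 2 * p ^ m ∸ 1 → IsAwK (2 * p ^ m) k (coeffs k))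
                          × N ≡ sumRange 1 (2 * p ^ m ∸ 1) coeffs)
           × p ^ (m ∸ 1) * (p ∸ 1) * N ≡ 2 * RHSnum p m)
theorem4p4 p zero    pr p-odd ()
theorem4p4 p (suc M) pr p-odd _ = subst (Conclusion p (suc M)) n≡ (conclusion p M pr p-odd (pred (2 * p ^ suc M)) n≡)
  where
  n≡ : suc (pred (2 * p ^ suc M)) ≡ 2 * p ^ suc M
  n≡ = suc-pred (2 * p ^ suc M) {{m*n≢0 2 (p ^ suc M) {{_}} {{m^n≢0 p (suc M) {{prime⇒nonZero pr}}}}}}
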